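{- The decision version of the Threshold Bike Spreading (T-BS) problem is NP-complete. This decision problem is: given a directed weighted graph $G=(V,E)$ with $n=|V|$, rational edge probabilities $p_e$ satisfying the normalization condition below, and integers $k, L, \gamma, \tau, \lambda$ with $0<k<n$, $L\ge 1$, $\gamma>0$, $\tau\ge 1$, $0<\lambda\le n$, decide whether there exists a seed set $S\subseteq V$ with $|S|=k$ such that $\sigma_T(S) := |\{v\in V : \ell(v,\tau,S)\ge \gamma\}| \ge \lambda$.
   Context: A mobility graph is a directed graph $G=(V,E)$ (self-loops allowed) with a probability $p_e\in[0,1]$ on each edge $e$, such that for each $u\in V$, $\sum_{v\in\Gamma^{OUT}(u)} p_{(u,v)}=1$, where $\Gamma^{OUT}(u)=\{w:(u,w)\in E\}$ and $\Gamma^{IN}(v)=\{w:(w,v)\in E\}$. For a seed set $S\subseteq V$ and integer $L\ge1$, the loads are defined by $\ell(v,0,S)=L$ if $v\in S$, $\ell(v,0,S)=0$ otherwise, and for $t\ge1$, $\ell(v,t,S)=\sum_{u\in\Gamma^{IN}(v)} p_{(u,v)}\,\ell(u,t-1,S)$ for all $v\in V$. -}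

module Defs where

open import Data.Bool using (Bool; true; false; T; if_then_else_)
open import Data.Fin using (Fin)
open import Data.Fin.Subset as Subset using (Subset)
open import Data.Integer as ℤ using (+_)
open import Data.List using (List; []; _∷_; _++_; length; map; foldr; replicate; concatMap; allFin; filter; filterᵇ)
open import Data.Maybe using (Maybe; just; nothing)
open import Data.Nat using (ℕ; zero; suc; _+_; _*_; _≤_; _<_; _≥_)
open import Data.Nat.Binary using (ℕᵇ; 2[1+_]; 1+[2_]; fromℕ)
open import Data.Product using (Σ; ∃; _×_; _,_)
open import Data.Rational.Unnormalised as ℚ using (ℚᵘ; 0ℚᵘ; 1ℚᵘ; _≃_; ↥_; ↧ₙ_)
open import Data.Rational.Unnormalised.Properties using (_≤?_)
open import Data.Vec as Vec using (Vec; lookup)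
open import Function.Bundles using (_⇔_)
open import Relation.Binary.PropositionalEquality using (_≡_)

data Symbol (extra : ℕ) : Set where
  blank : Symbol extra
  bit   : Bool → Symbol extra
  aux   : Fin extra → Symbol extra

data Move : Set where
  left stay right : Move

-- A two-way infinite tape: `before` lists the cells to the left of the head,
-- nearest first, `after` those to its right; all further cells are blank.
record Tape (extra : ℕ) : Set where
  constructor tape
  field
    before  : List (Symbol extra)
    current : Symbol extra
    after   : List (Symbol extra)

module _ {extra : ℕ} where

  fromCells : (before fromHead : List (Symbol extra)) → Tape extra
  fromCells ls []       = tape ls blank []
  fromCells ls (x ∷ xs) = tape ls x xs

  moveHead : Move → Tape extra → Tape extra
  moveHead stay  t                    = t
  moveHead right (tape ls x rs)       = fromCells (x ∷ ls) rs
  moveHead left  (tape [] x rs)       = tape [] blank (x ∷ rs)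
  moveHead left  (tape (l ∷ ls) x rs) = tape ls l (x ∷ rs)

  act : Tape extra → Symbol extra × Move → Tape extra
  act (tape ls _ rs) (y , m) = moveHead m (tape ls y rs)

  bitPrefix : List (Symbol extra) → List Bool
  bitPrefix (bit b ∷ xs) = b ∷ bitPrefix xs
  bitPrefix _            = []

-- The machine halts exactly when the transition function returns `nothing`.
-- The first tape is the input/output tape.
record TM : Set where
  field
    states workTapes extra : ℕ
    start     : Fin states
    accepting : Fin states → Bool
    δ         : Fin states → Vec (Symbol extra) (suc workTapes) →
                Maybe (Fin states × Vec (Symbol extra × Move) (suc workTapes))

module _ (M : TM) where
  open TM M

  record Config : Set where
    constructor config
    field
      state : Fin states
      tapes : Vec (Tape extra) (suc workTapes)

  open Config

  initial : List Bool → Config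
  initial w = config start
    (fromCells [] (map bit w) Vec.∷ Vec.replicate workTapes (fromCells [] []))

  step : Config → Maybe Config
  step (config q ts) with δ q (Vec.map Tape.current ts)
  ... | nothing          = nothing
  ... | just (q′ , acts) = just (config q′ (Vec.zipWith act ts acts))

  -- The halting configuration reached from c, if it is reached in at most
  -- the given number of steps.
  run : ℕ → Config → Maybe Config
  run t c with step c
  run _       c | nothing = just c
  run zero    c | just _  = nothing
  run (suc t) c | just c′ = run t c′

  accepts : Config → Bool
  accepts c = accepting (state c)

  -- The output is the maximal string of bits starting at the head of the
  -- first tape.
  output : Config → List Bool
  output c with Vec.head (tapes c)
  ... | tape _ x rs = bitPrefix (x ∷ rs)

-- Polynomials with natural-number coefficients, constant term first.
Polynomial : Set
Polynomial = List ℕ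

eval : Polynomial → ℕ → ℕ
eval p n = foldr (λ a r → a + n * r) 0 p

Language : Set₁
Language = List Bool → Set

PolyTimeDecidable : Language → Set
PolyTimeDecidable A =
  Σ TM λ M → Σ Polynomial λ p → ∀ w →
    ∃ λ c → run M (eval p (length w)) (initial M w) ≡ just c ×
            (A w ⇔ T (accepts M c))

PolyTimeComputable : (List Bool → List Bool) → Set
PolyTimeComputable f =
  Σ TM λ M → Σ Polynomial λ p → ∀ w →
    ∃ λ c → run M (eval p (length w)) (initial M w) ≡ just c ×
            output M c ≡ f w

_≤ₚ_ : Language → Language → Set
A ≤ₚ B = Σ (List Bool → List Bool) λ f →
  PolyTimeComputable f × (∀ w → A w ⇔ B (f w))

-- Self-delimiting code: every bit is preceded by `true`, and `false` ends
-- the string.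
delimit : List Bool → List Bool
delimit []      = false ∷ []
delimit (b ∷ w) = true ∷ b ∷ delimit w

pair : List Bool → List Bool → List Bool
pair w c = delimit w ++ c

NP : Language → Set₁
NP A = Σ Language λ R → Σ Polynomial λ p →
  PolyTimeDecidable R ×
  (∀ w → A w ⇔ (∃ λ c → length c ≤ eval p (length w) × R (pair w c)))

NPHard : Language → Set₁
NPHard A = ∀ B → NP B → B ≤ₚ A

NPComplete : Language → Set₁
NPComplete A = NP A × NPHard A

sumℚ : List ℚᵘ → ℚᵘ
sumℚ = foldr ℚ._+_ 0ℚᵘ

-- `prob u v` is meaningful only when (u , v) is an edge: neither the loads,
-- nor the normalization condition, nor the encoding look at it otherwise.
record MobilityGraph : Set where
  field
    n    : ℕ
    edge : Fin n → Fin n → Bool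
    prob : Fin n → Fin n → ℚᵘ

  Γᴼᵁᵀ : Fin n → List (Fin n)
  Γᴼᵁᵀ u = filterᵇ (λ w → edge u w) (allFin n)

  Γᴵᴺ : Fin n → List (Fin n)
  Γᴵᴺ v = filterᵇ (λ w → edge w v) (allFin n)

  field
    prob≥0     : ∀ u v → T (edge u v) → 0ℚᵘ ℚ.≤ prob u v
    prob≤1     : ∀ u v → T (edge u v) → prob u v ℚ.≤ 1ℚᵘ
    normalized : ∀ u → sumℚ (map (λ v → prob u v) (Γᴼᵁᵀ u)) ≃ 1ℚᵘ

fromNat : ℕ → ℚᵘ
fromNat m = + m ℚ./ 1

module _ (G : MobilityGraph) (L : ℕ) where
  open MobilityGraph G

  load : Fin n → ℕ → Subset n → ℚᵘ
  load v zero    S = if lookup S v then fromNat L else 0ℚᵘ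
  load v (suc t) S = sumℚ (map (λ u → prob u v ℚ.* load u t S) (Γᴵᴺ v))

  σᵀ : (γ τ : ℕ) → Subset n → ℕ
  σᵀ γ τ S = length (filter (λ v → fromNat γ ≤? load v τ S) (allFin n))

record Instance : Set where
  field
    graph : MobilityGraph
  open MobilityGraph graph public
  field
    k L γ τ Λ : ℕ
    0<k : 0 < k
    k<n : k < n
    L≥1 : L ≥ 1
    0<γ : 0 < γ
    τ≥1 : τ ≥ 1
    0<Λ : 0 < Λ
    Λ≤n : Λ ≤ n

YesInstance : Instance → Set
YesInstance I = Σ (Subset n) λ S → Subset.∣ S ∣ ≡ k × σᵀ graph L γ τ S ≥ Λ
  where open Instance I

-- Bijective base-2 digits, least significant first: `false` stands for the
-- digit 1 and `true` for the digit 2.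
digits : ℕᵇ → List Bool
digits ℕᵇ.zero  = []
digits 1+[2 x ] = false ∷ digits x
digits 2[1+ x ] = true ∷ digits x

encodeBinary : ℕ → List Bool
encodeBinary m = delimit (digits (fromℕ m))

encodeUnary : ℕ → List Bool
encodeUnary m = replicate m true ++ false ∷ []

-- The sign is omitted, since probabilities are non-negative.
encodeProb : ℚᵘ → List Bool
encodeProb q = encodeBinary ℤ.∣ ↥ q ∣ ++ encodeBinary (↧ₙ q)

-- Writing n in unary is harmless, as the n² matrix entries follow it.
encodeGraph : MobilityGraph → List Bool
encodeGraph G = encodeUnary n ++ concatMap (λ u → concatMap (entry u) (allFin n)) (allFin n)
  where
  open MobilityGraph G
  entry : Fin n → Fin n → List Bool
  entry u v = if edge u v then true ∷ encodeProb (prob u v) else false ∷ []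

-- The parameters are in binary except τ, a number of rounds, which is in
-- unary: the exact loads after τ rounds can need a number of bits linear in τ.
encode : Instance → List Bool
encode I = encodeGraph graph ++ encodeBinary k ++ encodeBinary L ++ encodeBinary γ
  ++ encodeUnary τ ++ encodeBinary Λ
  where open Instance I

T-BS : Language
T-BS w = Σ Instance λ I → w ≡ encode I × YesInstance I

{-# OPTIONS --safe #-}
-- Membership: a certificate lists the instance in a structured form together
-- with the seed set.  The verifier re-encodes it, compares the result with the
-- input, and recomputes the loads exactly: with D the product of all
-- denominators, the load of v after t rounds is N(t,v) / D^t for integers
-- N(t,v) of polynomially many bits.
--
-- Hardness: a run of a verifier on an input with an unknown suffix is laid out
-- as a tableau, one row per time step, whose columns are positions relative to
-- the heads; a cell then depends on three cells of the previous row and on its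
-- head cell.  That every cell has a value and all local constraints hold is a
-- set of clauses of positive literals (cell = value).  In the graph, a literal has
-- arcs to the clauses containing it, and every node has an arc to a sink; out-arcs
-- have equal probabilities, so with L = n, γ = 1 and τ = 1 the nodes reaching
-- the threshold are the out-neighbours of the seeds.  If there are as many seeds
-- as cells, then covering all clauses and the sink forces exactly one value per
-- cell.
--
-- Both the verifier and the reduction are Agda functions built from
-- combinators that carry a program over four stacks and a polynomial bound;
-- programs are compiled to Turing machines, one tape per stack.
module Submission where

open import Defs
open import Data.Bool as Bool using (Bool; true; false; T; if_then_else_; _∧_; _∨_; not)
open import Data.Bool.Properties using (T-∧)
open import Data.Bool.ListAction using (and; or; all; any)
open import Data.Empty using (⊥-elim)
open import Data.Fin as Fin using (Fin; zero; suc; toℕ; splitAt; _↑ˡ_; _↑ʳ_)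
import Data.Fin.Properties as Fin
open import Data.Fin.Subset as Subset using (Subset)
import Data.Fin.Subset.Properties as Subset
open import Data.Integer as ℤ using () renaming (+_ to infix 8 ⁺_)
import Data.Integer.Properties as ℤ
import Data.Integer.Tactic.RingSolver as ℤSolver
open import Data.List using (List; []; _∷_; map; drop; length; foldr; _++_; replicate; concat; concatMap; upTo; applyUpTo; filterᵇ; filter; tabulate; allFin; lookup; cartesianProduct; cartesianProductWith)
open import Data.List.Membership.Propositional using (_∈_; lose; find)
open import Data.List.Membership.Propositional.Properties using (∈-map⁺; ∈-map⁻; ∈-++⁺ˡ; ∈-++⁺ʳ; ∈-++⁻; ∈-concat⁺′; ∈-concat⁻′; ∈-lookup; ∈-allFin; ∈-upTo⁺; ∈-upTo⁻; ∈-cartesianProduct⁺; ∈-cartesianProductWith⁺; ∈-filter⁺; ∈-filter⁻)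
open import Data.List.Properties hiding (≡-dec)
open import Data.List.Relation.Binary.Pointwise as PwL using ([]; _∷_)
open import Data.List.Relation.Unary.All as All using (All; []; _∷_)
import Data.List.Relation.Unary.All.Properties as All
open import Data.List.Relation.Unary.AllPairs using ([]; _∷_)
open import Data.List.Relation.Unary.Any as Any using (here; there; index)
open import Data.List.Relation.Unary.Any.Properties using (any⁺; any⁻; lookup-index)
open import Data.List.Relation.Unary.Unique.Propositional using (Unique)
import Data.List.Relation.Unary.Unique.Propositional.Properties as Unique
open import Data.Maybe as Maybe using (Maybe; just; nothing; maybe′; fromMaybe)
open import Data.Nat using (ℕ; zero; suc; pred; _+_; _*_; _^_; _∸_; _≤_; _<_; _≥_; _≤ᵇ_; _≡ᵇ_; z≤n; s≤s; s≤s⁻¹; >-nonZero)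
import Data.Nat.Binary as ℕᵇ
import Data.Nat.Binary.Properties as ℕᵇ
open import Data.Nat.ListAction using (sum)
open import Data.Nat.Properties
open import Data.Nat.Tactic.RingSolver using (solve-∀)
open import Data.Product as Product using (Σ; ∃; _×_; _,_; proj₁; proj₂; map₁; curry)
import Data.Product.Properties as Product
open import Data.Rational.Unnormalised as ℚ using (ℚᵘ; mkℚᵘ; 0ℚᵘ; 1ℚᵘ; _≃_; *≡*; *≤*; ↥_; ↧_; ↧ₙ_)
import Data.Rational.Unnormalised.Properties as ℚ
open import Data.Sum as Sum using (_⊎_; inj₁; inj₂)
open import Data.Unit using (⊤; tt)
open import Data.Vec as Vec using (Vec; []; _∷_; updateAt; zipWith)
import Data.Vec.Properties as Vec
open import Data.Vec.Relation.Binary.Pointwise.Inductive using (Pointwise; []; _∷_)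
open import Function using (_∘_; id)
open import Function.Bundles using (_⇔_; mk⇔; module Equivalence)
open import Level using (0ℓ)
open import Relation.Binary.PropositionalEquality
open import Relation.Nullary using (Dec; yes; no; ¬_)
open import Relation.Nullary.Decidable using (T?)
open import Relation.Unary using (Pred; Decidable)
open Equivalence using () renaming (to to ⇒; from to ⇐)

-- Structured programs over four stacks, and their compilation to TMs

-- Membership in `T-BS` only asserts that some instance has the given code. Hence no parser for
-- instances is needed in the verifier, while in the hardness proof the instance behind a code has
-- to be recovered, up to what the code leaves open; both rest on the codes being prefix-free.
-- Positions relative to the heads keep all heads in one fixed column: a row describes all tapes at
-- once and no clause has to locate a head. The price is that each step loses a column at either end
-- of the row, so rows need margins. Literals are positive because a seed can only add load. That
-- values exclude each other, which would ask for negation, follows by counting: each cell has a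
-- clause that only its own literals cover, so one seed per cell leaves none to spare. The sink
-- provides the out-arc that normalization demands of every node, and L = n lets a single seed,
-- whose share is at least L / n, meet the threshold. Polynomial time does not survive iteration,
-- since sizes may grow at each step; so a bound on output size travels with each function, and
-- folds require a bound on every accumulator.

Sym : Set
Sym = Symbol 1

Stacks : Set
Stacks = Vec (List Sym) 4

top : List Sym → Sym
top []      = blank
top (x ∷ _) = x

infixr 5 _⨾_

data Cmd : Set where
  skip  : Cmd
  push  : Fin 4 → Sym → Cmd
  pop   : Fin 4 → Cmd
  _⨾_   : Cmd → Cmd → Cmd
  ifTop : Fin 4 → (Sym → Bool) → Cmd → Cmd → Cmd
  while : Fin 4 → (Sym → Bool) → Cmd → Cmd

infix 3 _⊢_⇓_⟨_⟩

-- The index bounds the steps of the compiled machine. A push takes two, as the head must move left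
-- before it writes; a pop only moves right, and the symbol it leaves behind is overwritten by a
-- later push.
data _⊢_⇓_⟨_⟩ : Cmd → Stacks → Stacks → ℕ → Set where
  ⇓skip  : ∀ {σ} → skip ⊢ σ ⇓ σ ⟨ 1 ⟩
  ⇓push  : ∀ {σ i y} → push i y ⊢ σ ⇓ updateAt σ i (y ∷_) ⟨ 2 ⟩
  ⇓pop   : ∀ {σ i} → pop i ⊢ σ ⇓ updateAt σ i (drop 1) ⟨ 1 ⟩
  ⇓seq   : ∀ {P Q σ σ′ σ″ s t} → P ⊢ σ ⇓ σ′ ⟨ s ⟩ → Q ⊢ σ′ ⇓ σ″ ⟨ t ⟩ → P ⨾ Q ⊢ σ ⇓ σ″ ⟨ s + t ⟩
  ⇓then  : ∀ {i p P Q σ σ′ t} → p (top (Vec.lookup σ i)) ≡ true → P ⊢ σ ⇓ σ′ ⟨ t ⟩ →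
           ifTop i p P Q ⊢ σ ⇓ σ′ ⟨ suc t ⟩
  ⇓else  : ∀ {i p P Q σ σ′ t} → p (top (Vec.lookup σ i)) ≡ false → Q ⊢ σ ⇓ σ′ ⟨ t ⟩ →
           ifTop i p P Q ⊢ σ ⇓ σ′ ⟨ suc t ⟩
  ⇓done  : ∀ {i p P σ} → p (top (Vec.lookup σ i)) ≡ false → while i p P ⊢ σ ⇓ σ ⟨ 1 ⟩
  ⇓loop  : ∀ {i p P σ σ′ σ″ s t} → p (top (Vec.lookup σ i)) ≡ true → P ⊢ σ ⇓ σ′ ⟨ s ⟩ →
           while i p P ⊢ σ′ ⇓ σ″ ⟨ t ⟩ → while i p P ⊢ σ ⇓ σ″ ⟨ suc s + t ⟩
  ⇓≤     : ∀ {P σ σ′ s t} → s ≤ t → P ⊢ σ ⇓ σ′ ⟨ s ⟩ → P ⊢ σ ⇓ σ′ ⟨ t ⟩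

State : Cmd → Set
State skip            = ⊤
State (push _ _)      = Bool
State (pop _)         = ⊤
State (P ⨾ Q)         = State P ⊎ State Q
State (ifTop _ _ P Q) = Maybe (State P ⊎ State Q)
State (while _ _ P)   = Maybe (State P)

entry : ∀ P → State P
entry skip            = tt
entry (push _ _)      = false
entry (pop _)         = tt
entry (P ⨾ Q)         = inj₁ (entry P)
entry (ifTop _ _ P Q) = nothing
entry (while _ _ P)   = nothing

Tapes : Set
Tapes = Vec (Tape 1) 4

Actions : Set
Actions = Vec (Sym × Move) 4

keep : ∀ {m} → Vec Sym m → Vec (Sym × Move) m
keep = Vec.map (_, stay)

at-tape : ∀ {m} → Fin m → (Sym → Sym × Move) → Vec Sym m → Vec (Sym × Move) m
at-tape i g v = updateAt (keep v) i (g ∘ proj₁)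

-- The next state is `nothing` when the program exits.
δᴾ : ∀ P → State P → Vec Sym 4 → Maybe (State P) × Actions
δᴾ skip       _     v = nothing , keep v
δᴾ (push i y) false v = just true , at-tape i (_, left) v
δᴾ (push i y) true  v = nothing , at-tape i (λ _ → y , stay) v
δᴾ (pop i)    _     v = nothing , at-tape i (_, right) v
δᴾ (P ⨾ Q) (inj₁ s) v = map₁ (maybe′ (just ∘ inj₁) (just (inj₂ (entry Q)))) (δᴾ P s v)
δᴾ (P ⨾ Q) (inj₂ s) v = map₁ (maybe′ (just ∘ inj₂) nothing) (δᴾ Q s v)
δᴾ (ifTop i p P Q) nothing v =
  just (just (if p (Vec.lookup v i) then inj₁ (entry P) else inj₂ (entry Q))) , keep v
δᴾ (ifTop i p P Q) (just (inj₁ s)) v = map₁ (maybe′ (just ∘ just ∘ inj₁) nothing) (δᴾ P s v)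
δᴾ (ifTop i p P Q) (just (inj₂ s)) v = map₁ (maybe′ (just ∘ just ∘ inj₂) nothing) (δᴾ Q s v)
δᴾ (while i p P) nothing v = (if p (Vec.lookup v i) then just (just (entry P)) else nothing) , keep v
δᴾ (while i p P) (just s) v = map₁ (maybe′ (just ∘ just) (just nothing)) (δᴾ P s v)

currents : ∀ {m} → Vec (Tape 1) m → Vec Sym m
currents = Vec.map Tape.current

data Reach (P : Cmd) : State P → Tapes → ℕ → Tapes → Set where
  exit : ∀ {s ts acts} → δᴾ P s (currents ts) ≡ (nothing , acts) →
         Reach P s ts 1 (zipWith act ts acts)
  next : ∀ {s s′ ts acts t ts′} → δᴾ P s (currents ts) ≡ (just s′ , acts) →
         Reach P s′ (zipWith act ts acts) t ts′ → Reach P s ts (suc t) ts′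

module _ {P R : Cmd} (e : State P → State R) where

  -- The exit of the subprogram is an exit of the whole here, and is redirected to the state `r` in
  -- `embed-continue`. Redirecting costs no step, being part of the exiting transition itself.
  embed-exit : (∀ s v → δᴾ R (e s) v ≡ map₁ (maybe′ (just ∘ e) nothing) (δᴾ P s v)) →
    ∀ {s ts t ts′} → Reach P s ts t ts′ → Reach R (e s) ts t ts′
  embed-exit h (exit eq)   = exit (trans (h _ _) (cong (map₁ (maybe′ (just ∘ e) nothing)) eq))
  embed-exit h (next eq x) = next (trans (h _ _) (cong (map₁ (maybe′ (just ∘ e) nothing)) eq)) (embed-exit h x)

  embed-continue : ∀ r → (∀ s v → δᴾ R (e s) v ≡ map₁ (maybe′ (just ∘ e) (just r)) (δᴾ P s v)) →
    ∀ {s ts t ts′ u ts″} → Reach P s ts t ts′ → Reach R r ts′ u ts″ → Reach R (e s) ts (t + u) ts″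
  embed-continue r h (exit eq)   k = next (trans (h _ _) (cong (map₁ (maybe′ (just ∘ e) (just r))) eq)) k
  embed-continue r h (next eq x) k = next (trans (h _ _) (cong (map₁ (maybe′ (just ∘ e) (just r))) eq)) (embed-continue r h x k)

-- Equality up to trailing blanks, which a stack never exposes.
infix 4 _≈_

data _≈_ : List Sym → List Sym → Set where
  []  : [] ≈ []
  pad : ∀ {xs} → [] ≈ xs → [] ≈ blank ∷ xs
  _∷_ : ∀ x {s xs} → s ≈ xs → x ∷ s ≈ x ∷ xs

cells : Tape 1 → List Sym
cells (tape _ x rs) = x ∷ rs

_represents_ : Tape 1 → List Sym → Set
t represents s = s ≈ cells t

fromCells-represents : ∀ {ls s xs} → s ≈ xs → fromCells ls xs represents s
fromCells-represents []      = pad []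
fromCells-represents (pad p) = pad p
fromCells-represents (x ∷ p) = x ∷ p

≈-refl : ∀ {s} → s ≈ s
≈-refl {[]}    = []
≈-refl {x ∷ s} = x ∷ ≈-refl

≈-drop : ∀ {s x xs} → s ≈ x ∷ xs → drop 1 s ≈ xs
≈-drop (pad p) = p
≈-drop (x ∷ p) = p

≈-top : ∀ {s x xs} → s ≈ x ∷ xs → x ≡ top s
≈-top (pad p) = refl
≈-top (x ∷ p) = refl

≈-bitPrefix : ∀ {s xs} → s ≈ xs → bitPrefix xs ≡ bitPrefix s
≈-bitPrefix []                   = refl
≈-bitPrefix (pad p)              = refl
≈-bitPrefix (blank ∷ p)          = refl
≈-bitPrefix (bit b ∷ p)          = cong (b ∷_) (≈-bitPrefix p)
≈-bitPrefix (aux a ∷ p)          = refl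

Represent : ∀ {m} → Vec (Tape 1) m → Vec (List Sym) m → Set
Represent = Pointwise _represents_

act-keep : ∀ {m} (ts : Vec (Tape 1) m) → zipWith act ts (keep (currents ts)) ≡ ts
act-keep []       = refl
act-keep (t ∷ ts) = cong (t ∷_) (act-keep ts)

act-at-tape : ∀ {m} (ts : Vec (Tape 1) m) i g →
  zipWith act ts (at-tape i g (currents ts)) ≡ updateAt ts i (λ t → act t (g (Tape.current t)))
act-at-tape (t ∷ ts) zero    g = cong (_ ∷_) (act-keep ts)
act-at-tape (t ∷ ts) (suc i) g = cong (t ∷_) (act-at-tape ts i g)

Represent-updateAt : ∀ {m f g} {ts : Vec (Tape 1) m} {σ} i → (∀ {t s} → t represents s → f t represents g s) →
  Represent ts σ → Represent (updateAt ts i f) (updateAt σ i g)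
Represent-updateAt zero    h (p ∷ ps) = h p ∷ ps
Represent-updateAt (suc i) h (p ∷ ps) = p ∷ Represent-updateAt i h ps

push-represents : ∀ y {t s} → t represents s →
  act (act t (Tape.current t , left)) (y , stay) represents (y ∷ s)
push-represents y {tape []       _ _} p = y ∷ p
push-represents y {tape (_ ∷ _) _ _} p = y ∷ p

currents-lookup : ∀ {m} {ts : Vec (Tape 1) m} {σ} i → Represent ts σ →
  Vec.lookup (currents ts) i ≡ top (Vec.lookup σ i)
currents-lookup zero    (p ∷ ps) = ≈-top p
currents-lookup (suc i) (p ∷ ps) = currents-lookup i ps

-- Quantifying over all tapes that represent the stacks leaves the cells left of the heads and the
-- trailing blanks arbitrary; this is what lets the cases of sequences and loops be chained.
compile-correct : ∀ {P σ σ′ t} → P ⊢ σ ⇓ σ′ ⟨ t ⟩ → ∀ {ts} → Represent ts σ →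
  ∃ λ t′ → ∃ λ ts′ → t′ ≤ t × Reach P (entry P) ts t′ ts′ × Represent ts′ σ′
compile-correct ⇓skip {ts} rep =
  _ , _ , ≤-refl , exit refl , subst (λ z → Represent z _) (sym (act-keep ts)) rep
compile-correct (⇓push {i = i} {y}) {ts} rep =
  _ , _ , ≤-refl , next refl (exit refl) ,
  subst (λ z → Represent z _) (sym eq) (Represent-updateAt i (λ {t} → push-represents y {t}) rep)
  where
  ts₁ = zipWith act ts (at-tape i (_, left) (currents ts))
  eq = trans (act-at-tape ts₁ i (λ _ → y , stay))
      (trans (cong (λ z → updateAt z i _) (act-at-tape ts i (_, left))) (Vec.updateAt-updateAt i ts))
compile-correct (⇓pop {i = i}) {ts} rep =
  _ , _ , ≤-refl , exit refl ,
  subst (λ z → Represent z _) (sym (act-at-tape ts i (_, right)))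
    (Represent-updateAt i (λ {t} p → fromCells-represents (≈-drop p)) rep)
compile-correct (⇓seq p q) rep with compile-correct p rep
... | _ , _ , le₁ , r₁ , rep₁ with compile-correct q rep₁
... | _ , _ , le₂ , r₂ , rep₂ = _ , _ , +-mono-≤ le₁ le₂ ,
  embed-continue inj₁ _ (λ _ _ → refl) r₁ (embed-exit inj₂ (λ _ _ → refl) r₂) , rep₂
compile-correct (⇓then {i} {p} {P} {Q} eq x) {ts} rep with compile-correct x rep
... | _ , _ , le , r , rep₁ = _ , _ , s≤s le ,
  next (cong (λ b → just (just (if b then inj₁ (entry P) else inj₂ (entry Q))) , _)
         (trans (cong p (currents-lookup i rep)) eq))
    (subst (λ z → Reach _ _ z _ _) (sym (act-keep ts))
      (embed-exit (just ∘ inj₁) (λ _ _ → refl) r)) , rep₁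
compile-correct (⇓else {i} {p} {P} {Q} eq x) {ts} rep with compile-correct x rep
... | _ , _ , le , r , rep₁ = _ , _ , s≤s le ,
  next (cong (λ b → just (just (if b then inj₁ (entry P) else inj₂ (entry Q))) , _)
         (trans (cong p (currents-lookup i rep)) eq))
    (subst (λ z → Reach _ _ z _ _) (sym (act-keep ts))
      (embed-exit (just ∘ inj₂) (λ _ _ → refl) r)) , rep₁
compile-correct (⇓done {i} {p} {P} eq) {ts} rep = _ , _ , ≤-refl ,
  exit (cong (λ b → (if b then just (just (entry P)) else nothing) , _)
         (trans (cong p (currents-lookup i rep)) eq)) ,
  subst (λ z → Represent z _) (sym (act-keep ts)) rep
compile-correct (⇓loop {i} {p} {P} eq x y) {ts} rep with compile-correct x rep
... | _ , _ , le₁ , r₁ , rep₁ with compile-correct y rep₁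
... | _ , _ , le₂ , r₂ , rep₂ = _ , _ , s≤s (+-mono-≤ le₁ le₂) ,
  next (cong (λ b → (if b then just (just (entry P)) else nothing) , _)
         (trans (cong p (currents-lookup i rep)) eq))
    (subst (λ z → Reach _ _ z _ _) (sym (act-keep ts))
      (embed-continue just nothing (λ _ _ → refl) r₁ r₂)) , rep₂
compile-correct (⇓≤ le x) rep with compile-correct x rep
... | _ , _ , le₁ , r , rep₁ = _ , _ , ≤-trans le₁ le , r , rep₁

-- Numbering of control states, and the resulting Turing machines

stateCount : Cmd → ℕ
stateCount skip            = 1
stateCount (push _ _)      = 2
stateCount (pop _)         = 1
stateCount (P ⨾ Q)         = stateCount P + stateCount Q
stateCount (ifTop _ _ P Q) = suc (stateCount P + stateCount Q)
stateCount (while _ _ P)   = suc (stateCount P)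

toFin : ∀ P → State P → Fin (stateCount P)
toFin skip            _               = zero
toFin (push _ _)      false           = zero
toFin (push _ _)      true            = suc zero
toFin (pop _)         _               = zero
toFin (P ⨾ Q)         (inj₁ s)        = toFin P s ↑ˡ stateCount Q
toFin (P ⨾ Q)         (inj₂ s)        = stateCount P ↑ʳ toFin Q s
toFin (ifTop _ _ P Q) nothing         = zero
toFin (ifTop _ _ P Q) (just (inj₁ s)) = suc (toFin P s ↑ˡ stateCount Q)
toFin (ifTop _ _ P Q) (just (inj₂ s)) = suc (stateCount P ↑ʳ toFin Q s)
toFin (while _ _ P)   nothing         = zero
toFin (while _ _ P)   (just s)        = suc (toFin P s)

fromFin : ∀ P → Fin (stateCount P) → State P
fromFin skip            _       = tt
fromFin (push _ _)      zero    = false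
fromFin (push _ _)      (suc _) = true
fromFin (pop _)         _       = tt
fromFin (P ⨾ Q)         i       = Sum.map (fromFin P) (fromFin Q) (splitAt (stateCount P) i)
fromFin (ifTop _ _ P Q) zero    = nothing
fromFin (ifTop _ _ P Q) (suc i) = just (Sum.map (fromFin P) (fromFin Q) (splitAt (stateCount P) i))
fromFin (while _ _ P)   zero    = nothing
fromFin (while _ _ P)   (suc i) = just (fromFin P i)

fromFin-toFin : ∀ P s → fromFin P (toFin P s) ≡ s
fromFin-toFin skip            _     = refl
fromFin-toFin (push _ _)      false = refl
fromFin-toFin (push _ _)      true  = refl
fromFin-toFin (pop _)         _     = refl
fromFin-toFin (P ⨾ Q) (inj₁ s)
  rewrite Fin.splitAt-↑ˡ (stateCount P) (toFin P s) (stateCount Q) = cong inj₁ (fromFin-toFin P s)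
fromFin-toFin (P ⨾ Q) (inj₂ s)
  rewrite Fin.splitAt-↑ʳ (stateCount P) (stateCount Q) (toFin Q s) = cong inj₂ (fromFin-toFin Q s)
fromFin-toFin (ifTop _ _ P Q) nothing = refl
fromFin-toFin (ifTop _ _ P Q) (just (inj₁ s))
  rewrite Fin.splitAt-↑ˡ (stateCount P) (toFin P s) (stateCount Q) = cong (just ∘ inj₁) (fromFin-toFin P s)
fromFin-toFin (ifTop _ _ P Q) (just (inj₂ s))
  rewrite Fin.splitAt-↑ʳ (stateCount P) (stateCount Q) (toFin Q s) = cong (just ∘ inj₂) (fromFin-toFin Q s)
fromFin-toFin (while _ _ P) nothing  = refl
fromFin-toFin (while _ _ P) (just s) = cong just (fromFin-toFin P s)

-- The exiting transition of the program is dropped, so the two possible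
-- exits of a final conditional become two halting states.
module _ (P : Cmd) (accept : State P → Bool) where

  machine : TM
  machine = record
    { states = stateCount P ; workTapes = 3 ; extra = 1
    ; start = toFin P (entry P)
    ; accepting = accept ∘ fromFin P
    ; δ = λ q v → leave (δᴾ P (fromFin P q) v) }
    where
    leave : Maybe (State P) × Actions → Maybe (Fin (stateCount P) × Actions)
    leave (nothing , _)   = nothing
    leave (just s , acts) = just (toFin P s , acts)

  at-state : State P → Tapes → Config machine
  at-state s ts = config (toFin P s) ts

  step-just : ∀ {s s′ acts} ts → δᴾ P s (currents ts) ≡ (just s′ , acts) →
    step machine (at-state s ts) ≡ just (at-state s′ (zipWith act ts acts))
  step-just {s} ts eq rewrite fromFin-toFin P s | eq = refl

  step-nothing : ∀ {s acts} ts → δᴾ P s (currents ts) ≡ (nothing , acts) →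
    step machine (at-state s ts) ≡ nothing
  step-nothing {s} ts eq rewrite fromFin-toFin P s | eq = refl

module _ (M : TM) where

  run-step : ∀ {c c′} t → step M c ≡ just c′ → run M (suc t) c ≡ run M t c′
  run-step {c} t eq with step M c
  run-step t refl | just _ = refl

  run-halt : ∀ {c} t → step M c ≡ nothing → run M t c ≡ just c
  run-halt {c} t eq with step M c
  run-halt zero    refl | nothing = refl
  run-halt (suc t) refl | nothing = refl

  run-mono : ∀ {s t} → s ≤ t → ∀ c {r} → run M s c ≡ just r → run M t c ≡ just r
  run-mono {s} {t} le c eq with step M c in stp
  run-mono {zero}  {zero}  le      c eq | nothing = eq
  run-mono {zero}  {suc t} le      c eq | nothing = eq
  run-mono {suc s} {suc t} le      c eq | nothing = eq
  run-mono {zero}  {_}     le      c () | just _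
  run-mono {suc s} {suc t} (s≤s le) c eq | just c′ = run-mono le c′ eq

run-program : ∀ P Q accept {s ts t ts′} u → Reach P s ts t ts′ →
  run (machine (P ⨾ Q) accept) (t + u) (at-state (P ⨾ Q) accept (inj₁ s) ts) ≡
  run (machine (P ⨾ Q) accept) u (at-state (P ⨾ Q) accept (inj₂ (entry Q)) ts′)
run-program P Q accept u (exit {ts = ts} eq) =
  run-step _ u (step-just (P ⨾ Q) accept {inj₁ _} {inj₂ (entry Q)} ts (cong (map₁ (maybe′ (just ∘ inj₁) (just (inj₂ (entry Q))))) eq))
run-program P Q accept u (next {ts = ts} eq r) =
  trans (run-step _ _ (step-just (P ⨾ Q) accept {inj₁ _} {inj₁ _} ts (cong (map₁ (maybe′ (just ∘ inj₁) (just (inj₂ (entry Q))))) eq))) (run-program P Q accept u r)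

input : List Bool → Stacks
input w = map bit w ∷ [] ∷ [] ∷ [] ∷ []

input-represented : ∀ w → Represent
  (fromCells [] (map bit w) ∷ Vec.replicate 3 (fromCells [] [])) (input w)
input-represented w = fromCells-represents ≈-refl ∷ pad [] ∷ pad [] ∷ pad [] ∷ []

-- `machine` halts in place of the exiting transition and so loses its effect on the tapes. The
-- `skip` that follows P has an exit without effect, and the last transition of P becomes an
-- ordinary one.
computes : ∀ P {w σ t} → P ⊢ input w ⇓ σ ⟨ t ⟩ →
  ∃ λ c → run (machine (P ⨾ skip) (λ _ → false)) t (initial (machine (P ⨾ skip) (λ _ → false)) w) ≡ just c ×
          output (machine (P ⨾ skip) (λ _ → false)) c ≡ bitPrefix (Vec.lookup σ zero)
computes P {w} {t = t} d with compile-correct d (input-represented w)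
... | t′ , (tape ls x rs ∷ ts′) , le , r , (rep ∷ _) =
  _ , run-mono M le _ (trans (cong (λ z → run M z _) (sym (+-identityʳ t′)))
        (trans (run-program P skip (λ _ → false) 0 r) (run-halt M 0 (step-nothing (P ⨾ skip) (λ _ → false) {inj₂ tt} (tape ls x rs ∷ ts′) refl)))) ,
  ≈-bitPrefix rep
  where M = machine (P ⨾ skip) (λ _ → false)

isOne : Sym → Bool
isOne (bit true) = true
isOne _          = false

branch : Cmd
branch = ifTop zero isOne skip skip

acceptTrue : ∀ P → State (P ⨾ branch) → Bool
acceptTrue P (inj₂ (just (inj₁ _))) = true
acceptTrue P _                      = false

-- The additional step is the test in `branch`; each of its two `skip` states is halting, and which
-- one is entered is the verdict.
decides : ∀ P {w σ t} → P ⊢ input w ⇓ σ ⟨ t ⟩ →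
  ∃ λ c → run (machine (P ⨾ branch) (acceptTrue P)) (suc t) (initial (machine (P ⨾ branch) (acceptTrue P)) w) ≡ just c ×
          accepts (machine (P ⨾ branch) (acceptTrue P)) c ≡ isOne (top (Vec.lookup σ zero))
decides P {w} {σ} {t} d with compile-correct d (input-represented w)
... | t′ , ts′ , le , r , rep = _ , run-mono M (≤-trans (≤-reflexive (+-comm t′ 1)) (s≤s le)) _
        (trans (run-program P branch (acceptTrue P) 1 r)
        (trans (run-step M 0 (step-just (P ⨾ branch) (acceptTrue P) {inj₂ nothing} {inj₂ (just (sel (isOne (Vec.lookup (currents ts′) zero))))} ts′ refl))
               (run-halt M 0 (halts (isOne (Vec.lookup (currents ts′) zero)) _)))) ,
  trans (verdict (isOne (Vec.lookup (currents ts′) zero)))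
        (cong isOne (currents-lookup zero rep))
  where
  M = machine (P ⨾ branch) (acceptTrue P)
  sel : Bool → ⊤ ⊎ ⊤
  sel b = if b then inj₁ tt else inj₂ tt
  halts : ∀ b ts → step M (at-state (P ⨾ branch) (acceptTrue P) (inj₂ (just (sel b))) ts) ≡ nothing
  halts true  ts = step-nothing (P ⨾ branch) (acceptTrue P) {inj₂ (just (inj₁ tt))} ts refl
  halts false ts = step-nothing (P ⨾ branch) (acceptTrue P) {inj₂ (just (inj₂ tt))} ts refl
  verdict : ∀ b → accepts M (at-state (P ⨾ branch) (acceptTrue P) (inj₂ (just (sel b))) (zipWith act ts′ (keep (currents ts′)))) ≡ b
  verdict true  rewrite fromFin-toFin (P ⨾ branch) (inj₂ (just (inj₁ tt))) = refl
  verdict false rewrite fromFin-toFin (P ⨾ branch) (inj₂ (just (inj₂ tt))) = refl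

-- Polynomial bounds

abstract

  -- One family with a single parameter stands for all polynomials. As the base is at least 2,
  -- constants and sums are absorbed by raising the degree.
  bound : ℕ → ℕ → ℕ
  bound d n = (2 + n) ^ d

Poly : (ℕ → ℕ) → Set
Poly f = ∃ λ d → ∀ n → f n ≤ bound d n

abstract

  1≤bound : ∀ d n → 1 ≤ bound d n
  1≤bound d n = m^n>0 (2 + n) d

  bound-mono-deg : ∀ {d e} n → d ≤ e → bound d n ≤ bound e n
  bound-mono-deg n = ^-monoʳ-≤ (2 + n)

  bound-mono : ∀ d {m n} → m ≤ n → bound d m ≤ bound d n
  bound-mono d m≤n = ^-monoˡ-≤ d (+-monoʳ-≤ 2 m≤n)

  Poly-const : ∀ k → Poly (λ _ → k)
  Poly-const k = k , λ n → ≤-trans (k≤2^k k) (^-monoˡ-≤ k (s≤s (s≤s z≤n)))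
    where
    k≤2^k : ∀ k → k ≤ 2 ^ k
    k≤2^k zero    = z≤n
    k≤2^k (suc k) = ≤-trans (+-mono-≤ (1≤bound k 0) (k≤2^k k)) (≤-reflexive (cong (2 ^ k +_) (sym (+-identityʳ (2 ^ k)))))

  Poly-id : Poly (λ n → n)
  Poly-id = 1 , λ n → ≤-trans (m≤n+m n 2) (≤-reflexive (sym (*-identityʳ (2 + n))))

  Poly-* : ∀ {f g} → Poly f → Poly g → Poly (λ n → f n * g n)
  Poly-* (d , p) (e , q) = d + e , λ n →
    ≤-trans (*-mono-≤ (p n) (q n)) (≤-reflexive (sym (^-distribˡ-+-* (2 + n) d e)))

  Poly-+ : ∀ {f g} → Poly f → Poly g → Poly (λ n → f n + g n)
  Poly-+ {f} {g} (d , p) (e , q) = suc (d + e) , λ n → begin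
    f n + g n                          ≤⟨ +-mono-≤ (p n) (q n) ⟩
    bound d n + bound e n              ≤⟨ +-mono-≤ (bound-mono-deg n (m≤m+n d e)) (bound-mono-deg n (m≤n+m e d)) ⟩
    bound (d + e) n + bound (d + e) n  ≡⟨ cong (bound (d + e) n +_) (+-identityʳ _) ⟨
    2 * bound (d + e) n                ≤⟨ *-monoˡ-≤ (bound (d + e) n) (m≤m+n 2 n) ⟩
    (2 + n) * bound (d + e) n          ∎
    where open ≤-Reasoning

  -- Closure under composition. For x at least 1, 2 + x is at most 4 x, which two more factors 2 + n
  -- absorb; hence the degree `(e + 2) * d`.
  Poly-bound : ∀ d {f} → Poly f → Poly (λ n → bound d (f n))
  Poly-bound d {f} (e , p) = (e + 2) * d , λ n → begin
    (2 + f n) ^ d             ≤⟨ ^-monoˡ-≤ d (≤-trans (+-monoʳ-≤ 2 (p n)) (absorb (1≤bound e n) n)) ⟩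
    ((2 + n) ^ e * bound 2 n) ^ d ≡⟨ cong (_^ d) (^-distribˡ-+-* (2 + n) e 2) ⟨
    ((2 + n) ^ (e + 2)) ^ d   ≡⟨ ^-*-assoc (2 + n) (e + 2) d ⟩
    (2 + n) ^ ((e + 2) * d)   ∎
    where
    open ≤-Reasoning
    absorb : ∀ {x} → 1 ≤ x → ∀ n → 2 + x ≤ x * bound 2 n
    absorb {x} 1≤x n = begin
      2 + x        ≤⟨ +-monoˡ-≤ x (≤-trans (+-mono-≤ 1≤x 1≤x) (m≤m+n (x + x) x)) ⟩
      (x + x + x) + x ≡⟨ four x ⟩
      x * 4        ≤⟨ *-monoʳ-≤ x (bound-mono 2 (z≤n {n})) ⟩
      x * bound 2 n ∎
      where
      four : ∀ x → (x + x + x) + x ≡ x * 4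
      four = solve-∀

-- Trees on stacks

data Tree : Set where
  leaf : Tree
  node : Tree → Tree → Tree

size : Tree → ℕ
size leaf       = 1
size (node x y) = suc (size x + size y)

pattern 0ˢ = bit false
pattern 1ˢ = bit true
pattern # = aux zero

infixr 5 _▹_ _◃_

_▹_ : Tree → List Sym → List Sym
leaf     ▹ s = 0ˢ ∷ s
node x y ▹ s = 1ˢ ∷ x ▹ y ▹ s

_◃_ : Tree → List Sym → List Sym
leaf     ◃ s = 0ˢ ∷ s
node x y ◃ s = y ◃ x ◃ 1ˢ ∷ s

-- Trees are stored on the data stack in prefix order, and on the two
-- scratch stacks in reverse; the counter holds one mark for each tree
-- still to be read from the data stack.
dataˢ scratch counter copy : Fin 4
dataˢ   = zero
scratch = suc zero
counter = suc (suc zero)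
copy    = suc (suc (suc zero))

stacks : (a b c d : List Sym) → Stacks
stacks a b c d = a ∷ b ∷ c ∷ d ∷ []

st : List Sym → List Sym → Stacks
st a b = stacks a b [] []

isBit : Sym → Bool
isBit (bit _) = true
isBit _       = false

-- The mark `#` under the reversed tree is not a bit, so the loops that read the tree back stop
-- there. Writing the tree to `copy` as well is what makes duplication possible.
liftLoop lift : Cmd
liftLoop = while counter isBit
  (ifTop dataˢ isOne (pop dataˢ ⨾ push scratch 1ˢ ⨾ push copy 1ˢ ⨾ push counter 0ˢ)
                     (pop dataˢ ⨾ push scratch 0ˢ ⨾ push copy 0ˢ ⨾ pop counter))
lift = push scratch # ⨾ push counter 0ˢ ⨾ liftLoop

-- In continuation style, so that the two subtrees of a node are handled by composing the lemma with
-- itself. A node replaces one tree to be read by two, a leaf uses up one mark; reading all of x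
-- therefore removes exactly one mark.
lift-loop : ∀ x {a b c d σ t} → liftLoop ⊢ stacks a (x ◃ b) c (x ◃ d) ⇓ σ ⟨ t ⟩ →
  liftLoop ⊢ stacks (x ▹ a) b (0ˢ ∷ c) d ⇓ σ ⟨ 9 * size x + t ⟩
lift-loop leaf k = ⇓≤ (n≤1+n _) (⇓loop refl (⇓else refl (⇓seq ⇓pop (⇓seq ⇓push (⇓seq ⇓push ⇓pop)))) k)
lift-loop (node x y) {t = t} k = ⇓≤ (≤-reflexive (arith (size x) (size y) t))
  (⇓loop refl (⇓then refl (⇓seq ⇓pop (⇓seq ⇓push (⇓seq ⇓push ⇓push)))) (lift-loop x (lift-loop y k)))
  where
  arith : ∀ x y t → 9 + (9 * x + (9 * y + t)) ≡ 9 * suc (x + y) + t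
  arith = solve-∀

⇓lift : ∀ x {a b} → lift ⊢ st (x ▹ a) b ⇓ stacks a (x ◃ # ∷ b) [] (x ◃ []) ⟨ 2 + (2 + (9 * size x + 1)) ⟩
⇓lift x = ⇓seq ⇓push (⇓seq ⇓push (lift-loop x (⇓done refl)))

restoreLoop : Fin 4 → Cmd
restoreLoop i = while i isBit (ifTop i isOne (pop i ⨾ push dataˢ 1ˢ) (pop i ⨾ push dataˢ 0ˢ))

restore-scratch : ∀ x {a b d σ t} → restoreLoop scratch ⊢ stacks (x ▹ a) b [] d ⇓ σ ⟨ t ⟩ →
  restoreLoop scratch ⊢ stacks a (x ◃ b) [] d ⇓ σ ⟨ 5 * size x + t ⟩
restore-copy : ∀ x {a b d σ t} → restoreLoop copy ⊢ stacks (x ▹ a) b [] d ⇓ σ ⟨ t ⟩ →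
  restoreLoop copy ⊢ stacks a b [] (x ◃ d) ⇓ σ ⟨ 5 * size x + t ⟩

restore-arith : ∀ x y t → 5 * y + (5 * x + (5 + t)) ≡ 5 * suc (x + y) + t
restore-arith = solve-∀

restore-scratch leaf k = ⇓loop refl (⇓else refl (⇓seq ⇓pop ⇓push)) k
restore-scratch (node x y) {t = t} k = ⇓≤ (≤-reflexive (restore-arith (size x) (size y) t))
  (restore-scratch y (restore-scratch x (⇓loop refl (⇓then refl (⇓seq ⇓pop ⇓push)) k)))
restore-copy leaf k = ⇓loop refl (⇓else refl (⇓seq ⇓pop ⇓push)) k
restore-copy (node x y) {t = t} k = ⇓≤ (≤-reflexive (restore-arith (size x) (size y) t))
  (restore-copy y (restore-copy x (⇓loop refl (⇓then refl (⇓seq ⇓pop ⇓push)) k)))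

unstash : Cmd
unstash = restoreLoop scratch ⨾ pop scratch

⇓unstash : ∀ x {a b d} → unstash ⊢ stacks a (x ◃ # ∷ b) [] d ⇓ stacks (x ▹ a) b [] d ⟨ (5 * size x + 1) + 1 ⟩
⇓unstash x = ⇓seq (restore-scratch x (⇓done refl)) ⇓pop

clearLoop : Fin 4 → Cmd
clearLoop i = while i isBit (pop i)

clear-arith : ∀ x y t → 2 * y + (2 * x + (2 + t)) ≡ 2 * suc (x + y) + t
clear-arith = solve-∀

clear-scratch : ∀ x {a b d σ t} → clearLoop scratch ⊢ stacks a b [] d ⇓ σ ⟨ t ⟩ →
  clearLoop scratch ⊢ stacks a (x ◃ b) [] d ⇓ σ ⟨ 2 * size x + t ⟩
clear-scratch leaf k = ⇓loop refl ⇓pop k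
clear-scratch (node x y) {t = t} k = ⇓≤ (≤-reflexive (clear-arith (size x) (size y) t))
  (clear-scratch y (clear-scratch x (⇓loop refl ⇓pop k)))

clear-copy : ∀ x {a b d σ t} → clearLoop copy ⊢ stacks a b [] d ⇓ σ ⟨ t ⟩ →
  clearLoop copy ⊢ stacks a b [] (x ◃ d) ⇓ σ ⟨ 2 * size x + t ⟩
clear-copy leaf k = ⇓loop refl ⇓pop k
clear-copy (node x y) {t = t} k = ⇓≤ (≤-reflexive (clear-arith (size x) (size y) t))
  (clear-copy y (clear-copy x (⇓loop refl ⇓pop k)))

dup stash discard : Cmd
dup     = lift ⨾ unstash ⨾ restoreLoop copy
stash   = lift ⨾ clearLoop copy
discard = stash ⨾ clearLoop scratch ⨾ pop scratch

⇓dup : ∀ x {a b} → dup ⊢ st (x ▹ a) b ⇓ st (x ▹ x ▹ a) b ⟨ 30 * size x + 30 ⟩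
⇓dup x = ⇓≤ (≤-trans (m≤m+n _ (11 * size x + 22)) (≤-reflexive (arith (size x))))
  (⇓seq (⇓lift x) (⇓seq (⇓unstash x) (restore-copy x (⇓done refl))))
  where
  arith : ∀ n → (2 + (2 + (9 * n + 1))) + (((5 * n + 1) + 1) + (5 * n + 1)) + (11 * n + 22) ≡ 30 * n + 30
  arith = solve-∀

⇓stash : ∀ x {a b} → stash ⊢ st (x ▹ a) b ⇓ st a (x ◃ # ∷ b) ⟨ 11 * size x + 6 ⟩
⇓stash x = ⇓≤ (≤-reflexive (arith (size x))) (⇓seq (⇓lift x) (clear-copy x (⇓done refl)))
  where
  arith : ∀ n → (2 + (2 + (9 * n + 1))) + (2 * n + 1) ≡ 11 * n + 6
  arith = solve-∀

⇓discard : ∀ x {a b} → discard ⊢ st (x ▹ a) b ⇓ st a b ⟨ 30 * size x + 30 ⟩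
⇓discard x = ⇓≤ (≤-trans (m≤m+n _ (17 * size x + 22)) (≤-reflexive (arith (size x))))
  (⇓seq (⇓stash x) (⇓seq (clear-scratch x (⇓done refl)) ⇓pop))
  where
  arith : ∀ n → (11 * n + 6) + ((2 * n + 1) + 1) + (17 * n + 22) ≡ 30 * n + 30
  arith = solve-∀

pushTree : Tree → Cmd
pushTree leaf       = push dataˢ 0ˢ
pushTree (node x y) = pushTree y ⨾ pushTree x ⨾ push dataˢ 1ˢ

⇓pushTree : ∀ x {a b} → pushTree x ⊢ st a b ⇓ st (x ▹ a) b ⟨ 2 * size x ⟩
⇓pushTree leaf       = ⇓push
⇓pushTree (node x y) = ⇓≤ (≤-reflexive (arith (size x) (size y)))
  (⇓seq (⇓pushTree y) (⇓seq (⇓pushTree x) ⇓push))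
  where
  arith : ∀ x y → 2 * y + (2 * x + 2) ≡ 2 * suc (x + y)
  arith = solve-∀

-- Polynomial-time functions between coded types

infixr 6 _⊗_

data Ty : Set where
  𝟙 bool nat tree : Ty
  _⊗_  : Ty → Ty → Ty
  list : Ty → Ty

⟦_⟧ : Ty → Set
⟦ 𝟙 ⟧      = ⊤
⟦ bool ⟧   = Bool
⟦ nat ⟧    = ℕ
⟦ tree ⟧   = Tree
⟦ A ⊗ B ⟧  = ⟦ A ⟧ × ⟦ B ⟧
⟦ list A ⟧ = List ⟦ A ⟧

encList : {X : Set} → (X → Tree) → List X → Tree
encList e []       = leaf
encList e (x ∷ xs) = node (e x) (encList e xs)

-- Arranged so that conversions cost nothing: a number is coded as a list of that many units, a
-- Boolean as a list of at most one, a nonempty list as the pair of its head and tail, and any tree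
-- is the list of trees along its right spine. Case distinction and recursion on lists thus serve
-- all types.
enc : ∀ A → ⟦ A ⟧ → Tree
enc 𝟙        _       = leaf
enc bool     false   = leaf
enc bool     true    = node leaf leaf
enc nat      zero    = leaf
enc nat      (suc n) = node leaf (enc nat n)
enc tree     t       = t
enc (A ⊗ B)  (x , y) = node (enc A x) (enc B y)
enc (list A) xs      = encList (enc A) xs

∣_∣ : ∀ {A} → ⟦ A ⟧ → ℕ
∣_∣ {A} x = size (enc A x)

-- The remainders `a` and `b` of the stacks are arbitrary so that a program can run while other
-- values wait below. One degree serves for time and output size; the latter is needed to bound the
-- time of a composite.
record Computable {A B : Ty} (f : ⟦ A ⟧ → ⟦ B ⟧) : Set where
  field
    prog    : Cmd
    deg     : ℕ
    correct : ∀ x a b → prog ⊢ st (enc A x ▹ a) b ⇓ st (enc B (f x) ▹ a) b ⟨ bound deg (∣_∣ {A} x) ⟩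
    growth  : ∀ x → ∣_∣ {B} (f x) ≤ bound deg (∣_∣ {A} x)

open Computable

record Fun (A B : Ty) : Set where
  constructor _by_
  field
    fn         : ⟦ A ⟧ → ⟦ B ⟧
    computable : Computable {A} {B} fn

open Fun public

computableWithin : ∀ {A B} {f : ⟦ A ⟧ → ⟦ B ⟧} {s t : ℕ → ℕ} (P : Cmd) →
  Poly t → (∀ x a b → P ⊢ st (enc A x ▹ a) b ⇓ st (enc B (f x) ▹ a) b ⟨ t (∣_∣ {A} x) ⟩) →
  Poly s → (∀ x → ∣_∣ {B} (f x) ≤ s (∣_∣ {A} x)) → Computable {A} {B} f
computableWithin P (d , p) run (e , q) grow = record
  { prog = P
  ; deg = d + e
  ; correct = λ x a b → ⇓≤ (≤-trans (p _) (bound-mono-deg _ (m≤m+n d e))) (run x a b)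
  ; growth = λ x → ≤-trans (grow x) (≤-trans (q _) (bound-mono-deg _ (m≤n+m e d))) }

linear : ∀ k → Poly (λ n → k * n + k)
linear k = Poly-+ (Poly-* (Poly-const k) Poly-id) (Poly-const k)

abstract

  const-computable : ∀ {A B} (y : ⟦ B ⟧) → Computable {A} {B} (λ _ → y)
  const-computable {A} {B} y = computableWithin (discard ⨾ pushTree (enc B y))
    (Poly-+ (linear 30) (Poly-const (2 * ∣_∣ {B} y)))
    (λ x a b → ⇓seq (⇓discard (enc A x)) (⇓pushTree (enc B y)))
    (Poly-const (∣_∣ {B} y)) (λ _ → ≤-refl)

  coerce-computable : ∀ {A B} (f : ⟦ A ⟧ → ⟦ B ⟧) → (∀ x → enc B (f x) ≡ enc A x) → Computable {A} {B} f
  coerce-computable {A} {B} f eq = computableWithin skip (Poly-const 1)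
    (λ x a b → subst (λ z → skip ⊢ st (enc A x ▹ a) b ⇓ st (z ▹ a) b ⟨ 1 ⟩) (sym (eq x)) ⇓skip)
    Poly-id (λ x → ≤-reflexive (cong size (eq x)))

  ∘-computable : ∀ {A B C} (f : Fun B C) (g : Fun A B) → Computable {A} {C} (λ x → fn f (fn g x))
  ∘-computable (f by F) (g by G) = computableWithin (prog G ⨾ prog F)
    (Poly-+ (Poly-bound (deg G) Poly-id) (Poly-bound (deg F) (Poly-bound (deg G) Poly-id)))
    (λ x a b → ⇓≤ (+-monoʳ-≤ _ (bound-mono (deg F) (growth G x)))
                  (⇓seq (correct G x a b) (correct F (g x) a b)))
    (Poly-bound (deg F) (Poly-bound (deg G) Poly-id))
    (λ x → ≤-trans (growth F (g x)) (bound-mono (deg F) (growth G x)))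

  pair-computable : ∀ {A B C} (f : Fun A B) (g : Fun A C) → Computable {A} {B ⊗ C} (λ x → fn f x , fn g x)
  pair-computable {A} {B} {C} (f by F) (g by G) = computableWithin
    -- The first result waits on the scratch stack while the other copy of the argument is consumed;
    -- the final `1ˢ` makes a node of two adjacent codes.
    (dup ⨾ prog F ⨾ stash ⨾ prog G ⨾ unstash ⨾ push dataˢ 1ˢ)
    (Poly-+ (linear 30) (Poly-+ pF (Poly-+ (Poly-+ (Poly-* (Poly-const 11) pF) (Poly-const 6))
      (Poly-+ pG (Poly-+ (Poly-+ (Poly-+ (Poly-* (Poly-const 5) pF) (Poly-const 1)) (Poly-const 1)) (Poly-const 2))))))
    (λ x a b → ⇓seq (⇓dup (enc A x)) (⇓seq (correct F x _ b)
      (⇓seq (⇓≤ (+-monoˡ-≤ 6 (*-monoʳ-≤ 11 (growth F x))) (⇓stash (enc B (f x))))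
      (⇓seq (correct G x a _)
      (⇓seq (⇓≤ (+-monoˡ-≤ 1 (+-monoˡ-≤ 1 (*-monoʳ-≤ 5 (growth F x)))) (⇓unstash (enc B (f x)))) ⇓push)))))
    (Poly-+ (Poly-const 1) (Poly-+ pF pG))
    (λ x → s≤s (+-mono-≤ (growth F x) (growth G x)))
    where
    pF : Poly (bound (deg F))
    pF = Poly-bound (deg F) Poly-id
    pG : Poly (bound (deg G))
    pG = Poly-bound (deg G) Poly-id

  fst-computable : ∀ {A B} → Computable {A ⊗ B} {A} proj₁
  fst-computable {A} {B} = computableWithin (pop dataˢ ⨾ stash ⨾ discard ⨾ unstash)
    (Poly-+ (Poly-const 1) (Poly-+ (Poly-+ (Poly-* (Poly-const 11) Poly-id) (Poly-const 6))
      (Poly-+ (linear 30) (Poly-+ (Poly-+ (Poly-* (Poly-const 5) Poly-id) (Poly-const 1)) (Poly-const 1)))))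
    (λ { (x , y) a b → ⇓seq ⇓pop (⇓seq (⇓≤ (+-monoˡ-≤ 6 (*-monoʳ-≤ 11 (left≤ x y))) (⇓stash (enc A x)))
      (⇓seq (⇓≤ (+-monoˡ-≤ 30 (*-monoʳ-≤ 30 (right≤ x y))) (⇓discard (enc B y)))
            (⇓≤ (+-monoˡ-≤ 1 (+-monoˡ-≤ 1 (*-monoʳ-≤ 5 (left≤ x y)))) (⇓unstash (enc A x))))) })
    Poly-id (λ { (x , y) → left≤ x y })
    where
    left≤ : ∀ x y → ∣_∣ {A} x ≤ ∣_∣ {A ⊗ B} (x , y)
    left≤ x y = m≤n⇒m≤1+n (m≤m+n _ _)
    right≤ : ∀ x y → ∣_∣ {B} y ≤ ∣_∣ {A ⊗ B} (x , y)
    right≤ x y = m≤n⇒m≤1+n (m≤n+m _ _)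

  snd-computable : ∀ {A B} → Computable {A ⊗ B} {B} proj₂
  snd-computable {A} {B} = computableWithin (pop dataˢ ⨾ discard)
    (Poly-+ (Poly-const 1) (linear 30))
    (λ { (x , y) a b → ⇓seq ⇓pop (⇓≤ (+-monoˡ-≤ 30 (*-monoʳ-≤ 30 (m≤n⇒m≤1+n (m≤m+n (∣_∣ {A} x) (∣_∣ {B} y))))) (⇓discard (enc A x))) })
    Poly-id (λ { (x , y) → m≤n⇒m≤1+n (m≤n+m _ _) })

caseList : ∀ {X Y Z : Set} → (X → Z) → (X × Y × List Y → Z) → X × List Y → Z
caseList f g (x , [])     = f x
caseList f g (x , y ∷ ys) = g (x , y , ys)

abstract

  case-computable : ∀ {Γ A C} (f : Fun Γ C) (g : Fun (Γ ⊗ A ⊗ list A) C) →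
    Computable {Γ ⊗ list A} {C} (caseList (fn f) (fn g))
  case-computable {Γ} {A} {C} (f by F) (g by G) = computableWithin
    -- A nonempty list has the code of the pair of its head and tail, so once γ is put back on top,
    -- pushing `1ˢ` completes the argument of G. Of an empty list only a `0ˢ` has to be removed.
    (pop dataˢ ⨾ stash ⨾ ifTop dataˢ isOne (unstash ⨾ push dataˢ 1ˢ ⨾ prog G) (pop dataˢ ⨾ unstash ⨾ prog F))
    (Poly-+ (Poly-const 1) (Poly-+ (Poly-+ (Poly-* (Poly-const 11) Poly-id) (Poly-const 6)) (Poly-+ (Poly-const 1)
      (Poly-+ (Poly-+ (Poly-+ (Poly-* (Poly-const 5) Poly-id) (Poly-const 1)) (Poly-const 1)) (Poly-+ (Poly-const 2) (Poly-+ pG pF))))))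
    (λ { (γ , ys) a b → ⇓seq ⇓pop (⇓seq (⇓≤ (+-monoˡ-≤ 6 (*-monoʳ-≤ 11 (left≤ γ ys))) (⇓stash (enc Γ γ))) (go γ ys a b)) })
    (Poly-+ pG pF)
    (λ { (γ , [])     → ≤-trans (growth F γ) (≤-trans (bound-mono (deg F) (left≤ γ [])) (m≤n+m _ _))
       ; (γ , y ∷ ys) → ≤-trans (growth G (γ , y , ys)) (m≤m+n _ _) })
    where
    pF : Poly (bound (deg F))
    pF = Poly-bound (deg F) Poly-id
    pG : Poly (bound (deg G))
    pG = Poly-bound (deg G) Poly-id
    left≤ : ∀ γ ys → ∣_∣ {Γ} γ ≤ ∣_∣ {Γ ⊗ list A} (γ , ys)
    left≤ γ ys = m≤n⇒m≤1+n (m≤m+n _ _)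
    go : ∀ γ ys a b → let n = ∣_∣ {Γ ⊗ list A} (γ , ys) in
      ifTop dataˢ isOne (unstash ⨾ push dataˢ 1ˢ ⨾ prog G) (pop dataˢ ⨾ unstash ⨾ prog F) ⊢
      st (enc (list A) ys ▹ a) (enc Γ γ ◃ # ∷ b) ⇓ st (enc C (caseList f g (γ , ys)) ▹ a) b
      ⟨ 1 + (((5 * n + 1) + 1) + (2 + (bound (deg G) n + bound (deg F) n))) ⟩
    go γ [] a b = ⇓≤
      (s≤s (≤-trans (≤-reflexive (swap-one _ _)) (+-mono-≤ (+-monoˡ-≤ 1 (+-monoˡ-≤ 1 (*-monoʳ-≤ 5 (left≤ γ []))))
        (+-mono-≤ (n≤1+n 1) (≤-trans (bound-mono (deg F) (left≤ γ [])) (m≤n+m _ _))))))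
      (⇓else refl (⇓seq ⇓pop (⇓seq (⇓unstash (enc Γ γ)) (correct F γ a b))))
      where
      swap-one : ∀ x y → 1 + (x + y) ≡ x + (1 + y)
      swap-one = solve-∀
    go γ (y ∷ ys) a b = ⇓≤
      (s≤s (+-mono-≤ (+-monoˡ-≤ 1 (+-monoˡ-≤ 1 (*-monoʳ-≤ 5 (left≤ γ (y ∷ ys))))) (+-monoʳ-≤ 2 (m≤m+n _ _))))
      (⇓then refl (⇓seq (⇓unstash (enc Γ γ)) (⇓seq ⇓push (correct G (γ , y , ys) a b))))

-- The elements of a list are stashed one above the other, each topped by 1ˢ;
-- unstashing then meets the last element first, in the order of a right fold.
stashAll : Cmd
stashAll = while dataˢ isOne (pop dataˢ ⨾ stash ⨾ push scratch 1ˢ)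

foldLoop : Cmd → Cmd
foldLoop P = while scratch isOne (pop scratch ⨾ unstash ⨾ push dataˢ 1ˢ ⨾ P)

module _ {A B : Ty} (s : ⟦ A ⟧ × ⟦ B ⟧ → ⟦ B ⟧) (S : Computable {A ⊗ B} {B} s) where

  stashed : List ⟦ A ⟧ → List Sym → List Sym
  stashed []       b = b
  stashed (x ∷ xs) b = stashed xs (1ˢ ∷ enc A x ◃ # ∷ b)

  fold : List ⟦ A ⟧ → ⟦ B ⟧ → ⟦ B ⟧
  fold xs z = foldr (curry s) z xs

  stash-all : ∀ xs {a b} → stashAll ⊢ st (enc (list A) xs ▹ a) b ⇓ st (0ˢ ∷ a) (stashed xs b) ⟨ 20 * ∣_∣ {list A} xs ⟩
  stash-all []       = ⇓≤ (s≤s z≤n) (⇓done refl)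
  stash-all (x ∷ xs) = ⇓≤ (≤-trans (m≤m+n _ (9 * ∣_∣ {A} x + 10)) (≤-reflexive (arith (∣_∣ {A} x) (∣_∣ {list A} xs))))
    (⇓loop refl (⇓seq ⇓pop (⇓seq (⇓stash (enc A x)) ⇓push)) (stash-all xs))
    where
    arith : ∀ x y → suc (1 + ((11 * x + 6) + 2)) + 20 * y + (9 * x + 10) ≡ 20 * suc (x + y)
    arith = solve-∀

  -- N bounds all accumulators at once: those that occur belong to suffixes of xs, and the
  -- hypothesis asks for every list that is no larger than xs. The continuation runs on the finished
  -- fold because the last element is taken first.
  fold-loop : ∀ xs z N → (∀ ys → ∣_∣ {list A} ys ≤ ∣_∣ {list A} xs → ∣_∣ {B} (fold ys z) ≤ N) →
    ∀ {a b σ t} → foldLoop (prog S) ⊢ st (enc B (fold xs z) ▹ a) b ⇓ σ ⟨ t ⟩ →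
    foldLoop (prog S) ⊢ st (enc B z ▹ a) (stashed xs b) ⇓ σ
      ⟨ ∣_∣ {list A} xs * (6 + 5 * ∣_∣ {list A} xs + bound (deg S) (suc (∣_∣ {list A} xs + N))) + t ⟩
  fold-loop []       z N h k = ⇓≤ (m≤n+m _ _) k
  fold-loop (x ∷ xs) z N h {t = t} k = ⇓≤ le
    (fold-loop xs z N (λ ys q → h ys (≤-trans q tail≤))
      (⇓loop refl (⇓seq ⇓pop (⇓seq (⇓unstash (enc A x)) (⇓seq ⇓push (correct S (x , fold xs z) _ _)))) k))
    where
    m = ∣_∣ {A} x
    n = ∣_∣ {list A} xs
    M = ∣_∣ {list A} (x ∷ xs)
    tail≤ : n ≤ M
    tail≤ = m≤n⇒m≤1+n (m≤n+m n m)
    head≤ : m ≤ M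
    head≤ = m≤n⇒m≤1+n (m≤m+n m n)
    K : ℕ → ℕ
    K n = 6 + 5 * n + bound (deg S) (suc (n + N))
    open ≤-Reasoning
    le : n * K n + (suc (1 + (((5 * m + 1) + 1) + (2 + bound (deg S) (suc (m + ∣_∣ {B} (fold xs z)))))) + t) ≤ M * K M + t
    le = begin
      n * K n + (suc (1 + (((5 * m + 1) + 1) + (2 + bound (deg S) (suc (m + ∣_∣ {B} (fold xs z)))))) + t)
        ≡⟨ arith (n * K n) m (bound (deg S) (suc (m + ∣_∣ {B} (fold xs z)))) t ⟩
      (6 + 5 * m + bound (deg S) (suc (m + ∣_∣ {B} (fold xs z))) + n * K n) + t
        ≤⟨ +-monoˡ-≤ t (+-mono-≤ (+-mono-≤ (+-monoʳ-≤ 6 (*-monoʳ-≤ 5 head≤))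
             (bound-mono (deg S) (s≤s (+-mono-≤ head≤ (h xs tail≤)))))
             (*-monoʳ-≤ n (+-mono-≤ (+-monoʳ-≤ 6 (*-monoʳ-≤ 5 tail≤)) (bound-mono (deg S) (s≤s (+-monoˡ-≤ N tail≤)))))) ⟩
      suc n * K M + t
        ≤⟨ +-monoˡ-≤ t (*-monoˡ-≤ (K M) (s≤s (m≤n+m n m))) ⟩
      M * K M + t ∎
      where
      arith : ∀ p m q t → p + (suc (1 + (((5 * m + 1) + 1) + (2 + q))) + t) ≡ (6 + 5 * m + q + p) + t
      arith = solve-∀

abstract

  -- Iterating a polynomial-time step can produce values of superpolynomial size, so the caller
  -- supplies a polynomial bound on the folds over all lists. This is bounded recursion in the
  -- manner of Cobham.
  foldr-computable : ∀ {Γ A B} (e : Fun Γ (list A ⊗ B)) (s : Fun (A ⊗ B) B) d →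
    (∀ γ ys → ∣_∣ {B} (foldr (curry (fn s)) (proj₂ (fn e γ)) ys) ≤ bound d (∣_∣ {list A} ys + ∣_∣ {Γ} γ)) →
    Computable {Γ} {B} (λ γ → foldr (curry (fn s)) (proj₂ (fn e γ)) (proj₁ (fn e γ)))
  foldr-computable {Γ} {A} {B} (e by E) (s by S) d h = computableWithin
    -- The `0ˢ` pushed below the elements is what ends `foldLoop`. The two pops on the data stack
    -- take away the tag of the pair and the end of the list.
    (prog E ⨾ pop dataˢ ⨾ push scratch 0ˢ ⨾ stashAll ⨾ pop dataˢ ⨾ foldLoop (prog S) ⨾ pop scratch)
    (Poly-+ pE (Poly-+ (Poly-const 1) (Poly-+ (Poly-const 2) (Poly-+ (Poly-* (Poly-const 20) pE) (Poly-+ (Poly-const 1)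
      (Poly-+ (Poly-+ (Poly-* pE (Poly-+ (Poly-+ (Poly-const 6) (Poly-* (Poly-const 5) pE))
         (Poly-bound (deg S) (Poly-+ (Poly-const 1) (Poly-+ pE pN))))) (Poly-const 1)) (Poly-const 1)))))))
    (λ γ a b → ⇓seq (correct E γ a b) (⇓seq ⇓pop (⇓seq ⇓push
      (⇓seq (⇓≤ (*-monoʳ-≤ 20 (list≤ γ)) (stash-all s S (proj₁ (e γ)))) (⇓seq ⇓pop
      (⇓seq (⇓≤ (+-monoˡ-≤ 1 (*-mono-≤ (list≤ γ) (+-mono-≤ (+-monoʳ-≤ 6 (*-monoʳ-≤ 5 (list≤ γ)))
               (bound-mono (deg S) (s≤s (+-monoˡ-≤ _ (list≤ γ)))))))
        (fold-loop s S (proj₁ (e γ)) (proj₂ (e γ)) (bound d (bound (deg E) (∣_∣ {Γ} γ) + ∣_∣ {Γ} γ))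
          (λ ys q → ≤-trans (h γ ys) (bound-mono d (+-monoˡ-≤ _ (≤-trans q (list≤ γ)))))
          (⇓done refl))) ⇓pop))))))
    pN (λ γ → ≤-trans (h γ _) (bound-mono d (+-monoˡ-≤ _ (list≤ γ))))
    where
    pE : Poly (bound (deg E))
    pE = Poly-bound (deg E) Poly-id
    pN : Poly (λ n → bound d (bound (deg E) n + n))
    pN = Poly-bound d (Poly-+ pE Poly-id)
    list≤ : ∀ γ → ∣_∣ {list A} (proj₁ (e γ)) ≤ bound (deg E) (∣_∣ {Γ} γ)
    list≤ γ = ≤-trans (m≤n⇒m≤1+n (m≤m+n _ _)) (growth E γ)

-- From programs to the machines of the statement

-- Input and output are raw bits, not tree codes. Passing through the scratch stack reverses the
-- word, which lets `readIn` build the list from its end and gives the output its proper order.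
unload readIn emit : Cmd
unload = while dataˢ isBit (ifTop dataˢ isOne (pop dataˢ ⨾ push scratch 1ˢ) (pop dataˢ ⨾ push scratch 0ˢ))
readIn   = while scratch isBit (ifTop scratch isOne
           (pop scratch ⨾ pushTree (enc bool true) ⨾ push dataˢ 1ˢ)
           (pop scratch ⨾ pushTree (enc bool false) ⨾ push dataˢ 1ˢ))
emit   = while dataˢ isOne (pop dataˢ ⨾ ifTop dataˢ isOne
           (pop dataˢ ⨾ pop dataˢ ⨾ pop dataˢ ⨾ push scratch 1ˢ)
           (pop dataˢ ⨾ push scratch 0ˢ))

onto : List Bool → List Sym → List Sym
onto []      b = b
onto (x ∷ w) b = onto w (bit x ∷ b)

⇓unload : ∀ w {b} → unload ⊢ st (map bit w) b ⇓ st [] (onto w b) ⟨ 5 * length w + 1 ⟩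
⇓unload []          = ⇓done refl
⇓unload (true  ∷ w) = ⇓≤ (≤-reflexive (arith (length w))) (⇓loop refl (⇓then refl (⇓seq ⇓pop ⇓push)) (⇓unload w))
  where arith : ∀ n → 5 + (5 * n + 1) ≡ 5 * suc n + 1
        arith = solve-∀
⇓unload (false ∷ w) = ⇓≤ (≤-reflexive (arith (length w))) (⇓loop refl (⇓else refl (⇓seq ⇓pop ⇓push)) (⇓unload w))
  where arith : ∀ n → 5 + (5 * n + 1) ≡ 5 * suc n + 1
        arith = solve-∀

readIn-loop : ∀ w {xs b σ t} → readIn ⊢ st (enc (list bool) (w ++ xs) ▹ []) b ⇓ σ ⟨ t ⟩ →
  readIn ⊢ st (enc (list bool) xs ▹ []) (onto w b) ⇓ σ ⟨ 11 * length w + t ⟩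
readIn-loop []          k = k
readIn-loop (true  ∷ w) {t = t} k = ⇓≤ (≤-reflexive (arith (length w) t)) (readIn-loop w
  (⇓loop refl (⇓then refl (⇓seq ⇓pop (⇓seq (⇓pushTree (enc bool true)) ⇓push))) k))
  where arith : ∀ n t → 11 * n + (11 + t) ≡ 11 * suc n + t
        arith = solve-∀
readIn-loop (false ∷ w) {t = t} k = ⇓≤ (≤-trans (m≤m+n _ 4) (≤-reflexive (arith (length w) t))) (readIn-loop w
  (⇓loop refl (⇓else refl (⇓seq ⇓pop (⇓seq (⇓pushTree (enc bool false)) ⇓push))) k))
  where arith : ∀ n t → 11 * n + (7 + t) + 4 ≡ 11 * suc n + t
        arith = solve-∀

⇓emit : ∀ w {b} → emit ⊢ st (enc (list bool) w ▹ []) b ⇓ st (0ˢ ∷ []) (onto w b) ⟨ 8 * length w + 1 ⟩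
⇓emit []          = ⇓done refl
⇓emit (true  ∷ w) = ⇓≤ (≤-reflexive (arith (length w)))
  (⇓loop refl (⇓seq ⇓pop (⇓then refl (⇓seq ⇓pop (⇓seq ⇓pop (⇓seq ⇓pop ⇓push))))) (⇓emit w))
  where arith : ∀ n → 8 + (8 * n + 1) ≡ 8 * suc n + 1
        arith = solve-∀
⇓emit (false ∷ w) = ⇓≤ (≤-trans (m≤m+n _ 2) (≤-reflexive (arith (length w))))
  (⇓loop refl (⇓seq ⇓pop (⇓else refl (⇓seq ⇓pop ⇓push))) (⇓emit w))
  where arith : ∀ n → 6 + (8 * n + 1) + 2 ≡ 8 * suc n + 1
        arith = solve-∀

reload-loop : ∀ w {a b σ t} → restoreLoop scratch ⊢ st (map bit w ++ a) b ⇓ σ ⟨ t ⟩ →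
  restoreLoop scratch ⊢ st a (onto w b) ⇓ σ ⟨ 5 * length w + t ⟩
reload-loop []          k = k
reload-loop (true  ∷ w) {t = t} k = ⇓≤ (≤-reflexive (arith (length w) t)) (reload-loop w
  (⇓loop refl (⇓then refl (⇓seq ⇓pop ⇓push)) k))
  where arith : ∀ n t → 5 * n + (5 + t) ≡ 5 * suc n + t
        arith = solve-∀
reload-loop (false ∷ w) {t = t} k = ⇓≤ (≤-reflexive (arith (length w) t)) (reload-loop w
  (⇓loop refl (⇓else refl (⇓seq ⇓pop ⇓push)) k))
  where arith : ∀ n t → 5 * n + (5 + t) ≡ 5 * suc n + t
        arith = solve-∀

∣bits∣≤ : ∀ w → ∣_∣ {list bool} w ≤ 4 * length w + 1
∣bits∣≤ []          = ≤-refl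
∣bits∣≤ (true  ∷ w) = ≤-trans (+-monoʳ-≤ 4 (∣bits∣≤ w)) (≤-reflexive (arith (length w)))
  where arith : ∀ n → 4 + (4 * n + 1) ≡ 4 * suc n + 1
        arith = solve-∀
∣bits∣≤ (false ∷ w) = ≤-trans (+-mono-≤ {2} {4} (s≤s (s≤s z≤n)) (∣bits∣≤ w)) (≤-reflexive (arith (length w)))
  where arith : ∀ n → 4 + (4 * n + 1) ≡ 4 * suc n + 1
        arith = solve-∀

length≤∣bits∣ : ∀ w → length w ≤ ∣_∣ {list bool} w
length≤∣bits∣ []      = z≤n
length≤∣bits∣ (b ∷ w) = s≤s (≤-trans (length≤∣bits∣ w) (m≤n+m _ _))

whole : ∀ {B} → Fun (list bool) B → Cmd
whole (f by F) = unload ⨾ push dataˢ 0ˢ ⨾ readIn ⨾ prog F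

wholeTime : ℕ → ℕ → ℕ
wholeTime d n = (5 * n + 1) + (2 + ((11 * n + 1) + bound d (4 * n + 1)))

wholeTime-Poly : ∀ d → Poly (wholeTime d)
wholeTime-Poly d = Poly-+ (Poly-+ (Poly-* (Poly-const 5) Poly-id) (Poly-const 1)) (Poly-+ (Poly-const 2)
  (Poly-+ (Poly-+ (Poly-* (Poly-const 11) Poly-id) (Poly-const 1))
    (Poly-bound d (Poly-+ (Poly-* (Poly-const 4) Poly-id) (Poly-const 1)))))

⇓whole : ∀ {B} (f : Fun (list bool) B) w →
  whole f ⊢ input w ⇓ st (enc B (fn f w) ▹ []) [] ⟨ wholeTime (deg (computable f)) (length w) ⟩
⇓whole (f by F) w = ⇓seq (⇓unload w) (⇓seq ⇓push (⇓seq
  (readIn-loop w {[]} (subst (λ v → readIn ⊢ st (enc (list bool) v ▹ []) [] ⇓ st (enc (list bool) w ▹ []) [] ⟨ 1 ⟩) (sym (++-identityʳ w)) (⇓done refl)))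
  (⇓≤ (bound-mono (deg F) (∣bits∣≤ w)) (correct F w [] []))))

addPolynomial : Polynomial → Polynomial → Polynomial
addPolynomial []      q       = q
addPolynomial (a ∷ p) []      = a ∷ p
addPolynomial (a ∷ p) (b ∷ q) = a + b ∷ addPolynomial p q

eval-add : ∀ p q n → eval (addPolynomial p q) n ≡ eval p n + eval q n
eval-add []      q       n = refl
eval-add (a ∷ p) []      n = sym (+-identityʳ _)
eval-add (a ∷ p) (b ∷ q) n = trans (cong (λ r → a + b + n * r) (eval-add p q n)) (arith a b n (eval p n) (eval q n))
  where arith : ∀ a b n x y → a + b + n * (x + y) ≡ (a + n * x) + (b + n * y)
        arith = solve-∀

-- The recursion is (2 + n) p = p + p + n p, where prepending the coefficient 0 multiplies by n.
boundPolynomial : ℕ → Polynomial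
boundPolynomial zero    = 1 ∷ []
boundPolynomial (suc d) = addPolynomial (addPolynomial p p) (0 ∷ p)
  where p = boundPolynomial d

abstract
  eval-bound : ∀ d n → eval (boundPolynomial d) n ≡ bound d n
  eval-bound zero    n = cong suc (*-zeroʳ n)
  eval-bound (suc d) n
    rewrite eval-add (addPolynomial (boundPolynomial d) (boundPolynomial d)) (0 ∷ boundPolynomial d) n
          | eval-add (boundPolynomial d) (boundPolynomial d) n | eval-bound d n = arith n (bound d n)
    where arith : ∀ n x → x + x + n * x ≡ (2 + n) * x
          arith = solve-∀

polynomial : ∀ {f} → Poly f → ∃ λ p → ∀ n → f n ≤ eval p n
polynomial (d , h) = boundPolynomial d , λ n → ≤-trans (h n) (≤-reflexive (sym (eval-bound d n)))

decidable-by : ∀ P {g : List Bool → Bool} {σ : List Bool → Stacks} {t} → Poly t →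
  (∀ w → P ⊢ input w ⇓ σ w ⟨ t (length w) ⟩) → (∀ w → isOne (top (Vec.lookup (σ w) zero)) ≡ g w) →
  PolyTimeDecidable (T ∘ g)
decidable-by P {g} p runs out = _ , proj₁ q , λ w → let c , run≡ , acc = decides P (runs w) in
  c , run-mono _ (proj₂ q (length w)) _ run≡ ,
  subst (λ b → T (g w) ⇔ T b) (sym (trans acc (out w))) (mk⇔ id id)
  where q = polynomial (Poly-+ (Poly-const 1) p)

computable-by : ∀ P {g : List Bool → List Bool} {σ : List Bool → Stacks} {t} → Poly t →
  (∀ w → P ⊢ input w ⇓ σ w ⟨ t (length w) ⟩) → (∀ w → bitPrefix (Vec.lookup (σ w) zero) ≡ g w) →
  PolyTimeComputable g
computable-by P p runs out = _ , proj₁ q , λ w → let c , run≡ , o = computes P (runs w) in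
  c , run-mono _ (proj₂ q (length w)) _ run≡ , trans o (out w)
  where q = polynomial p

Fun-decidable : (f : Fun (list bool) bool) → PolyTimeDecidable (T ∘ fn f)
Fun-decidable f = decidable-by (whole f) (wholeTime-Poly (deg (computable f))) (⇓whole f) (λ w → isOne-enc (fn f w))
  where
  isOne-enc : ∀ b → isOne (top (enc bool b ▹ [])) ≡ b
  isOne-enc true  = refl
  isOne-enc false = refl

wholeTime-out-Poly : ∀ d → Poly (λ n → wholeTime d n + ((8 * bound d (4 * n + 1) + 1) + (1 + (5 * bound d (4 * n + 1) + 1))))
wholeTime-out-Poly d = Poly-+ (wholeTime-Poly d) (Poly-+ (Poly-+ (Poly-* (Poly-const 8) p) (Poly-const 1))
    (Poly-+ (Poly-const 1) (Poly-+ (Poly-* (Poly-const 5) p) (Poly-const 1))))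
  where
  p : Poly (λ n → bound d (4 * n + 1))
  p = Poly-bound d (Poly-+ (Poly-* (Poly-const 4) Poly-id) (Poly-const 1))

Fun-computable : (f : Fun (list bool) (list bool)) → PolyTimeComputable (fn f)
Fun-computable f = computable-by (whole f ⨾ emit ⨾ pop dataˢ ⨾ restoreLoop scratch) (wholeTime-out-Poly d)
  (λ w → ⇓seq (⇓whole f w) (⇓seq (⇓≤ (+-monoˡ-≤ 1 (*-monoʳ-≤ 8 (len≤ w))) (⇓emit (fn f w))) (⇓seq ⇓pop
          (⇓≤ (+-monoˡ-≤ 1 (*-monoʳ-≤ 5 (len≤ w))) (reload-loop (fn f w) (⇓done refl))))))
  (λ w → prefix (fn f w))
  where
  d = deg (computable f)
  len≤ : ∀ w → length (fn f w) ≤ bound d (4 * length w + 1)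
  len≤ w = ≤-trans (length≤∣bits∣ (fn f w)) (≤-trans (growth (computable f) w) (bound-mono d (∣bits∣≤ w)))
  prefix : ∀ v → bitPrefix {1} (map bit v ++ []) ≡ v
  prefix []      = refl
  prefix (b ∷ v) = cong (b ∷_) (prefix v)

-- Combinators with context for polynomial-time functions

Poly-deg : ∀ {A B} (f : Fun A B) → Poly (bound (deg (computable f)))
Poly-deg f = Poly-bound (deg (computable f)) Poly-id

grows : ∀ {A B} (f : Fun A B) x → ∣_∣ {B} (fn f x) ≤ bound (deg (computable f)) (∣_∣ {A} x)
grows f = growth (computable f)

∣≡∣ : ∀ {A} {x y : ⟦ A ⟧} {n} → x ≡ y → ∣_∣ {A} y ≤ n → ∣_∣ {A} x ≤ n
∣≡∣ refl p = p

abstract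
  -- Allows `fn` to be the intended function by definition instead of the composite of combinators,
  -- so that specifications of large programs hold by computation.
  ext-computable : ∀ {A B} (f : Fun A B) (g : ⟦ A ⟧ → ⟦ B ⟧) → (∀ x → fn f x ≡ g x) → Computable {A} {B} g
  ext-computable {A} {B} (f by F) g eq = record
    { prog = prog F ; deg = deg F
    ; correct = λ x a b → subst (λ y → prog F ⊢ _ ⇓ st (enc B y ▹ a) b ⟨ _ ⟩) (eq x) (correct F x a b)
    ; growth = λ x → subst (λ y → ∣_∣ {B} y ≤ _) (eq x) (growth F x) }

infix 2 _as_by-ext_
_as_by-ext_ : ∀ {A B} (f : Fun A B) (g : ⟦ A ⟧ → ⟦ B ⟧) → (∀ x → fn f x ≡ g x) → Fun A B
f as g by-ext eq = g by ext-computable f g eq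

coerceF : ∀ {A B} (f : ⟦ A ⟧ → ⟦ B ⟧) → (∀ x → enc B (f x) ≡ enc A x) → Fun A B
coerceF f eq = f by coerce-computable f eq

idF : ∀ {A} → Fun A A
idF = coerceF (λ x → x) (λ _ → refl)

constF : ∀ {A B} → ⟦ B ⟧ → Fun A B
constF y = (λ _ → y) by const-computable y

infixr 9 _∘F_
_∘F_ : ∀ {A B C} → Fun B C → Fun A B → Fun A C
f ∘F g = (λ x → fn f (fn g x)) by ∘-computable f g

infixr 4 _,F_
_,F_ : ∀ {A B C} → Fun A B → Fun A C → Fun A (B ⊗ C)
f ,F g = (λ x → fn f x , fn g x) by pair-computable f g

fstF : ∀ {A B} → Fun (A ⊗ B) A
fstF = proj₁ by fst-computable

sndF : ∀ {A B} → Fun (A ⊗ B) B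
sndF = proj₂ by snd-computable

caseF : ∀ {Γ A C} → Fun Γ (list A) → Fun Γ C → Fun (Γ ⊗ A ⊗ list A) C → Fun Γ C
caseF e n c = (caseList (fn n) (fn c) by case-computable n c) ∘F (idF ,F e)

letF : ∀ {Γ A C} → Fun Γ A → Fun (Γ ⊗ A) C → Fun Γ C
letF e f = f ∘F (idF ,F e)

ifF : ∀ {Γ C} → Fun Γ bool → Fun Γ C → Fun Γ C → Fun Γ C
ifF {Γ} c t e = caseF (coerceF units units-enc ∘F c) e (t ∘F fstF)
  as (λ γ → if fn c γ then fn t γ else fn e γ) by-ext λ γ → lemma γ (fn c γ)
  where
  units : Bool → List ⊤
  units false = []
  units true  = tt ∷ []
  units-enc : ∀ b → enc (list 𝟙) (units b) ≡ enc bool b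
  units-enc false = refl
  units-enc true  = refl
  lemma : ∀ γ b → caseList (fn e) (fn t ∘ proj₁) (γ , units b) ≡ (if b then fn t γ else fn e γ)
  lemma γ false = refl
  lemma γ true  = refl

andF orF : ∀ {Γ} → Fun Γ bool → Fun Γ bool → Fun Γ bool
andF f g = ifF f g (constF false) as (λ γ → fn f γ ∧ fn g γ) by-ext λ γ → lemma (fn f γ)
  where lemma : ∀ b {c} → (if b then c else false) ≡ b ∧ c
        lemma true  = refl
        lemma false = refl
orF f g = ifF f (constF true) g as (λ γ → fn f γ ∨ fn g γ) by-ext λ γ → lemma (fn f γ)
  where lemma : ∀ b {c} → (if b then true else c) ≡ b ∨ c
        lemma true  = refl
        lemma false = refl

notF : ∀ {Γ} → Fun Γ bool → Fun Γ bool
notF f = ifF f (constF false) (constF true) as (λ γ → not (fn f γ)) by-ext λ γ → lemma (fn f γ)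
  where lemma : ∀ b → (if b then false else true) ≡ not b
        lemma true  = refl
        lemma false = refl

module _ {Γ A B : Ty} (e : Fun Γ (list A)) (z : Fun Γ B) (s : Fun (Γ ⊗ A ⊗ B) B) where

  private
    -- The step of `foldr-computable` has no context, so γ travels inside the accumulator.
    S : Fun (A ⊗ Γ ⊗ B) (Γ ⊗ B)
    S = fstF ∘F sndF ,F s ∘F (fstF ∘F sndF ,F fstF ,F sndF ∘F sndF)

    threaded : ∀ γ b ys → foldr (curry (fn S)) (γ , b) ys ≡ (γ , foldr (λ a b → fn s (γ , a , b)) b ys)
    threaded γ b []       = refl
    threaded γ b (y ∷ ys) = cong (λ p → fn S (y , p)) (threaded γ b ys)

  foldF : ∀ d →
    (∀ γ ys → ∣_∣ {B} (foldr (λ a b → fn s (γ , a , b)) (fn z γ) ys) ≤ bound d (∣_∣ {list A} ys + ∣_∣ {Γ} γ)) → Fun Γ B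
  foldF d h = sndF ∘F (_ by foldr-computable (e ,F idF ,F z) S (proj₁ p) λ γ ys →
      ∣≡∣ {Γ ⊗ B} (threaded γ (fn z γ) ys)
        (≤-trans (s≤s (+-mono-≤ (m≤n+m _ (∣_∣ {list A} ys)) (h γ ys))) (proj₂ p _)))
    as (λ γ → foldr (λ a b → fn s (γ , a , b)) (fn z γ) (fn e γ))
    by-ext λ γ → cong proj₂ (threaded γ (fn z γ) (fn e γ))
    where
    p : Poly (λ n → 1 + (n + bound d n))
    p = Poly-+ (Poly-const 1) (Poly-+ Poly-id (Poly-bound d Poly-id))

  -- If the accumulator enters the size of the result with coefficient one, and the rest depends on
  -- γ and the element only, then the increments just add up. Most folds below are of this kind.
  foldF-additive : ∀ {q} → Poly q →
    (∀ γ a b → ∣_∣ {B} (fn s (γ , a , b)) ≤ ∣_∣ {B} b + q (∣_∣ {Γ} γ + ∣_∣ {A} a)) → Fun Γ B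
  foldF-additive {q} (d , q≤) h = foldF (proj₁ p) λ γ ys → ≤-trans (total γ ys) (proj₂ p _)
    where
    p : Poly (λ n → bound (deg (computable z)) n + n * bound d n)
    p = Poly-+ (Poly-deg z) (Poly-* Poly-id (Poly-bound d Poly-id))
    open ≤-Reasoning
    steps : ∀ γ ys N → ∣_∣ {list A} ys ≤ N →
      ∣_∣ {B} (foldr (λ a b → fn s (γ , a , b)) (fn z γ) ys) ≤ ∣_∣ {B} (fn z γ) + ∣_∣ {list A} ys * bound d (∣_∣ {Γ} γ + N)
    steps γ []       N le = m≤m+n _ _
    steps γ (y ∷ ys) N le = begin
      ∣_∣ {B} (fn s (γ , y , foldr (λ a b → fn s (γ , a , b)) (fn z γ) ys))
        ≤⟨ h γ y _ ⟩
      ∣_∣ {B} (foldr (λ a b → fn s (γ , a , b)) (fn z γ) ys) + q (∣_∣ {Γ} γ + ∣_∣ {A} y)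
        ≤⟨ +-mono-≤ (steps γ ys N (≤-trans tail≤ le)) (≤-trans (q≤ _) (bound-mono d (+-monoʳ-≤ (∣_∣ {Γ} γ) (≤-trans head≤ le)))) ⟩
      Z + n * K + K   ≡⟨ arith Z n K ⟩
      Z + suc n * K   ≤⟨ +-monoʳ-≤ Z (*-monoˡ-≤ K (s≤s (m≤n+m n (∣_∣ {A} y)))) ⟩
      Z + ∣_∣ {list A} (y ∷ ys) * K ∎
      where
      Z = ∣_∣ {B} (fn z γ)
      n = ∣_∣ {list A} ys
      K = bound d (∣_∣ {Γ} γ + N)
      arith : ∀ z n k → z + n * k + k ≡ z + suc n * k
      arith = solve-∀
      tail≤ : n ≤ ∣_∣ {list A} (y ∷ ys)
      tail≤ = m≤n⇒m≤1+n (m≤n+m n (∣_∣ {A} y))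
      head≤ : ∣_∣ {A} y ≤ ∣_∣ {list A} (y ∷ ys)
      head≤ = m≤n⇒m≤1+n (m≤m+n (∣_∣ {A} y) n)
    total : ∀ γ ys → let n = ∣_∣ {list A} ys + ∣_∣ {Γ} γ in
      ∣_∣ {B} (foldr (λ a b → fn s (γ , a , b)) (fn z γ) ys) ≤ bound (deg (computable z)) n + n * bound d n
    total γ ys = ≤-trans (steps γ ys _ ≤-refl) (+-mono-≤
      (≤-trans (grows z γ) (bound-mono (deg (computable z)) (m≤n+m _ (∣_∣ {list A} ys))))
      (*-mono-≤ (m≤m+n (∣_∣ {list A} ys) (∣_∣ {Γ} γ)) (bound-mono d (≤-reflexive (+-comm (∣_∣ {Γ} γ) (∣_∣ {list A} ys))))))

consF : ∀ {Γ A} → Fun Γ A → Fun Γ (list A) → Fun Γ (list A)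
consF {A = A} x xs = coerceF {A ⊗ list A} (λ { (x , xs) → x ∷ xs }) (λ _ → refl) ∘F (x ,F xs)

mapF : ∀ {Γ A B} → Fun (Γ ⊗ A) B → Fun Γ (list A) → Fun Γ (list B)
mapF {Γ} {A} {B} f e = foldF-additive e (constF []) (consF (f ∘F (fstF ,F fstF ∘F sndF)) (sndF ∘F sndF))
    (Poly-+ (Poly-const 1) (Poly-bound (deg (computable f)) (Poly-+ (Poly-const 1) Poly-id)))
    (λ γ a b → ≤-trans (≤-reflexive (cong suc (+-comm _ (∣_∣ {list B} b))))
      (≤-trans (s≤s (+-monoʳ-≤ (∣_∣ {list B} b) (grows f (γ , a)))) (≤-reflexive (sym (+-suc (∣_∣ {list B} b) _)))))
  as (λ γ → map (λ a → fn f (γ , a)) (fn e γ)) by-ext λ γ → lemma γ (fn e γ)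
  where
  lemma : ∀ γ xs → foldr (λ a b → fn f (γ , a) ∷ b) [] xs ≡ map (λ a → fn f (γ , a)) xs
  lemma γ []       = refl
  lemma γ (x ∷ xs) = cong (_ ∷_) (lemma γ xs)

filterF : ∀ {Γ A} → Fun (Γ ⊗ A) bool → Fun Γ (list A) → Fun Γ (list A)
filterF {Γ} {A} f e = foldF-additive e (constF [])
    (ifF (f ∘F (fstF ,F fstF ∘F sndF)) (consF (fstF ∘F sndF) (sndF ∘F sndF)) (sndF ∘F sndF))
    (Poly-+ (Poly-const 1) Poly-id) (λ γ a b → small γ a b (fn f (γ , a)))
  as (λ γ → filterᵇ (λ a → fn f (γ , a)) (fn e γ)) by-ext λ γ → lemma γ (fn e γ)
  where
  small : ∀ γ a b c → ∣_∣ {list A} (if c then a ∷ b else b) ≤ ∣_∣ {list A} b + (1 + (∣_∣ {Γ} γ + ∣_∣ {A} a))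
  small γ a b false = m≤m+n _ _
  small γ a b true  = ≤-trans (s≤s (≤-trans (+-monoˡ-≤ _ (m≤n+m _ (∣_∣ {Γ} γ))) (≤-reflexive (+-comm (∣_∣ {Γ} γ + ∣_∣ {A} a) _))))
                        (≤-reflexive (sym (+-suc _ _)))
  lemma : ∀ γ xs → foldr (λ a b → if fn f (γ , a) then a ∷ b else b) [] xs ≡ filterᵇ (λ a → fn f (γ , a)) xs
  lemma γ []       = refl
  lemma γ (x ∷ xs) with fn f (γ , x)
  ... | true  = cong (x ∷_) (lemma γ xs)
  ... | false = lemma γ xs

∣++∣ : ∀ {A} (xs ys : List ⟦ A ⟧) → ∣_∣ {list A} (xs ++ ys) ≤ ∣_∣ {list A} xs + ∣_∣ {list A} ys
∣++∣ []       ys = n≤1+n _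
∣++∣ {A} (x ∷ xs) ys = s≤s (≤-trans (+-monoʳ-≤ (∣_∣ {A} x) (∣++∣ {A} xs ys)) (≤-reflexive (sym (+-assoc (∣_∣ {A} x) _ _))))

infixr 5 _++F_
_++F_ : ∀ {Γ A} → Fun Γ (list A) → Fun Γ (list A) → Fun Γ (list A)
_++F_ {Γ} {A} e f = foldF-additive e f (consF (fstF ∘F sndF) (sndF ∘F sndF)) (Poly-+ (Poly-const 1) Poly-id)
    (λ γ a b → ≤-trans (≤-reflexive (trans (cong suc (+-comm (∣_∣ {A} a) _)) (sym (+-suc _ _))))
      (+-monoʳ-≤ _ (s≤s (m≤n+m _ (∣_∣ {Γ} γ)))))
  as (λ γ → fn e γ ++ fn f γ) by-ext λ γ → lemma (fn e γ) (fn f γ)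
  where
  lemma : ∀ xs ys → foldr _∷_ ys xs ≡ xs ++ ys
  lemma []       ys = refl
  lemma (x ∷ xs) ys = cong (x ∷_) (lemma xs ys)

concatF : ∀ {Γ A} → Fun Γ (list (list A)) → Fun Γ (list A)
concatF {Γ} {A} e = foldF-additive e (constF []) (fstF ∘F sndF ++F sndF ∘F sndF) Poly-id
    (λ γ a b → ≤-trans (∣++∣ {A} a b) (≤-trans (≤-reflexive (+-comm (∣_∣ {list A} a) _)) (+-monoʳ-≤ (∣_∣ {list A} b) (m≤n+m (∣_∣ {list A} a) (∣_∣ {Γ} γ)))))
  as (λ γ → concat (fn e γ)) by-ext λ γ → lemma (fn e γ)
  where
  lemma : ∀ xss → foldr _++_ [] xss ≡ concat xss
  lemma []         = refl
  lemma (xs ∷ xss) = cong (xs ++_) (lemma xss)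

-- Unary numbers

∣nat∣ : ∀ n → ∣_∣ {nat} n ≡ suc (n + n)
∣nat∣ zero    = refl
∣nat∣ (suc n) = trans (cong (2 +_) (∣nat∣ n)) (cong (2 +_) (sym (+-suc n n)))

n≤∣nat∣ : ∀ n → n ≤ ∣_∣ {nat} n
n≤∣nat∣ n = subst (n ≤_) (sym (∣nat∣ n)) (m≤n⇒m≤1+n (m≤m+n n n))

sucF : ∀ {Γ} → Fun Γ nat → Fun Γ nat
sucF e = coerceF {𝟙 ⊗ nat} {nat} (λ p → suc (proj₂ p)) (λ _ → refl) ∘F (constF tt ,F e)

unitsF : ∀ {Γ} → Fun Γ nat → Fun Γ (list 𝟙)
unitsF e = coerceF {nat} {list 𝟙} (λ n → replicate n tt) units-enc ∘F e
  where
  units-enc : ∀ n → enc (list 𝟙) (replicate n tt) ≡ enc nat n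
  units-enc zero    = refl
  units-enc (suc n) = cong (node leaf) (units-enc n)

iter : ∀ {X : Set} → ℕ → (X → X) → X → X
iter zero    f x = x
iter (suc n) f x = f (iter n f x)

iter-shift : ∀ {X : Set} (f : X → X) n x → iter (suc n) f x ≡ iter n f (f x)
iter-shift f zero    x = refl
iter-shift f (suc n) x = cong f (iter-shift f n x)

length≤∣list∣ : ∀ {A} (xs : List ⟦ A ⟧) → length xs ≤ ∣_∣ {list A} xs
length≤∣list∣ []           = z≤n
length≤∣list∣ {A} (x ∷ xs) = s≤s (≤-trans (length≤∣list∣ {A} xs) (m≤n+m _ (∣_∣ {A} x)))

module _ {Γ B : Ty} (n : Fun Γ nat) (z : Fun Γ B) (s : Fun (Γ ⊗ B) B) where

  private
    S : Fun (Γ ⊗ 𝟙 ⊗ B) B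
    S = s ∘F (fstF ,F sndF ∘F sndF)

    fold-iter : ∀ γ (ys : List ⊤) → foldr (λ a b → fn S (γ , a , b)) (fn z γ) ys ≡ iter (length ys) (λ b → fn s (γ , b)) (fn z γ)
    fold-iter γ []       = refl
    fold-iter γ (y ∷ ys) = cong (λ b → fn s (γ , b)) (fold-iter γ ys)

    result : Fun Γ B → Set
    result f = ∀ γ → fn f γ ≡ foldr (λ a b → fn S (γ , a , b)) (fn z γ) (replicate (fn n γ) tt)

    as-iter : (f : Fun Γ B) → result f → Fun Γ B
    as-iter f eq = f as (λ γ → iter (fn n γ) (λ b → fn s (γ , b)) (fn z γ))
      by-ext λ γ → trans (eq γ) (trans (fold-iter γ (replicate (fn n γ) tt)) (cong (λ m → iter m (λ b → fn s (γ , b)) (fn z γ)) (length-replicate (fn n γ) {tt})))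

  iterF : ∀ d → (∀ γ m → ∣_∣ {B} (iter m (λ b → fn s (γ , b)) (fn z γ)) ≤ bound d (m + ∣_∣ {Γ} γ)) → Fun Γ B
  iterF d h = as-iter (foldF (unitsF n) z S d λ γ ys →
    ≤-trans (≤-reflexive (cong (∣_∣ {B}) (fold-iter γ ys)))
      (≤-trans (h γ _) (bound-mono d (+-monoˡ-≤ _ (length≤∣list∣ {𝟙} ys))))) (λ _ → refl)

  iterF-additive : ∀ {q} → Poly q → (∀ γ b → ∣_∣ {B} (fn s (γ , b)) ≤ ∣_∣ {B} b + q (∣_∣ {Γ} γ)) → Fun Γ B
  iterF-additive {q} (d , q≤) h = as-iter (foldF-additive (unitsF n) z S (Poly-bound d Poly-id) λ γ a b →
    ≤-trans (h γ b) (+-monoʳ-≤ _ (≤-trans (q≤ _) (bound-mono d (m≤m+n _ 1))))) (λ _ → refl)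

lengthF : ∀ {Γ A} → Fun Γ (list A) → Fun Γ nat
lengthF e = foldF-additive e (constF 0) (sucF (sndF ∘F sndF)) (Poly-const 2) (λ γ a b → ≤-reflexive (+-comm 2 _))
  as (λ γ → length (fn e γ)) by-ext λ γ → lemma (fn e γ)
  where
  lemma : ∀ {X : Set} (xs : List X) → foldr (λ _ n → suc n) 0 xs ≡ length xs
  lemma []       = refl
  lemma (x ∷ xs) = cong suc (lemma xs)

infixl 6 _+F_
infixl 7 _*F_
_+F_ _*F_ _∸F_ : ∀ {Γ} → Fun Γ nat → Fun Γ nat → Fun Γ nat
m +F n = iterF-additive m n (sucF sndF) (Poly-const 2) (λ γ b → ≤-reflexive (+-comm 2 _))
  as (λ γ → fn m γ + fn n γ) by-ext λ γ → lemma (fn m γ) (fn n γ)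
  where
  lemma : ∀ m n → iter m suc n ≡ m + n
  lemma zero    n = refl
  lemma (suc m) n = cong suc (lemma m n)

_*F_ {Γ} m n = iterF-additive m (constF 0) (n ∘F fstF +F sndF) (Poly-deg n) (λ γ b →
      ≤-trans (≤-reflexive (∣nat∣ (fn n γ + b))) (≤-trans (≤-trans (m≤m+n _ 1) (≤-reflexive (arith (fn n γ) b)))
        (+-mono-≤ (≤-reflexive (sym (∣nat∣ b))) (≤-trans (≤-reflexive (sym (∣nat∣ (fn n γ)))) (grows n γ)))))
  as (λ γ → fn m γ * fn n γ) by-ext λ γ → lemma (fn m γ) (fn n γ)
  where
  arith : ∀ x y → suc (x + y + (x + y)) + 1 ≡ suc (y + y) + suc (x + x)
  arith = solve-∀
  lemma : ∀ m n → iter m (n +_) 0 ≡ m * n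
  lemma zero    n = refl
  lemma (suc m) n = cong (n +_) (lemma m n)

predF : Fun nat nat
predF = caseF (unitsF idF) (constF 0) (lengthF (sndF ∘F sndF))
  as pred by-ext λ { zero → refl ; (suc n) → length-replicate n }

∣pred∣ : ∀ n → ∣_∣ {nat} (pred n) ≤ ∣_∣ {nat} n
∣pred∣ zero    = ≤-refl
∣pred∣ (suc n) = m≤n+m _ 2

m ∸F n = iterF-additive n m (predF ∘F sndF) (Poly-const 0) (λ γ b → ≤-trans (∣pred∣ b) (≤-reflexive (sym (+-identityʳ _))))
  as (λ γ → fn m γ ∸ fn n γ) by-ext λ γ → lemma (fn m γ) (fn n γ)
  where
  lemma : ∀ m n → iter n pred m ≡ m ∸ n
  lemma m zero    = refl
  lemma m (suc n) = trans (cong pred (lemma m n)) (pred[m∸n]≡m∸[1+n] m n)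

leqF eqF : ∀ {Γ} → Fun Γ nat → Fun Γ nat → Fun Γ bool
leqF m n = caseF (unitsF (m ∸F n)) (constF true) (constF false)
  as (λ γ → fn m γ ≤ᵇ fn n γ) by-ext λ γ → lemma (fn m γ) (fn n γ)
  where
  lemma : ∀ m n {X : Set} {γ : X} → caseList (λ _ → true) (λ _ → false) (γ , replicate (m ∸ n) tt) ≡ (m ≤ᵇ n)
  lemma zero    n       rewrite 0∸n≡0 n = refl
  lemma (suc m) zero    = refl
  lemma (suc zero) (suc n) {γ = γ} = lemma zero n {γ = γ}
  lemma (suc (suc m)) (suc n) {γ = γ} = lemma (suc m) n {γ = γ}
eqF m n = andF (leqF m n) (leqF n m)
  as (λ γ → fn m γ ≡ᵇ fn n γ) by-ext λ γ → lemma (fn m γ) (fn n γ)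
  where
  ≤ᵇ-suc : ∀ m n → (suc m ≤ᵇ suc n) ≡ (m ≤ᵇ n)
  ≤ᵇ-suc zero    n = refl
  ≤ᵇ-suc (suc m) n = refl
  lemma : ∀ m n → (m ≤ᵇ n) ∧ (n ≤ᵇ m) ≡ (m ≡ᵇ n)
  lemma zero    zero    = refl
  lemma zero    (suc n) = refl
  lemma (suc m) zero    = refl
  lemma (suc m) (suc n) = trans (cong₂ _∧_ (≤ᵇ-suc m n) (≤ᵇ-suc n m)) (lemma m n)

∣list∣≤ : ∀ {A} K {xs : List ⟦ A ⟧} → All (λ x → ∣_∣ {A} x ≤ K) xs → ∣_∣ {list A} xs ≤ suc (length xs * suc K)
∣list∣≤ K [] = ≤-refl
∣list∣≤ {A} K {x ∷ xs} (p ∷ ps) = s≤s (≤-trans (+-mono-≤ p (∣list∣≤ {A} K ps)) (≤-reflexive (+-suc K _)))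

upToF : ∀ {Γ} → Fun Γ nat → Fun Γ (list nat)
upToF n = iterF n (constF []) (consF (constF 0) (mapF (sucF sndF) sndF)) (proj₁ p)
    (λ γ m → ∣≡∣ {list nat} (iter-upTo m)
      (≤-trans (∣upTo∣ m) (≤-trans (proj₂ p m) (bound-mono (proj₁ p) (m≤m+n m _)))))
  as (λ γ → upTo (fn n γ)) by-ext λ γ → iter-upTo (fn n γ)
  where
  p : Poly (λ m → 1 + m * (2 + 2 * m))
  p = Poly-+ (Poly-const 1) (Poly-* Poly-id (Poly-+ (Poly-const 2) (Poly-* (Poly-const 2) Poly-id)))
  iter-upTo : ∀ m → iter m (λ acc → 0 ∷ map suc acc) [] ≡ upTo m
  iter-upTo zero    = refl
  iter-upTo (suc m) = cong (0 ∷_) (trans (cong (map suc) (iter-upTo m)) (map-upTo suc m))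
  ∣map-suc∣ : ∀ xs → ∣_∣ {list nat} (map suc xs) ≡ ∣_∣ {list nat} xs + 2 * length xs
  ∣map-suc∣ []       = refl
  ∣map-suc∣ (x ∷ xs) = trans (cong (λ z → suc (suc (suc (∣_∣ {nat} x)) + z)) (∣map-suc∣ xs))
                         (arith (∣_∣ {nat} x) (∣_∣ {list nat} xs) (length xs))
    where arith : ∀ a b c → suc (suc (suc a) + (b + 2 * c)) ≡ suc (a + b) + 2 * suc c
          arith = solve-∀
  ∣upTo∣ : ∀ m → ∣_∣ {list nat} (upTo m) ≤ 1 + m * (2 + 2 * m)
  ∣upTo∣ zero    = ≤-refl
  ∣upTo∣ (suc m) = begin
    2 + ∣_∣ {list nat} (applyUpTo suc m)          ≡⟨ cong (λ v → 2 + ∣_∣ {list nat} v) (map-upTo suc m) ⟨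
    2 + ∣_∣ {list nat} (map suc (upTo m))         ≡⟨ cong (2 +_) (∣map-suc∣ (upTo m)) ⟩
    2 + (∣_∣ {list nat} (upTo m) + 2 * length (upTo m)) ≡⟨ cong (λ k → 2 + (∣_∣ {list nat} (upTo m) + 2 * k)) (length-upTo m) ⟩
    2 + (∣_∣ {list nat} (upTo m) + 2 * m)         ≤⟨ +-monoʳ-≤ 2 (+-monoˡ-≤ (2 * m) (∣upTo∣ m)) ⟩
    2 + ((1 + m * (2 + 2 * m)) + 2 * m)           ≤⟨ m≤m+n _ (2 * m + 2) ⟩
    2 + ((1 + m * (2 + 2 * m)) + 2 * m) + (2 * m + 2) ≡⟨ arith m ⟩
    1 + suc m * (2 + 2 * suc m)                   ∎
    where
    open ≤-Reasoning
    arith : ∀ m → 2 + ((1 + m * (2 + 2 * m)) + 2 * m) + (2 * m + 2) ≡ 1 + suc m * (2 + 2 * suc m)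
    arith = solve-∀

dropF : ∀ {Γ A} → Fun Γ nat → Fun Γ (list A) → Fun Γ (list A)
dropF {A = A} n xs = iterF-additive n xs tailF (Poly-const 0)
    (λ γ b → ≤-trans (∣tail∣ γ b) (≤-reflexive (sym (+-identityʳ _))))
  as (λ γ → drop (fn n γ) (fn xs γ)) by-ext λ γ → lemma γ (fn n γ) (fn xs γ)
  where
  tailF : ∀ {Γ} → Fun (Γ ⊗ list A) (list A)
  tailF = caseF sndF (constF []) (sndF ∘F sndF)
  ∣tail∣ : ∀ {Γ} (γ : ⟦ Γ ⟧) b → ∣_∣ {list A} (fn (tailF {Γ}) (γ , b)) ≤ ∣_∣ {list A} b
  ∣tail∣ γ []       = ≤-refl
  ∣tail∣ γ (x ∷ xs) = m≤n⇒m≤1+n (m≤n+m _ (∣_∣ {A} x))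
  tail-drop : ∀ {Γ} (γ : ⟦ Γ ⟧) n xs → fn (tailF {Γ}) (γ , drop n xs) ≡ drop (suc n) xs
  tail-drop γ zero    []       = refl
  tail-drop γ (suc n) []       = refl
  tail-drop γ zero    (x ∷ xs) = refl
  tail-drop {Γ} γ (suc n) (x ∷ xs) = tail-drop {Γ} γ n xs
  lemma : ∀ {Γ} (γ : ⟦ Γ ⟧) n xs → iter n (λ b → fn (tailF {Γ}) (γ , b)) xs ≡ drop n xs
  lemma γ zero    xs = refl
  lemma {Γ} γ (suc n) xs = trans (cong (λ b → fn (tailF {Γ}) (γ , b)) (lemma {Γ} γ n xs)) (tail-drop {Γ} γ n xs)

at : ∀ {X : Set} → X → List X → ℕ → X
at d []       _       = d
at d (x ∷ xs) zero    = x
at d (x ∷ xs) (suc i) = at d xs i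

atF : ∀ {Γ A} → ⟦ A ⟧ → Fun Γ (list A) → Fun Γ nat → Fun Γ A
atF {A = A} d xs i = caseF (dropF i xs) (constF d) (fstF ∘F sndF)
  as (λ γ → at d (fn xs γ) (fn i γ)) by-ext λ γ → lemma γ (fn i γ) (fn xs γ)
  where
  lemma : ∀ {X : Set} (γ : X) i xs → caseList (λ _ → d) (λ p → proj₁ (proj₂ p)) (γ , drop i xs) ≡ at d xs i
  lemma γ zero    []       = refl
  lemma γ (suc i) []       = refl
  lemma γ zero    (x ∷ xs) = refl
  lemma γ (suc i) (x ∷ xs) = lemma γ i xs

∣bool∣≤3 : ∀ b → ∣_∣ {bool} b ≤ 3
∣bool∣≤3 true  = ≤-refl
∣bool∣≤3 false = s≤s z≤n

bool≤bound : ∀ b n → ∣_∣ {bool} b ≤ bound (proj₁ (Poly-const 3)) n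
bool≤bound b n = ≤-trans (∣bool∣≤3 b) (proj₂ (Poly-const 3) n)

allF anyF : ∀ {Γ A} → Fun (Γ ⊗ A) bool → Fun Γ (list A) → Fun Γ bool
allF f e = foldF (mapF f e) (constF true) (andF (fstF ∘F sndF) (sndF ∘F sndF)) _ (λ γ ys → bool≤bound (foldr _∧_ true ys) (∣_∣ {list bool} ys + _))
  as (λ γ → all (λ a → fn f (γ , a)) (fn e γ)) by-ext λ γ → refl
anyF f e = foldF (mapF f e) (constF false) (orF (fstF ∘F sndF) (sndF ∘F sndF)) _ (λ γ ys → bool≤bound (foldr _∨_ false ys) (∣_∣ {list bool} ys + _))
  as (λ γ → any (λ a → fn f (γ , a)) (fn e γ)) by-ext λ γ → refl

eqBool : Bool → Bool → Bool
eqBool a b = if a then b else not b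

-- Compared position by position, since recursion runs over a single list at a time.
eqBits : List Bool → List Bool → Bool
eqBits xs ys = (length xs ≡ᵇ length ys) ∧ all (λ i → eqBool (at false xs i) (at false ys i)) (upTo (length xs))

eqBitsF : ∀ {Γ} → Fun Γ (list bool) → Fun Γ (list bool) → Fun Γ bool
eqBitsF xs ys = andF (eqF (lengthF xs) (lengthF ys))
  (allF (ifF (atF false (xs ∘F fstF) sndF) (atF false (ys ∘F fstF) sndF) (notF (atF false (ys ∘F fstF) sndF))) (upToF (lengthF xs)))

all-suc : ∀ (p : ℕ → Bool) n → all p (upTo (suc n)) ≡ p 0 ∧ all (p ∘ suc) (upTo n)
all-suc p n = cong (λ v → p 0 ∧ and v) (trans (cong (map p) (sym (map-upTo suc n))) (sym (map-∘ (upTo n))))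

eqBits-correct : ∀ xs ys → T (eqBits xs ys) ⇔ xs ≡ ys
eqBits-correct []       []       = mk⇔ (λ _ → refl) (λ _ → tt)
eqBits-correct []       (y ∷ ys) = mk⇔ (λ ()) (λ ())
eqBits-correct (x ∷ xs) []       = mk⇔ (λ ()) (λ ())
eqBits-correct (x ∷ xs) (y ∷ ys) = mk⇔ to from
  where
  tail : ℕ → Bool
  tail i = eqBool (at false xs i) (at false ys i)
  heads : ∀ x y → T (eqBool x y) → x ≡ y
  heads true  true  _ = refl
  heads false false _ = refl
  heads≡ : ∀ x → T (eqBool x x)
  heads≡ true  = tt
  heads≡ false = tt
  split : eqBits (x ∷ xs) (y ∷ ys) ≡ (length xs ≡ᵇ length ys) ∧ (eqBool x y ∧ all tail (upTo (length xs)))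
  split = cong ((length xs ≡ᵇ length ys) ∧_)
    (all-suc (λ i → eqBool (at false (x ∷ xs) i) (at false (y ∷ ys) i)) (length xs))
  to : T (eqBits (x ∷ xs) (y ∷ ys)) → x ∷ xs ≡ y ∷ ys
  to p with ⇒ (T-∧ {length xs ≡ᵇ length ys}) (subst T split p)
  ... | l , q with ⇒ (T-∧ {eqBool x y}) q
  ... | h , t = cong₂ _∷_ (heads x y h) (⇒ (eqBits-correct xs ys) (⇐ T-∧ (l , t)))
  from : x ∷ xs ≡ y ∷ ys → T (eqBits (x ∷ xs) (y ∷ ys))
  from refl with ⇒ (T-∧ {length xs ≡ᵇ length xs}) (⇐ (eqBits-correct xs xs) refl)
  ... | l , t = subst T (sym split) (⇐ T-∧ (l , ⇐ (T-∧ {eqBool x x}) (heads≡ x , t)))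

-- Bijective base-2 numerals

digit : Bool → ℕ
digit false = 1
digit true  = 2

val : List Bool → ℕ
val []       = 0
val (b ∷ ds) = digit b + 2 * val ds

2^length≤ : ∀ ds → 2 ^ length ds ≤ suc (val ds)
2^length≤ []       = ≤-refl
2^length≤ (b ∷ ds) = ≤-trans (*-monoʳ-≤ 2 (2^length≤ ds)) (≤-trans (≤-reflexive (*-suc 2 (val ds)))
  (s≤s (+-monoˡ-≤ (2 * val ds) (1≤digit b))))
  where
  1≤digit : ∀ b → 1 ≤ digit b
  1≤digit true  = s≤s z≤n
  1≤digit false = ≤-refl

length≤width : ∀ m {ds} → val ds < 2 ^ m → length ds ≤ m
length≤width m {ds} lt = ≮⇒≥ λ m<l → <⇒≱ (^-monoʳ-< 2 (s≤s (s≤s z≤n)) m<l) (≤-trans (2^length≤ ds) lt)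

val<2^ : ∀ ds → val ds < 2 ^ suc (length ds)
-- The largest numeral with l digits, all of them 2, is worth 2 ^ (l + 1) - 2; this sharp bound is
-- the one that passes the induction.
val<2^ ds = ≤-trans (n≤1+n _) (go ds)
  where
  digit≤2 : ∀ b → digit b ≤ 2
  digit≤2 true  = ≤-refl
  digit≤2 false = s≤s z≤n
  go : ∀ ds → 2 + val ds ≤ 2 ^ suc (length ds)
  go []       = ≤-refl
  go (b ∷ ds) = ≤-trans (+-monoʳ-≤ 2 (+-monoˡ-≤ (2 * val ds) (digit≤2 b)))
    (≤-trans (≤-reflexive (arith (val ds))) (*-monoʳ-≤ 2 (go ds)))
    where arith : ∀ v → 2 + (2 + 2 * v) ≡ 2 * (2 + v)
          arith = solve-∀

∣bits∣≤width : ∀ m {ds} → val ds < 2 ^ m → ∣_∣ {list bool} ds ≤ 4 * m + 1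
∣bits∣≤width m {ds} lt = ≤-trans (∣bits∣≤ ds) (+-monoˡ-≤ 1 (*-monoʳ-≤ 4 (length≤width m {ds} lt)))

val-*-width : ∀ {a b} m n → a < 2 ^ m → b < 2 ^ n → a * b < 2 ^ (m + n)
val-*-width {a} {b} m n p q = ≤-trans (*-mono-< p q) (≤-reflexive (sym (^-distribˡ-+-* 2 m n)))

sucD : List Bool → List Bool
sucD []           = false ∷ []
sucD (false ∷ ds) = true ∷ ds
sucD (true ∷ ds)  = false ∷ sucD ds

val-sucD : ∀ ds → val (sucD ds) ≡ suc (val ds)
val-sucD []           = refl
val-sucD (false ∷ ds) = refl
val-sucD (true ∷ ds)  = trans (cong (λ v → 1 + 2 * v) (val-sucD ds)) (arith (val ds))
  where arith : ∀ v → 1 + 2 * suc v ≡ 3 + 2 * v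
        arith = solve-∀

∣sucD∣ : ∀ ds → ∣_∣ {list bool} (sucD ds) ≤ ∣_∣ {list bool} ds + 2
∣sucD∣ []           = ≤-refl
∣sucD∣ (false ∷ ds) = ≤-reflexive (+-comm 4 _) ▸ arith (∣_∣ {list bool} ds)
  where
  _▸_ : ∀ {a b c} → a ≤ b → b ≡ c → a ≤ c
  p ▸ refl = p
  arith : ∀ n → n + 4 ≡ suc (1 + n) + 2
  arith = solve-∀
∣sucD∣ (true ∷ ds)  = s≤s (s≤s (≤-trans (∣sucD∣ ds) (≤-trans (n≤1+n _) (n≤1+n _))))

-- A fold sees only the successor of the tail, but after a digit 1 the tail itself is wanted; hence
-- the fold returns the pair of both.
sucDF : ∀ {Γ} → Fun Γ (list bool) → Fun Γ (list bool)
sucDF e = sndF ∘F foldF e (constF ([] , false ∷ []))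
      (consF (fstF ∘F sndF) (fstF ∘F sndF ∘F sndF) ,F
       ifF (fstF ∘F sndF) (consF (constF false) (sndF ∘F sndF ∘F sndF)) (consF (constF true) (fstF ∘F sndF ∘F sndF)))
      (proj₁ p) (λ γ ys → ∣≡∣ {list bool ⊗ list bool} (lemma ys)
        (≤-trans (s≤s (+-monoʳ-≤ (∣_∣ {list bool} ys) (∣sucD∣ ys)))
          (≤-trans (proj₂ p (∣_∣ {list bool} ys)) (bound-mono (proj₁ p) (m≤m+n _ _)))))
  as (λ γ → sucD (fn e γ)) by-ext λ γ → cong proj₂ (lemma (fn e γ))
  where
  p : Poly (λ n → 1 + (n + (n + 2)))
  p = Poly-+ (Poly-const 1) (Poly-+ Poly-id (Poly-+ Poly-id (Poly-const 2)))
  lemma : ∀ ys → foldr (λ b s → (b ∷ proj₁ s) , (if b then false ∷ proj₂ s else true ∷ proj₁ s)) ([] , false ∷ []) ys ≡ (ys , sucD ys)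
  lemma []           = refl
  lemma (false ∷ ys) rewrite lemma ys = refl
  lemma (true ∷ ys)  rewrite lemma ys = refl

-- `zipSuffix` lets a right fold over one list consume a second one in step.
zipSuffix : ∀ {X Y : Set} → List X → List Y → List (X × List Y)
zipSuffix []       ys = []
zipSuffix (x ∷ xs) ys = (x , ys) ∷ zipSuffix xs (drop 1 ys)

zipSuffixF : ∀ {Γ A B} → ⟦ A ⟧ → Fun Γ (list A) → Fun Γ (list B) → Fun Γ (list (A ⊗ list B))
zipSuffixF d xs ys = mapF (atF d (xs ∘F fstF) sndF ,F dropF sndF (ys ∘F fstF)) (upToF (lengthF xs))
  as (λ γ → zipSuffix (fn xs γ) (fn ys γ)) by-ext λ γ → lemma (fn xs γ) (fn ys γ)
  where
  lemma : ∀ xs ys → map (λ i → at d xs i , drop i ys) (upTo (length xs)) ≡ zipSuffix xs ys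
  lemma []       ys = refl
  lemma (x ∷ xs) ys = cong ((x , ys) ∷_) (trans (cong (map _) (sym (map-upTo suc (length xs)))) (trans (sym (map-∘ (upTo (length xs))))
    (trans (map-cong (λ i → cong (at d xs i ,_) (sym (drop-drop 1 i ys))) (upTo (length xs))) (lemma xs (drop 1 ys)))))

-- Two digits add up to 2, 3 or 4, leaving the digits 2, 1, 2 with carries 0, 1, 1. A carry is
-- realised by a successor on the sum `c` of the higher digits.
addStep : Bool → List Bool → List Bool → List Bool
addStep x []      c = x ∷ c
addStep x (y ∷ _) c = if x then (if y then true ∷ sucD c else false ∷ sucD c)
                           else (if y then false ∷ sucD c else true ∷ c)

addD : List Bool → List Bool → List Bool
addD []       ys = ys
addD (x ∷ xs) ys = addStep x ys (addD xs (drop 1 ys))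

val-addD : ∀ xs ys → val (addD xs ys) ≡ val xs + val ys
val-addD []       ys       = refl
val-addD (x ∷ xs) []       = trans (cong (λ v → digit x + 2 * v) (trans (val-addD xs []) (+-identityʳ _))) (sym (+-identityʳ _))
val-addD (x ∷ xs) (y ∷ ys) = go x y
  where
  c = addD xs ys
  IH : val c ≡ val xs + val ys
  IH = val-addD xs ys
  carry : ∀ d → digit d + 2 * val (sucD c) ≡ digit d + 2 * suc (val xs + val ys)
  carry d = cong (λ v → digit d + 2 * v) (trans (val-sucD c) (cong suc IH))
  arith₄ : ∀ a b → 2 + 2 * suc (a + b) ≡ 2 + 2 * a + (2 + 2 * b)
  arith₄ = solve-∀
  arith₃ : ∀ a b → 1 + 2 * suc (a + b) ≡ 2 + 2 * a + (1 + 2 * b)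
  arith₃ = solve-∀
  arith₃′ : ∀ a b → 1 + 2 * suc (a + b) ≡ 1 + 2 * a + (2 + 2 * b)
  arith₃′ = solve-∀
  arith₂ : ∀ a b → 2 + 2 * (a + b) ≡ 1 + 2 * a + (1 + 2 * b)
  arith₂ = solve-∀
  go : ∀ x y → val (addStep x (y ∷ ys) c) ≡ val (x ∷ xs) + val (y ∷ ys)
  go true  true  = trans (carry true) (arith₄ (val xs) (val ys))
  go true  false = trans (carry false) (arith₃ (val xs) (val ys))
  go false true  = trans (carry false) (arith₃′ (val xs) (val ys))
  go false false = trans (cong (λ v → 2 + 2 * v) IH) (arith₂ (val xs) (val ys))

addDF : ∀ {Γ} → Fun Γ (list bool) → Fun Γ (list bool) → Fun Γ (list bool)
-- Once xs is used up, the sum is the remainder of ys; this is the initial value. The 6 is made up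
-- of at most 4 for the new digit and 2 for the carry.
addDF {Γ} xs ys = foldF-additive (zipSuffixF false xs ys) (dropF (lengthF xs) ys) stepF (Poly-const 6)
    (λ { γ (x , ys) c → ∣≡∣ {list bool} (stepF≡ γ x ys c) (∣addStep∣ x ys c) })
  as (λ γ → addD (fn xs γ) (fn ys γ)) by-ext λ γ → lemma γ (fn xs γ) (fn ys γ)
  where
  stepF : Fun (Γ ⊗ (bool ⊗ list bool) ⊗ list bool) (list bool)
  stepF = caseF (sndF ∘F x,ysF) (consF xF cF)
    (ifF (xF ∘F fstF)
      (ifF (fstF ∘F sndF) (consF (constF true) (sucDF (cF ∘F fstF))) (consF (constF false) (sucDF (cF ∘F fstF))))
      (ifF (fstF ∘F sndF) (consF (constF false) (sucDF (cF ∘F fstF))) (consF (constF true) (cF ∘F fstF))))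
    where
    x,ysF : Fun (Γ ⊗ (bool ⊗ list bool) ⊗ list bool) (bool ⊗ list bool)
    x,ysF = fstF ∘F sndF
    xF : Fun (Γ ⊗ (bool ⊗ list bool) ⊗ list bool) bool
    xF = fstF ∘F x,ysF
    cF : Fun (Γ ⊗ (bool ⊗ list bool) ⊗ list bool) (list bool)
    cF = sndF ∘F sndF
  stepF≡ : ∀ γ x ys c → fn stepF (γ , (x , ys) , c) ≡ addStep x ys c
  stepF≡ γ x []       c = refl
  stepF≡ γ x (y ∷ ys) c = refl
  lemma : ∀ γ xs ys → foldr (λ p c → fn stepF (γ , p , c)) (drop (length xs) ys) (zipSuffix xs ys) ≡ addD xs ys
  lemma γ []       ys = refl
  lemma γ (x ∷ xs) ys = trans (stepF≡ γ x ys _) (cong (addStep x ys)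
    (trans (cong (λ z → foldr (λ p c → fn stepF (γ , p , c)) z (zipSuffix xs (drop 1 ys))) (sym (drop-drop 1 (length xs) ys)))
      (lemma γ xs (drop 1 ys))))
  ∣cons∣ : ∀ b (c c′ : List Bool) → ∣_∣ {list bool} c ≤ ∣_∣ {list bool} c′ + 2 → ∣_∣ {list bool} (b ∷ c) ≤ ∣_∣ {list bool} c′ + 6
  ∣cons∣ b c c′ p = ≤-trans (s≤s (+-mono-≤ (∣bool∣≤3 b) p)) (≤-reflexive (arith (∣_∣ {list bool} c′)))
    where arith : ∀ n → suc (3 + (n + 2)) ≡ n + 6
          arith = solve-∀
  ∣addStep∣ : ∀ x ys c → ∣_∣ {list bool} (addStep x ys c) ≤ ∣_∣ {list bool} c + 6
  ∣addStep∣ x     []          c = ∣cons∣ x c c (m≤m+n _ 2)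
  ∣addStep∣ true  (true ∷ _)  c = ∣cons∣ true (sucD c) c (∣sucD∣ c)
  ∣addStep∣ true  (false ∷ _) c = ∣cons∣ false (sucD c) c (∣sucD∣ c)
  ∣addStep∣ false (true ∷ _)  c = ∣cons∣ false (sucD c) c (∣sucD∣ c)
  ∣addStep∣ false (false ∷ _) c = ∣cons∣ true c c (m≤m+n _ 2)

mulD : List Bool → List Bool → List Bool
mulD []       ys = []
mulD (x ∷ xs) ys = addD (addD (mulD xs ys) (mulD xs ys)) (if x then addD ys ys else ys)

val-mulD : ∀ xs ys → val (mulD xs ys) ≡ val xs * val ys
val-mulD []       ys = refl
val-mulD (x ∷ xs) ys = trans (val-addD (addD r r) _) (trans (cong₂ _+_ (trans (val-addD r r) (cong₂ _+_ IH IH)) (times x)) (arith (val xs) (val ys) (digit x)))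
  where
  r = mulD xs ys
  IH = val-mulD xs ys
  times : ∀ x → val (if x then addD ys ys else ys) ≡ digit x * val ys
  times true  = trans (val-addD ys ys) (cong (val ys +_) (sym (+-identityʳ _)))
  times false = sym (+-identityʳ _)
  arith : ∀ a b d → a * b + a * b + d * b ≡ (d + 2 * a) * b
  arith = solve-∀

mulD-width : ∀ xs ys → val (mulD xs ys) < 2 ^ (suc (length xs) + suc (length ys))
mulD-width xs ys = subst (_< 2 ^ (suc (length xs) + suc (length ys))) (sym (val-mulD xs ys)) (val-*-width (suc (length xs)) (suc (length ys)) (val<2^ xs) (val<2^ ys))

mulDF : ∀ {Γ} → Fun Γ (list bool) → Fun Γ (list bool) → Fun Γ (list bool)
mulDF {Γ} xs ys = foldF xs (constF []) stepF (proj₁ p) (λ γ zs → ∣≡∣ {list bool} (lemma γ zs)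
      (≤-trans (∣bits∣≤width (suc (length zs) + suc (length (fn ys γ))) {mulD zs (fn ys γ)} (mulD-width zs (fn ys γ)))
        (≤-trans (+-monoˡ-≤ 1 (*-monoʳ-≤ 4 (+-mono-≤ (s≤s (≤-trans (length≤∣bits∣ zs) (m≤m+n _ (∣_∣ {Γ} γ))))
           (s≤s (≤-trans (length≤∣bits∣ (fn ys γ)) (≤-trans (grows ys γ) (bound-mono _ (m≤n+m _ (∣_∣ {list bool} zs)))))))))
          (proj₂ p _))))
  as (λ γ → mulD (fn xs γ) (fn ys γ)) by-ext λ γ → lemma γ (fn xs γ)
  where
  stepF : Fun (Γ ⊗ bool ⊗ list bool) (list bool)
  stepF = addDF (addDF (sndF ∘F sndF) (sndF ∘F sndF)) (ifF (fstF ∘F sndF) (addDF (ys ∘F fstF) (ys ∘F fstF)) (ys ∘F fstF))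
  p : Poly (λ n → 4 * (suc n + suc (bound (deg (computable ys)) n)) + 1)
  p = Poly-+ (Poly-* (Poly-const 4) (Poly-+ (Poly-+ (Poly-const 1) Poly-id) (Poly-+ (Poly-const 1) (Poly-deg ys)))) (Poly-const 1)
  lemma : ∀ γ zs → foldr (λ a b → fn stepF (γ , a , b)) [] zs ≡ mulD zs (fn ys γ)
  lemma γ []       = refl
  lemma γ (z ∷ zs) = cong (λ r → addD (addD r r) (if z then addD (fn ys γ) (fn ys γ) else fn ys γ)) (lemma γ zs)

-- Both ≤ and < of the remaining digits decide either comparison, whatever
-- the least significant digits are.
leStep : Bool → List Bool → Bool × Bool → Bool × Bool
leStep x []      (le , lt) = false , false
leStep x (y ∷ _) (le , lt) = if x then (if y then (le , lt) else (lt , lt)) else (if y then (le , le) else (le , lt))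

compareD : List Bool → List Bool → Bool × Bool
compareD []       []       = true , false
compareD []       (y ∷ ys) = true , true
compareD (x ∷ xs) ys       = leStep x ys (compareD xs (drop 1 ys))

leD : List Bool → List Bool → Bool
leD xs ys = proj₁ (compareD xs ys)

Compares : ℕ → ℕ → Bool × Bool → Set
Compares m n (le , lt) = (T le ⇔ m ≤ n) × (T lt ⇔ m < n)

double-≤ : ∀ a b m n → (m ≤ n → a + 2 * m ≤ b + 2 * n) → (n < m → b + 2 * n < a + 2 * m) → (m ≤ n) ⇔ (a + 2 * m ≤ b + 2 * n)
double-≤ a b m n up down = mk⇔ up (λ le → ≮⇒≥ λ n<m → <⇒≱ (down n<m) le)

compareD-correct : ∀ xs ys → Compares (val xs) (val ys) (compareD xs ys)
compareD-correct []       []           = mk⇔ (λ _ → z≤n) (λ _ → tt) , mk⇔ (λ ()) (λ ())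
compareD-correct []       (false ∷ ys) = mk⇔ (λ _ → z≤n) (λ _ → tt) , mk⇔ (λ _ → s≤s z≤n) (λ _ → tt)
compareD-correct []       (true ∷ ys)  = mk⇔ (λ _ → z≤n) (λ _ → tt) , mk⇔ (λ _ → s≤s z≤n) (λ _ → tt)
compareD-correct (true ∷ xs)  []       = mk⇔ (λ ()) (λ ()) , mk⇔ (λ ()) (λ ())
compareD-correct (false ∷ xs) []       = mk⇔ (λ ()) (λ ()) , mk⇔ (λ ()) (λ ())
compareD-correct (x ∷ xs) (y ∷ ys)     = go x y
  where
  X = val xs
  Y = val ys
  le = proj₁ (compareD-correct xs ys)
  lt = proj₂ (compareD-correct xs ys)
  _⨟_ : ∀ {A B C : Set} → A ⇔ B → B ⇔ C → A ⇔ C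
  f ⨟ g = mk⇔ (⇒ g ∘ ⇒ f) (⇐ f ∘ ⇐ g)
  2* : ∀ {m n} → m ≤ n → 2 * m ≤ 2 * n
  2* = *-monoʳ-≤ 2
  2*< : ∀ {m n} → m < n → 2 + 2 * m ≤ 2 * n
  2*< {m} p = ≤-trans (≤-reflexive (sym (*-suc 2 m))) (2* p)
  go : ∀ x y → Compares (val (x ∷ xs)) (val (y ∷ ys)) (leStep x (y ∷ ys) (compareD xs ys))
  go true true =
    (le ⨟ double-≤ 2 2 X Y (λ p → +-monoʳ-≤ 2 (2* p)) (λ p → s≤s (s≤s (≤-trans (n≤1+n _) (2*< p))))) ,
    (lt ⨟ mk⇔ (λ p → s≤s (s≤s (≤-trans (n≤1+n _) (2*< p)))) (λ q → *-cancelˡ-< 2 X Y (s≤s⁻¹ (s≤s⁻¹ q))))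
  go false false =
    (le ⨟ double-≤ 1 1 X Y (λ p → +-monoʳ-≤ 1 (2* p)) (λ p → s≤s (≤-trans (n≤1+n _) (2*< p)))) ,
    (lt ⨟ mk⇔ (λ p → s≤s (≤-trans (n≤1+n _) (2*< p))) (λ q → *-cancelˡ-< 2 X Y (s≤s⁻¹ q)))
  go false true =
    (le ⨟ double-≤ 1 2 X Y (λ p → ≤-trans (n≤1+n _) (+-monoʳ-≤ 2 (2* p))) (λ p → s≤s (2*< p))) ,
    (le ⨟ double-≤ 2 2 X Y (λ p → +-monoʳ-≤ 2 (2* p)) (λ p → s≤s (s≤s (≤-trans (n≤1+n _) (2*< p)))))
  go true false =
    (lt ⨟ mk⇔ (λ p → ≤-trans (2*< p) (n≤1+n _)) (λ q → *-cancelˡ-< 2 X Y (s≤s⁻¹ q))) ,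
    (lt ⨟ mk⇔ (λ p → s≤s (2*< p)) (λ q → *-cancelˡ-< 2 X Y (≤-trans (n≤1+n _) (s≤s⁻¹ q))))

leDF : ∀ {Γ} → Fun Γ (list bool) → Fun Γ (list bool) → Fun Γ bool
leDF {Γ} xs ys = fstF ∘F foldF (zipSuffixF false xs ys) (constF true ,F caseF (dropF (lengthF xs) ys) (constF false) (constF true))
      stepF _ (λ γ zs → flags≤ (foldr (λ p c → fn stepF (γ , p , c)) (base γ (drop (length (fn xs γ)) (fn ys γ))) zs) (∣_∣ {list (bool ⊗ list bool)} zs + ∣_∣ {Γ} γ))
  as (λ γ → leD (fn xs γ) (fn ys γ)) by-ext λ γ → cong proj₁ (lemma γ (fn xs γ) (fn ys γ))
  where
  stepF : Fun (Γ ⊗ (bool ⊗ list bool) ⊗ bool ⊗ bool) (bool ⊗ bool)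
  stepF = caseF (sndF ∘F fstF ∘F sndF) (constF (false , false))
    (ifF (fstF ∘F fstF ∘F sndF ∘F fstF)
      (ifF (fstF ∘F sndF) c (sndF ∘F c ,F sndF ∘F c))
      (ifF (fstF ∘F sndF) (fstF ∘F c ,F fstF ∘F c) c))
    where
    c : ∀ {A} → Fun ((Γ ⊗ (bool ⊗ list bool) ⊗ bool ⊗ bool) ⊗ A) (bool ⊗ bool)
    c = sndF ∘F sndF ∘F fstF
  base : ⟦ Γ ⟧ → List Bool → Bool × Bool
  base γ ys = true , caseList (λ _ → false) (λ _ → true) (γ , ys)
  flags≤ : ∀ c n → ∣_∣ {bool ⊗ bool} c ≤ bound (proj₁ (Poly-const 7)) n
  flags≤ (a , b) n = ≤-trans (s≤s (+-mono-≤ (∣bool∣≤3 a) (∣bool∣≤3 b))) (proj₂ (Poly-const 7) n)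
  stepF≡ : ∀ γ x ys c → fn stepF (γ , (x , ys) , c) ≡ leStep x ys c
  stepF≡ γ x     []           c = refl
  stepF≡ γ true  (true ∷ ys)  c = refl
  stepF≡ γ true  (false ∷ ys) c = refl
  stepF≡ γ false (true ∷ ys)  c = refl
  stepF≡ γ false (false ∷ ys) c = refl
  lemma : ∀ γ xs ys → foldr (λ p c → fn stepF (γ , p , c)) (base γ (drop (length xs) ys)) (zipSuffix xs ys) ≡ compareD xs ys
  lemma γ []       []       = refl
  lemma γ []       (y ∷ ys) = refl
  lemma γ (x ∷ xs) ys = trans (stepF≡ γ x ys _) (cong (leStep x ys)
    (trans (cong (λ z → foldr (λ p c → fn stepF (γ , p , c)) (base γ z) (zipSuffix xs (drop 1 ys))) (sym (drop-drop 1 (length xs) ys)))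
      (lemma γ xs (drop 1 ys))))

-- Encodings

digits-suc : ∀ x → digits (ℕᵇ.suc x) ≡ sucD (digits x)
digits-suc ℕᵇ.zero     = refl
digits-suc ℕᵇ.2[1+ x ] = cong (false ∷_) (digits-suc x)
digits-suc ℕᵇ.1+[2 x ] = refl

toDigits : ℕ → List Bool
toDigits n = digits (ℕᵇ.fromℕ n)

toDigits-suc : ∀ n → toDigits (suc n) ≡ sucD (toDigits n)
toDigits-suc n rewrite ℕᵇ.fromℕ≡fromℕ' (suc n) | ℕᵇ.fromℕ≡fromℕ' n = digits-suc (ℕᵇ.fromℕ' n)

val-digits : ∀ x → val (digits x) ≡ ℕᵇ.toℕ x
val-digits ℕᵇ.zero     = refl
val-digits ℕᵇ.2[1+ x ] = trans (cong (λ v → 2 + 2 * v) (val-digits x)) (sym (*-suc 2 (ℕᵇ.toℕ x)))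
val-digits ℕᵇ.1+[2 x ] = cong (λ v → 1 + 2 * v) (val-digits x)

val-toDigits : ∀ n → val (toDigits n) ≡ n
val-toDigits n = trans (val-digits (ℕᵇ.fromℕ n)) (ℕᵇ.toℕ-fromℕ n)

toDigits-val : ∀ ds → toDigits (val ds) ≡ ds
toDigits-val ds = trans (cong toDigits (trans (cong val (sym (digits-undigits ds))) (val-digits (undigits ds))))
    (trans (cong digits (ℕᵇ.fromℕ-toℕ (undigits ds))) (digits-undigits ds))
  where
  undigits : List Bool → ℕᵇ.ℕᵇ
  undigits []           = ℕᵇ.zero
  undigits (true ∷ ds)  = ℕᵇ.2[1+ undigits ds ]
  undigits (false ∷ ds) = ℕᵇ.1+[2 undigits ds ]
  digits-undigits : ∀ ds → digits (undigits ds) ≡ ds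
  digits-undigits []           = refl
  digits-undigits (true ∷ ds)  = cong (true ∷_) (digits-undigits ds)
  digits-undigits (false ∷ ds) = cong (false ∷_) (digits-undigits ds)

-- Counting up to n is affordable because `nat` is coded in unary.
toDigitsF : ∀ {Γ} → Fun Γ nat → Fun Γ (list bool)
toDigitsF n = iterF-additive n (constF []) (sucDF sndF) (Poly-const 2) (λ γ b → ∣sucD∣ b)
  as (λ γ → toDigits (fn n γ)) by-ext λ γ → lemma (fn n γ)
  where
  lemma : ∀ n → iter n sucD [] ≡ toDigits n
  lemma zero    = refl
  lemma (suc n) = trans (cong sucD (lemma n)) (sym (toDigits-suc n))

delimitF : ∀ {Γ} → Fun Γ (list bool) → Fun Γ (list bool)
delimitF {Γ} e = foldF-additive e (constF (false ∷ [])) (consF (constF true) (consF (fstF ∘F sndF) (sndF ∘F sndF)))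
    (Poly-const 8) (λ γ b c → ≤-trans (s≤s (s≤s (s≤s (s≤s (s≤s (+-monoˡ-≤ _ (∣bool∣≤3 b))))))) (≤-reflexive (+-comm 8 (∣_∣ {list bool} c))))
  as (λ γ → delimit (fn e γ)) by-ext λ γ → lemma (fn e γ)
  where
  lemma : ∀ w → foldr (λ b c → true ∷ b ∷ c) (false ∷ []) w ≡ delimit w
  lemma []      = refl
  lemma (b ∷ w) = cong (λ c → true ∷ b ∷ c) (lemma w)

encodeBinaryF encodeUnaryF : ∀ {Γ} → Fun Γ nat → Fun Γ (list bool)
encodeBinaryF n = delimitF (toDigitsF n)
encodeUnaryF n = iterF-additive n (constF (false ∷ [])) (consF (constF true) sndF) (Poly-const 4) (λ γ b → ≤-reflexive (+-comm 4 (∣_∣ {list bool} b)))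
  as (λ γ → encodeUnary (fn n γ)) by-ext λ γ → lemma (fn n γ)
  where
  lemma : ∀ n → iter n (true ∷_) (false ∷ []) ≡ encodeUnary n
  lemma zero    = refl
  lemma (suc n) = cong (true ∷_) (lemma n)

-- Reading trees back from bit strings

spine : Tree → List Tree
spine leaf       = []
spine (node x y) = x ∷ spine y

enc-spine : ∀ t → enc (list tree) (spine t) ≡ t
enc-spine leaf       = refl
enc-spine (node x y) = cong (node x) (enc-spine y)

spineF : Fun tree (list tree)
spineF = coerceF spine enc-spine

unspineF : Fun (list tree) tree
unspineF = coerceF (encList id) (λ _ → refl)

decodeF : ∀ A → Fun tree A
decodeF 𝟙        = constF tt
decodeF bool     = caseF spineF (constF false) (constF true)
decodeF nat      = lengthF spineF
decodeF tree     = idF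
decodeF (A ⊗ B)  = caseF spineF (decodeF A ,F decodeF B)
                     (decodeF A ∘F fstF ∘F sndF ,F decodeF B ∘F unspineF ∘F sndF ∘F sndF)
decodeF (list A) = mapF (decodeF A ∘F sndF) spineF

decode-enc : ∀ A x → fn (decodeF A) (enc A x) ≡ x
decode-enc 𝟙        _       = refl
decode-enc bool     true    = refl
decode-enc bool     false   = refl
decode-enc nat      zero    = refl
decode-enc nat      (suc n) = cong suc (decode-enc nat n)
decode-enc tree     t       = refl
decode-enc (A ⊗ B)  (x , y) = cong₂ _,_ (decode-enc A x) (trans (cong (fn (decodeF B)) (enc-spine (enc B y))) (decode-enc B y))
decode-enc (list A) []       = refl
decode-enc (list A) (x ∷ xs) = cong₂ _∷_ (decode-enc A x) (decode-enc (list A) xs)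

serialize : Tree → List Bool → List Bool
serialize leaf       w = false ∷ w
serialize (node x y) w = true ∷ serialize x (serialize y w)

length-serialize : ∀ t w → length (serialize t w) ≡ size t + length w
length-serialize leaf       w = refl
length-serialize (node x y) w = cong suc (trans (length-serialize x _)
  (trans (cong (size x +_) (length-serialize y w)) (sym (+-assoc (size x) (size y) (length w)))))

parseStep : Bool → List Tree → List Tree
parseStep false ts           = leaf ∷ ts
parseStep true  []           = []
parseStep true  (x ∷ [])     = []
parseStep true  (x ∷ y ∷ ts) = node x y ∷ ts

-- Polish notation read from the right: the accumulator is the stack of trees parsed so far, so a
-- right fold is enough. A missing operand empties the stack.
parse : List Bool → List Tree
parse = foldr parseStep []

parse-serialize : ∀ t w → parse (serialize t w) ≡ t ∷ parse w
parse-serialize leaf       w = refl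
parse-serialize (node x y) w = cong (parseStep true)
  (trans (parse-serialize x (serialize y w)) (cong (x ∷_) (parse-serialize y w)))

parseF : Fun (list bool) (list tree)
parseF = foldF-additive idF (constF []) stepF (Poly-const 2)
    (λ γ b ts → ∣≡∣ {list tree} (stepF≡ γ b ts) (∣parseStep∣ b ts))
  as parse by-ext lemma
  where
  stepF : Fun (list bool ⊗ bool ⊗ list tree) (list tree)
  stepF = ifF (fstF ∘F sndF)
    (caseF (sndF ∘F sndF) (constF []) (caseF (sndF ∘F sndF) (constF [])
      (consF (coerceF {tree ⊗ tree} (λ p → node (proj₁ p) (proj₂ p)) (λ _ → refl) ∘F (fstF ∘F sndF ∘F fstF ,F fstF ∘F sndF)) (sndF ∘F sndF))))
    (consF (constF leaf) (sndF ∘F sndF))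
  stepF≡ : ∀ γ b ts → fn stepF (γ , b , ts) ≡ parseStep b ts
  stepF≡ γ false ts           = refl
  stepF≡ γ true  []           = refl
  stepF≡ γ true  (x ∷ [])     = refl
  stepF≡ γ true  (x ∷ y ∷ ts) = refl
  ∣parseStep∣ : ∀ b ts → ∣_∣ {list tree} (parseStep b ts) ≤ ∣_∣ {list tree} ts + 2
  ∣parseStep∣ false ts       = ≤-reflexive (+-comm 2 _)
  ∣parseStep∣ true  []       = s≤s z≤n
  ∣parseStep∣ true  (x ∷ []) = s≤s z≤n
  ∣parseStep∣ true  (x ∷ y ∷ ts) = ≤-trans (≤-reflexive (arith (size x) (size y) (∣_∣ {list tree} ts))) (m≤m+n _ 2)
    where arith : ∀ a b n → 1 + (1 + (a + b) + n) ≡ 1 + (a + (1 + (b + n)))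
          arith = solve-∀
  lemma : ∀ w → foldr (λ b ts → fn stepF (w , b , ts)) [] w ≡ parse w
  lemma w = go w
    where
    go : ∀ v → foldr (λ b ts → fn stepF (w , b , ts)) [] v ≡ parse v
    go []      = refl
    go (b ∷ v) = trans (stepF≡ w b _) (cong (parseStep b) (go v))

-- A fixed point is reached at the end mark, so any sufficiently large number of steps will do.

skipStep : List Bool → List Bool
skipStep (true ∷ b ∷ w) = w
skipStep w              = w

skipDelimited : List Bool → List Bool
skipDelimited w = drop 1 (iter (length w) skipStep w)

skipDelimited-pair : ∀ w c → skipDelimited (pair w c) ≡ c
skipDelimited-pair w c = cong (drop 1) (go w (length (pair w c)) enough)
  where
  stable : ∀ n → iter n skipStep (false ∷ c) ≡ false ∷ c
  stable zero    = refl
  stable (suc n) = cong skipStep (stable n)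
  go : ∀ w n → length w ≤ n → iter n skipStep (pair w c) ≡ false ∷ c
  go []      n       _        = stable n
  go (b ∷ w) (suc n) (s≤s le) = trans (iter-shift skipStep n (pair (b ∷ w) c)) (go w n le)
  enough : length w ≤ length (pair w c)
  enough = ≤-trans (length≤ w) (≤-trans (m≤m+n _ _) (≤-reflexive (sym (length-++ (delimit w)))))
    where
    length≤ : ∀ w → length w ≤ length (delimit w)
    length≤ []      = z≤n
    length≤ (b ∷ w) = s≤s (m≤n⇒m≤1+n (length≤ w))

skipDelimitedF : Fun (list bool) (list bool)
skipDelimitedF = dropF (constF 1) (iterF-additive (lengthF idF) idF stepF (Poly-const 0)
    (λ γ w → ≤-trans (∣≡∣ {list bool} (stepF≡ γ w) (∣skipStep∣ w)) (≤-reflexive (sym (+-identityʳ _)))))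
  as skipDelimited by-ext λ w → cong (drop 1) (lemma w (length w))
  where
  stepF : Fun (list bool ⊗ list bool) (list bool)
  stepF = caseF sndF sndF (ifF (fstF ∘F sndF)
    (caseF (sndF ∘F sndF) (sndF ∘F fstF) (sndF ∘F sndF)) (sndF ∘F fstF))
  stepF≡ : ∀ γ w → fn stepF (γ , w) ≡ skipStep w
  stepF≡ γ []               = refl
  stepF≡ γ (false ∷ w)      = refl
  stepF≡ γ (true ∷ [])      = refl
  stepF≡ γ (true ∷ b ∷ w)   = refl
  ∣skipStep∣ : ∀ w → ∣_∣ {list bool} (skipStep w) ≤ ∣_∣ {list bool} w
  ∣skipStep∣ []             = ≤-refl
  ∣skipStep∣ (false ∷ w)    = ≤-refl
  ∣skipStep∣ (true ∷ [])    = ≤-refl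
  ∣skipStep∣ (true ∷ b ∷ w) = m≤n⇒m≤1+n (m≤n⇒m≤1+n (m≤n⇒m≤1+n (m≤n⇒m≤1+n (m≤n⇒m≤1+n (m≤n+m _ (∣_∣ {bool} b))))))
  lemma : ∀ w n → iter n (λ v → fn stepF (w , v)) w ≡ iter n skipStep w
  lemma w zero    = refl
  lemma w (suc n) = trans (stepF≡ w (iter n (λ v → fn stepF (w , v)) w)) (cong skipStep (lemma w n))

-- The form with remainders `r` and `s` lets these lemmas be applied field after field to a
-- concatenation of codes.
delimit-prefix : ∀ v w {r s} → delimit v ++ r ≡ delimit w ++ s → v ≡ w × r ≡ s
delimit-prefix []      []      eq = refl , ∷-injectiveʳ eq
delimit-prefix (a ∷ v) (b ∷ w) eq with ∷-injective (∷-injectiveʳ eq)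
... | refl , eq′ with delimit-prefix v w eq′
... | refl , eq″ = refl , eq″

encodeUnary-prefix : ∀ m n {r s} → encodeUnary m ++ r ≡ encodeUnary n ++ s → m ≡ n × r ≡ s
encodeUnary-prefix zero    zero    eq = refl , ∷-injectiveʳ eq
encodeUnary-prefix (suc m) (suc n) eq with encodeUnary-prefix m n (∷-injectiveʳ eq)
... | refl , eq′ = refl , eq′

encodeBinary-prefix : ∀ m n {r s} → encodeBinary m ++ r ≡ encodeBinary n ++ s → m ≡ n × r ≡ s
encodeBinary-prefix m n eq with delimit-prefix (toDigits m) (toDigits n) eq
... | eq′ , rest = trans (sym (val-toDigits m)) (trans (cong val eq′) (val-toDigits n)) , rest

-- Exact arithmetic over a common denominator

bits : Ty
bits = list bool

suc-length≤∣bits∣ : ∀ ds → suc (length ds) ≤ ∣_∣ {bits} ds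
suc-length≤∣bits∣ []       = ≤-refl
suc-length≤∣bits∣ (b ∷ ds) = s≤s (≤-trans (suc-length≤∣bits∣ ds) (m≤n+m _ (∣_∣ {bool} b)))

width-mono : ∀ {a m n} → m ≤ n → a < 2 ^ m → a < 2 ^ n
width-mono m≤n lt = ≤-trans lt (^-monoʳ-≤ 2 m≤n)

Widths : ℕ → List (List Bool) → Set
Widths m = All (λ x → val x < 2 ^ m)

Widths-mono : ∀ {m n xs} → m ≤ n → Widths m xs → Widths n xs
Widths-mono m≤n = All.map (width-mono m≤n)

∣bits∣-width : ∀ ds → val ds < 2 ^ ∣_∣ {bits} ds
∣bits∣-width ds = width-mono (suc-length≤∣bits∣ ds) (val<2^ ds)

∣list∣-widths : ∀ xs {N} → ∣_∣ {list bits} xs ≤ N → Widths N xs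
∣list∣-widths []       le = []
∣list∣-widths (x ∷ xs) le =
  width-mono (≤-trans (m≤n⇒m≤1+n (m≤m+n (∣_∣ {bits} x) (∣_∣ {list bits} xs))) le) (∣bits∣-width x) ∷
  ∣list∣-widths xs (≤-trans (m≤n⇒m≤1+n (m≤n+m _ (∣_∣ {bits} x))) le)

∣widths∣ : ∀ m {xs} → Widths m xs → ∣_∣ {list bits} xs ≤ suc (length xs * suc (4 * m + 1))
∣widths∣ m ws = ∣list∣≤ {bits} (4 * m + 1) (All.map (λ {x} → ∣bits∣≤width m {x}) ws)

sumD : List (List Bool) → List Bool
sumD = foldr addD []

val-sumD : ∀ xs → val (sumD xs) ≡ sum (map val xs)
val-sumD []       = refl
val-sumD (x ∷ xs) = trans (val-addD x (sumD xs)) (cong (val x +_) (val-sumD xs))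

-- One more bit per summand is generous, but follows by doubling alone and is polynomial.
sumD-width : ∀ m {xs} → Widths m xs → val (sumD xs) < 2 ^ (m + length xs)
sumD-width m []                = m^n>0 2 (m + 0)
sumD-width m {x ∷ xs} (p ∷ ps) = begin-strict
  val (addD x (sumD xs))                  ≡⟨ val-addD x (sumD xs) ⟩
  val x + val (sumD xs)                   <⟨ +-mono-< (width-mono (m≤m+n m (length xs)) p) (sumD-width m ps) ⟩
  2 ^ (m + length xs) + 2 ^ (m + length xs) ≡⟨ cong (2 ^ (m + length xs) +_) (+-identityʳ _) ⟨
  2 ^ suc (m + length xs)                 ≡⟨ cong (2 ^_) (+-suc m (length xs)) ⟨
  2 ^ (m + length (x ∷ xs))               ∎
  where open ≤-Reasoning

sumDF : ∀ {Γ} → Fun Γ (list bits) → Fun Γ bits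
sumDF {Γ} e = foldF e (constF []) (addDF (fstF ∘F sndF) (sndF ∘F sndF)) (proj₁ p) λ γ xs →
    ≤-trans (∣bits∣≤width (n xs + length xs) {sumD xs} (sumD-width (n xs) (∣list∣-widths xs ≤-refl)))
      (≤-trans (+-monoˡ-≤ 1 (*-monoʳ-≤ 4 (+-monoʳ-≤ (n xs) (length≤∣list∣ {bits} xs))))
        (≤-trans (proj₂ p (n xs)) (bound-mono (proj₁ p) (m≤m+n _ _))))
  where
  n : List (List Bool) → ℕ
  n xs = ∣_∣ {list bits} xs
  p : Poly (λ n → 4 * (n + n) + 1)
  p = Poly-+ (Poly-* (Poly-const 4) (Poly-+ Poly-id Poly-id)) (Poly-const 1)

Fraction : Set
Fraction = List Bool × List Bool

fraction : Ty
fraction = bits ⊗ bits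

one : List Bool
one = false ∷ []

-- The fractions of a row over a common denominator: if a/b is a member of
-- the row and c the corresponding member of the result (Q , cs), then c b = a Q.
scaleStep : Fraction → List Bool × List (List Bool) → List Bool × List (List Bool)
scaleStep (a , b) (Q , cs) = mulD b Q , mulD a Q ∷ map (mulD b) cs

scaleRow : List Fraction → List Bool × List (List Bool)
scaleRow = foldr scaleStep (one , [])

widthRow : List Fraction → ℕ
widthRow []             = 1
widthRow ((a , b) ∷ es) = (suc (length a) + suc (length b)) + widthRow es

mulD-width′ : ∀ {x y} m n k → val x < 2 ^ m → val y < 2 ^ n → m + n ≤ k → val (mulD x y) < 2 ^ k
mulD-width′ {x} {y} m n k p q le = width-mono le (subst (_< 2 ^ (m + n)) (sym (val-mulD x y)) (val-*-width m n p q))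

map-mulD-widths : ∀ {x} m n k → val x < 2 ^ m → m + n ≤ k → ∀ {ys} → Widths n ys → Widths k (map (mulD x) ys)
map-mulD-widths {x} m n k p le []                 = []
map-mulD-widths {x} m n k p le {y ∷ ys} (q ∷ qs)  = mulD-width′ {x} {y} m n k p q le ∷ map-mulD-widths {x} m n k p le qs

scaleRow-width : ∀ es → val (proj₁ (scaleRow es)) < 2 ^ widthRow es × Widths (widthRow es) (proj₂ (scaleRow es))
scaleRow-width []             = s≤s (s≤s z≤n) , []
scaleRow-width ((a , b) ∷ es) with scaleRow es | scaleRow-width es
... | Q , cs | p , ps =
  mulD-width′ {b} {Q} (suc (length b)) (widthRow es) _ (val<2^ b) p (+-monoˡ-≤ (widthRow es) (m≤n+m _ (suc (length a)))) ,
  mulD-width′ {a} {Q} (suc (length a)) (widthRow es) _ (val<2^ a) p (+-monoˡ-≤ (widthRow es) (m≤m+n (suc (length a)) _)) ∷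
  map-mulD-widths {b} (suc (length b)) (widthRow es) _ (val<2^ b) (+-monoˡ-≤ (widthRow es) (m≤n+m _ (suc (length a)))) ps

scaleRow-length : ∀ es → length (proj₂ (scaleRow es)) ≡ length es
scaleRow-length []       = refl
scaleRow-length (e ∷ es) = cong suc (trans (length-map (mulD (proj₂ e)) (proj₂ (scaleRow es))) (scaleRow-length es))

widthRow≤ : ∀ es → widthRow es ≤ ∣_∣ {list fraction} es
widthRow≤ []             = ≤-refl
widthRow≤ ((a , b) ∷ es) = m≤n⇒m≤1+n (+-mono-≤ (m≤n⇒m≤1+n (+-mono-≤ (suc-length≤∣bits∣ a) (suc-length≤∣bits∣ b))) (widthRow≤ es))

scaleRowF : ∀ {Γ} → Fun Γ (list fraction) → Fun Γ (bits ⊗ list bits)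
scaleRowF {Γ} e = foldF e (constF (one , [])) stepF (proj₁ p) λ γ es →
    ≤-trans (s≤s (+-mono-≤ (∣bits∣≤width (widthRow es) {proj₁ (scaleRow es)} (proj₁ (scaleRow-width es)))
        (≤-trans (∣widths∣ (widthRow es) (proj₂ (scaleRow-width es))) (≤-reflexive (cong (λ k → suc (k * suc (4 * widthRow es + 1))) (scaleRow-length es))))))
      (≤-trans (s≤s (+-mono-≤ (+-monoˡ-≤ 1 (*-monoʳ-≤ 4 (widthRow≤ es)))
          (s≤s (*-mono-≤ (length≤∣list∣ {fraction} es) (s≤s (+-monoˡ-≤ 1 (*-monoʳ-≤ 4 (widthRow≤ es))))))))
        (≤-trans (proj₂ p (∣_∣ {list fraction} es)) (bound-mono (proj₁ p) (m≤m+n _ _))))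
  where
  stepF : Fun (Γ ⊗ fraction ⊗ bits ⊗ list bits) (bits ⊗ list bits)
  stepF = mulDF bF QF ,F consF (mulDF aF QF) (mapF (mulDF (bF ∘F fstF) sndF) (sndF ∘F sndF ∘F sndF))
    where
    aF bF QF : Fun (Γ ⊗ fraction ⊗ bits ⊗ list bits) bits
    aF = fstF ∘F fstF ∘F sndF
    bF = sndF ∘F fstF ∘F sndF
    QF = fstF ∘F sndF ∘F sndF
  p : Poly (λ n → 1 + ((4 * n + 1) + (1 + n * (1 + (4 * n + 1)))))
  p = Poly-+ (Poly-const 1) (Poly-+ q (Poly-+ (Poly-const 1) (Poly-* Poly-id (Poly-+ (Poly-const 1) q))))
    where
    q : Poly (λ n → 4 * n + 1)
    q = Poly-+ (Poly-* (Poly-const 4) Poly-id) (Poly-const 1)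

matrix : Ty
matrix = list (list bits)

Matrix : Set
Matrix = List (List (List Bool))

-- Each side is multiplied by the denominator of the other: the new row by that of the rows already
-- scaled, and these by that of the new row.
scaleRowsStep : List Fraction → List Bool × Matrix → List Bool × Matrix
scaleRowsStep es (Q , css) = mulD (proj₁ (scaleRow es)) Q ,
  map (mulD Q) (proj₂ (scaleRow es)) ∷ map (map (mulD (proj₁ (scaleRow es)))) css

scaleRows : List (List Fraction) → List Bool × Matrix
scaleRows = foldr scaleRowsStep (one , [])

widthRows : List (List Fraction) → ℕ
widthRows []         = 1
widthRows (es ∷ ess) = widthRow es + widthRows ess

scaleRows-width : ∀ ess → val (proj₁ (scaleRows ess)) < 2 ^ widthRows ess × All (Widths (widthRows ess)) (proj₂ (scaleRows ess))
scaleRows-width []         = s≤s (s≤s z≤n) , []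
scaleRows-width (es ∷ ess) with scaleRow es | scaleRow-width es | scaleRows ess | scaleRows-width ess
... | q , cs | p , ps | Q , css | r , rs =
  mulD-width′ {q} {Q} (widthRow es) (widthRows ess) _ p r ≤-refl ,
  map-mulD-widths {Q} (widthRows ess) (widthRow es) _ r (≤-reflexive (+-comm (widthRows ess) _)) ps ∷
  go rs
  where
  go : ∀ {css} → All (Widths (widthRows ess)) css → All (Widths (widthRow es + widthRows ess)) (map (map (mulD q)) css)
  go []       = []
  go (x ∷ xs) = map-mulD-widths {q} (widthRow es) (widthRows ess) _ p ≤-refl x ∷ go xs

scaleRows-length : ∀ ess → length (proj₂ (scaleRows ess)) ≡ length ess
scaleRows-length []         = refl
scaleRows-length (es ∷ ess) = cong suc (trans (length-map (map (mulD (proj₁ (scaleRow es)))) (proj₂ (scaleRows ess))) (scaleRows-length ess))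

scaleRows-lengths : ∀ ess → All (λ cs → length cs ≤ ∣_∣ {list (list fraction)} ess) (proj₂ (scaleRows ess))
scaleRows-lengths []         = []
scaleRows-lengths (es ∷ ess) =
  ≤-trans (≤-reflexive (trans (length-map _ (proj₂ (scaleRow es))) (scaleRow-length es)))
    (≤-trans (length≤∣list∣ {fraction} es) (m≤n⇒m≤1+n (m≤m+n _ _))) ∷
  go (scaleRows-lengths ess)
  where
  go : ∀ {css} → All (λ cs → length cs ≤ ∣_∣ {list (list fraction)} ess) css →
    All (λ cs → length cs ≤ ∣_∣ {list (list fraction)} (es ∷ ess)) (map (map (mulD (proj₁ (scaleRow es)))) css)
  go []                = []
  go {cs ∷ _} (x ∷ xs) = ≤-trans (≤-reflexive (length-map _ cs)) (≤-trans x (m≤n⇒m≤1+n (m≤n+m _ (∣_∣ {list fraction} es)))) ∷ go xs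

widthRows≤ : ∀ ess → widthRows ess ≤ ∣_∣ {list (list fraction)} ess
widthRows≤ []         = ≤-refl
widthRows≤ (es ∷ ess) = m≤n⇒m≤1+n (+-mono-≤ (widthRow≤ es) (widthRows≤ ess))

scaleRowsF : ∀ {Γ} → Fun Γ (list (list fraction)) → Fun Γ (bits ⊗ matrix)
scaleRowsF {Γ} e = foldF e (constF (one , [])) stepF (proj₁ p) λ γ ess →
    ≤-trans (size≤ ess) (≤-trans (proj₂ p (∣_∣ {list (list fraction)} ess)) (bound-mono (proj₁ p) (m≤m+n _ _)))
  where
  stepF : Fun (Γ ⊗ list fraction ⊗ bits ⊗ matrix) (bits ⊗ matrix)
  stepF = mulDF qF QF ,F consF (mapF (mulDF (QF ∘F fstF) sndF) (sndF ∘F rowF))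
    (mapF (mapF (mulDF (qF ∘F fstF ∘F fstF) sndF) sndF) (sndF ∘F sndF ∘F sndF))
    where
    rowF : Fun (Γ ⊗ list fraction ⊗ bits ⊗ matrix) (bits ⊗ list bits)
    rowF = scaleRowF (fstF ∘F sndF)
    qF QF : Fun (Γ ⊗ list fraction ⊗ bits ⊗ matrix) bits
    qF = fstF ∘F rowF
    QF = fstF ∘F sndF ∘F sndF
  p : Poly (λ n → 1 + ((4 * n + 1) + (1 + n * (1 + (1 + n * (1 + (4 * n + 1)))))))
  p = Poly-+ (Poly-const 1) (Poly-+ q (Poly-+ (Poly-const 1) (Poly-* Poly-id (Poly-+ (Poly-const 1) (Poly-+ (Poly-const 1) (Poly-* Poly-id (Poly-+ (Poly-const 1) q)))))))
    where
    q : Poly (λ n → 4 * n + 1)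
    q = Poly-+ (Poly-* (Poly-const 4) Poly-id) (Poly-const 1)
  size≤ : ∀ ess → let n = ∣_∣ {list (list fraction)} ess in
    ∣_∣ {bits ⊗ matrix} (scaleRows ess) ≤ 1 + ((4 * n + 1) + (1 + n * (1 + (1 + n * (1 + (4 * n + 1))))))
  size≤ ess = s≤s (+-mono-≤ (∣bits∣≤width n {proj₁ (scaleRows ess)} (width-mono (widthRows≤ ess) (proj₁ (scaleRows-width ess))))
      (≤-trans (∣list∣≤ {list bits} (1 + n * (1 + (4 * n + 1))) (rows (proj₂ (scaleRows-width ess)) (scaleRows-lengths ess)))
        (s≤s (*-monoˡ-≤ (suc (1 + n * (1 + (4 * n + 1)))) (≤-trans (≤-reflexive (scaleRows-length ess)) (length≤∣list∣ {list fraction} ess))))))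
    where
    n = ∣_∣ {list (list fraction)} ess
    rows : ∀ {css} → All (Widths (widthRows ess)) css → All (λ cs → length cs ≤ n) css →
      All (λ cs → ∣_∣ {list bits} cs ≤ 1 + n * (1 + (4 * n + 1))) css
    rows []       []       = []
    rows (w ∷ ws) (l ∷ ls) = ≤-trans (∣widths∣ n (Widths-mono (widthRows≤ ess) w)) (s≤s (*-monoˡ-≤ (1 + (4 * n + 1)) l)) ∷ rows ws ls

-- One round of the load recurrence on numerators over the common
-- denominator D; instead of dividing the loads by D, the threshold is multiplied by D.

entryAt : Matrix → ℕ → ℕ → List Bool
entryAt css u v = at [] (at [] css u) v

nextLoads : Matrix → ℕ → List (List Bool) → List (List Bool)
nextLoads css n N = map (λ v → sumD (map (λ u → mulD (entryAt css u v) (at [] N u)) (upTo n))) (upTo n)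

nextRound : List Bool → Matrix → ℕ → List Bool × List (List Bool) → List Bool × List (List Bool)
nextRound D css n (g , N) = mulD g D , nextLoads css n N

roundTy : Ty
roundTy = bits ⊗ matrix ⊗ nat ⊗ bits ⊗ list bits

at-width : ∀ m {xs} → Widths m xs → ∀ i → val (at [] xs i) < 2 ^ m
at-width m []       i       = m^n>0 2 m
at-width m (p ∷ ps) zero    = p
at-width m (p ∷ ps) (suc i) = at-width m ps i

map-widths : ∀ m {f : ℕ → List Bool} → (∀ i → val (f i) < 2 ^ m) → ∀ is → Widths m (map f is)
map-widths m h []       = []
map-widths m h (i ∷ is) = h i ∷ map-widths m h is

matrix-width : ∀ css {N} → ∣_∣ {matrix} css ≤ N → ∀ u v → val (entryAt css u v) < 2 ^ N
matrix-width []         {N} le u       v = m^n>0 2 N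
matrix-width (cs ∷ css) {N} le zero    v = at-width N (∣list∣-widths cs (≤-trans (m≤n⇒m≤1+n (m≤m+n _ _)) le)) v
matrix-width (cs ∷ css) {N} le (suc u) v = matrix-width css (≤-trans (m≤n⇒m≤1+n (m≤n+m _ (∣_∣ {list bits} cs))) le) u v

roundsF : ∀ {Γ} → Fun Γ nat → Fun Γ roundTy → Fun Γ (bits ⊗ list bits)
roundsF τ e = core ∘F (τ ,F e)
  as (λ γ → let (D , css , n , s) = fn e γ in iter (fn τ γ) (nextRound D css n) s) by-ext λ γ → refl
  where
  stepF : Fun ((nat ⊗ roundTy) ⊗ bits ⊗ list bits) (bits ⊗ list bits)
  stepF = mulDF (fstF ∘F sndF) (fstF ∘F sndF ∘F fstF) ,F
    mapF (sumDF (mapF (mulDF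
        (atF [] (atF [] (fstF ∘F sndF ∘F sndF ∘F fstF ∘F fstF ∘F fstF) sndF) (sndF ∘F fstF))
        (atF [] (sndF ∘F sndF ∘F fstF ∘F fstF) sndF))
      (upToF (nF ∘F fstF)))) (upToF nF)
    where
    nF : Fun ((nat ⊗ roundTy) ⊗ bits ⊗ list bits) nat
    nF = fstF ∘F sndF ∘F sndF ∘F sndF ∘F fstF
  p : Poly (λ k → 1 + ((4 * (k + k * (2 * k)) + 1) + (1 + k * (1 + (4 * (k + k * (2 * k)) + 1)))))
  p = Poly-+ (Poly-const 1) (Poly-+ q (Poly-+ (Poly-const 1) (Poly-* Poly-id (Poly-+ (Poly-const 1) q))))
    where
    q : Poly (λ k → 4 * (k + k * (2 * k)) + 1)
    q = Poly-+ (Poly-* (Poly-const 4) (Poly-+ Poly-id (Poly-* Poly-id (Poly-* (Poly-const 2) Poly-id)))) (Poly-const 1)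
  module _ (D : List Bool) (css : Matrix) (n : ℕ) (g₀ : List Bool) (N₀ : List (List Bool)) where
    M = ∣_∣ {roundTy} (D , css , n , g₀ , N₀)
    D≤ : ∣_∣ {bits} D ≤ M
    D≤ = m≤n⇒m≤1+n (m≤m+n _ _)
    css≤ : ∣_∣ {matrix} css ≤ M
    css≤ = m≤n⇒m≤1+n (≤-trans (m≤n⇒m≤1+n (m≤m+n _ _)) (m≤n+m _ (∣_∣ {bits} D)))
    rest≤ : ∣_∣ {nat ⊗ bits ⊗ list bits} (n , g₀ , N₀) ≤ M
    rest≤ = m≤n⇒m≤1+n (≤-trans (m≤n⇒m≤1+n (m≤n+m _ (∣_∣ {matrix} css))) (m≤n+m _ (∣_∣ {bits} D)))
    n≤ : n ≤ M
    n≤ = ≤-trans (n≤∣nat∣ n) (≤-trans (m≤n⇒m≤1+n (m≤m+n _ _)) rest≤)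
    state≤ : ∣_∣ {bits ⊗ list bits} (g₀ , N₀) ≤ M
    state≤ = ≤-trans (m≤n⇒m≤1+n (m≤n+m _ (∣_∣ {nat} n))) rest≤
    g₀≤ : ∣_∣ {bits} g₀ ≤ M
    g₀≤ = ≤-trans (m≤n⇒m≤1+n (m≤m+n _ _)) state≤
    N₀≤ : ∣_∣ {list bits} N₀ ≤ M
    N₀≤ = ≤-trans (m≤n⇒m≤1+n (m≤n+m _ (∣_∣ {bits} g₀))) state≤
    s : ℕ → List Bool × List (List Bool)
    s t = iter t (nextRound D css n) (g₀ , N₀)
    -- A round adds at most M bits by multiplying with D or with a matrix entry, and at most one bit
    -- for each of the n summands, n being at most M. Growth is thus linear in the number of rounds,
    -- which is given in unary.
    w : ℕ → ℕ
    w t = M + t * (2 * M)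
    w-suc : ∀ t → w t + 2 * M ≡ w (suc t)
    w-suc t = arith M (t * (2 * M))
      where arith : ∀ m k → m + k + 2 * m ≡ m + (2 * m + k)
            arith = solve-∀
    widths : ∀ t → val (proj₁ (s t)) < 2 ^ w t × Widths (w t) (proj₂ (s t))
    widths zero    = width-mono (≤-trans g₀≤ (m≤m+n M 0)) (∣bits∣-width g₀) , ∣list∣-widths N₀ (≤-trans N₀≤ (m≤m+n M 0))
    widths (suc t) with s t | widths t
    ... | g , N | p , ps =
      mulD-width′ {g} {D} (w t) M (w (suc t)) p (width-mono D≤ (∣bits∣-width D)) (≤-trans (+-monoʳ-≤ (w t) (m≤m+n M _)) (≤-reflexive (w-suc t))) ,
      map-widths (w (suc t)) (λ v → width-mono {n = w (suc t)} (le v)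
        (sumD-width (M + w t) (map-widths (M + w t) (λ u →
          mulD-width′ {entryAt css u v} {at [] N u} M (w t) _ (matrix-width css css≤ u v) (at-width (w t) ps u) ≤-refl) (upTo n)))) (upTo n)
      where
      le : ∀ v → M + w t + length (map (λ u → mulD (entryAt css u v) (at [] N u)) (upTo n)) ≤ w (suc t)
      le v = ≤-trans (+-monoʳ-≤ (M + w t) (≤-trans (≤-reflexive (trans (length-map _ (upTo n)) (length-upTo n))) n≤))
             (≤-trans (≤-reflexive (arith M (w t))) (≤-reflexive (w-suc t)))
        where arith : ∀ m k → m + k + m ≡ k + 2 * m
              arith = solve-∀
    lengths : ∀ t → length (proj₂ (s t)) ≤ M
    lengths zero    = ≤-trans (length≤∣list∣ {bits} N₀) N₀≤
    lengths (suc t) = ≤-trans (≤-reflexive (trans (length-map _ (upTo n)) (length-upTo n))) n≤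
    size≤ : ∀ t k → t ≤ k → M ≤ k →
      ∣_∣ {bits ⊗ list bits} (s t) ≤ 1 + ((4 * (k + k * (2 * k)) + 1) + (1 + k * (1 + (4 * (k + k * (2 * k)) + 1))))
    size≤ t k t≤k M≤k = s≤s (+-mono-≤
      (∣bits∣≤width W {proj₁ (s t)} (width-mono w≤ (proj₁ (widths t))))
      (≤-trans (∣widths∣ W (Widths-mono w≤ (proj₂ (widths t)))) (s≤s (*-monoˡ-≤ (suc (4 * W + 1)) (≤-trans (lengths t) M≤k)))))
      where
      W = k + k * (2 * k)
      w≤ : w t ≤ W
      w≤ = +-mono-≤ M≤k (*-mono-≤ t≤k (*-monoʳ-≤ 2 M≤k))
  core : Fun (nat ⊗ roundTy) (bits ⊗ list bits)
  core = iterF fstF (sndF ∘F sndF ∘F sndF ∘F sndF) stepF (proj₁ p) λ { γ@(m , (D , css , n , g , N)) t →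
    ≤-trans (size≤ D css n g N t (t + ∣_∣ {nat ⊗ roundTy} γ) (m≤m+n t _)
      (≤-trans (m≤n⇒m≤1+n (m≤n+m _ (∣_∣ {nat} m))) (m≤n+m (∣_∣ {nat ⊗ roundTy} γ) t))) (proj₂ p _) }

-- The verifier

-- There is no field for k, which is the number of seeds. L and γ may be exponential in the length
-- of the input and stay in digits; τ is unary in the input too, and Λ is at most n.
entryTy certTy : Ty
entryTy = bool ⊗ bits ⊗ bits
certTy  = list (list entryTy) ⊗ bits ⊗ bits ⊗ nat ⊗ nat ⊗ list bool

Entry : Set
Entry = Bool × List Bool × List Bool

Cert : Set
Cert = List (List Entry) × List Bool × List Bool × ℕ × ℕ × List Bool

encodeEntry : Entry → List Bool
encodeEntry (e , a , b) = if e then true ∷ (delimit a ++ delimit b) else false ∷ []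

encodeEntryF : Fun entryTy bits
encodeEntryF = ifF fstF (consF (constF true) (delimitF (fstF ∘F sndF) ++F delimitF (sndF ∘F sndF))) (constF (false ∷ []))

encodeRows : List (List Entry) → List Bool
encodeRows rows = concat (map (λ row → concat (map encodeEntry row)) rows)

seeds : List Bool → ℕ
seeds S = length (filterᵇ id S)

encodeCert : Cert → List Bool
encodeCert (rows , L , γ , τ , Λ , S) = encodeUnary (length rows) ++ encodeRows rows ++ encodeBinary (seeds S)
  ++ delimit L ++ delimit γ ++ encodeUnary τ ++ encodeBinary Λ

-- A non-edge becomes 0 / 1, so that sums over neighbours can be taken over all vertices without
-- changing the common denominator.
toFraction : Entry → Fraction
toFraction (e , a , b) = if e then (a , b) else ([] , one)

toFractionF : Fun entryTy fraction
toFractionF = ifF fstF sndF (constF ([] , one))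

nonempty : List Bool → Bool
nonempty []      = false
nonempty (_ ∷ _) = true

nonemptyF : ∀ {Γ} → Fun Γ bits → Fun Γ bool
nonemptyF e = caseF e (constF false) (constF true) as (λ γ → nonempty (fn e γ)) by-ext λ γ → lemma γ (fn e γ)
  where
  lemma : ∀ {X : Set} (γ : X) w → caseList (λ _ → false) (λ _ → true) (γ , w) ≡ nonempty w
  lemma γ []      = refl
  lemma γ (_ ∷ _) = refl

validEntry : Entry → Bool
validEntry (e , a , b) = if e then nonempty b ∧ leD a b else true

validEntryF : Fun entryTy bool
validEntryF = ifF fstF (andF (nonemptyF (sndF ∘F sndF)) (leDF (fstF ∘F sndF) (sndF ∘F sndF))) (constF true)

scaled : List (List Entry) → List Bool × Matrix
scaled rows = scaleRows (map (map toFraction) rows)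

hits : List Bool × List (List Bool) → ℕ
hits (g , N) = length (filterᵇ (leD g) N)

-- The dimension is an argument of its own so that it can be the size of a graph and not merely the
-- length of a list. A row is compared with D because D is the numerator of 1 over D.
validFor : ℕ → Cert → Bool
validFor n (rows , L , γ , τ , Λ , S) =
  all (λ row → length row ≡ᵇ n) rows ∧ (length S ≡ᵇ n) ∧ all (all validEntry) rows
  ∧ all (λ cs → eqBits (sumD cs) D) css
  ∧ (1 ≤ᵇ seeds S) ∧ (suc (seeds S) ≤ᵇ n) ∧ nonempty L ∧ nonempty γ ∧ (1 ≤ᵇ τ) ∧ (1 ≤ᵇ Λ) ∧ (Λ ≤ᵇ n)
  ∧ (Λ ≤ᵇ hits (iter τ (nextRound D css n) (γ , map (λ s → if s then L else []) S)))
  where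
  D = proj₁ (scaled rows)
  css = proj₂ (scaled rows)

valid : Cert → Bool
valid c = validFor (length (proj₁ c)) c

encodeCertF : Fun certTy bits
encodeCertF = encodeUnaryF (lengthF fstF) ++F concatF (mapF (concatF (mapF (encodeEntryF ∘F sndF) sndF)) fstF)
  ++F encodeBinaryF (lengthF (filterF sndF S)) ++F delimitF (fstF ∘F sndF) ++F delimitF (fstF ∘F sndF ∘F sndF)
  ++F encodeUnaryF (fstF ∘F sndF ∘F sndF ∘F sndF) ++F encodeBinaryF (fstF ∘F sndF ∘F sndF ∘F sndF ∘F sndF)
  where
  S : Fun certTy (list bool)
  S = sndF ∘F sndF ∘F sndF ∘F sndF ∘F sndF

validF : Fun certTy bool
validF = letF (scaleRowsF (mapF (mapF (toFractionF ∘F sndF) sndF) fstF))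
  (andF (allF (eqF (lengthF sndF) (n ∘F fstF)) rows) (andF (eqF (lengthF S) n) (andF (allF (allF (validEntryF ∘F sndF) sndF) rows)
  (andF (allF (eqBitsF (sumDF sndF) (fstF ∘F sndF ∘F fstF)) (sndF ∘F sndF))
  (andF (leqF (constF 1) k) (andF (leqF (sucF k) n) (andF (nonemptyF L) (andF (nonemptyF γ) (andF (leqF (constF 1) τ)
  (andF (leqF (constF 1) Λ) (andF (leqF Λ n)
  (leqF Λ (lengthF (letF (roundsF τ (fstF ∘F sndF ,F sndF ∘F sndF ,F n ,F γ ,F mapF (ifF sndF (L ∘F fstF) (constF [])) S))
    (filterF (leDF (fstF ∘F sndF ∘F fstF) sndF) (sndF ∘F sndF))))))))))))))))
  where
  Γ : Ty
  Γ = certTy ⊗ bits ⊗ matrix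
  rows : Fun Γ (list (list entryTy))
  rows = fstF ∘F fstF
  L γ : Fun Γ bits
  L = fstF ∘F sndF ∘F fstF
  γ = fstF ∘F sndF ∘F sndF ∘F fstF
  n k τ Λ : Fun Γ nat
  n = lengthF rows
  τ = fstF ∘F sndF ∘F sndF ∘F sndF ∘F fstF
  Λ = fstF ∘F sndF ∘F sndF ∘F sndF ∘F sndF ∘F fstF
  S : Fun Γ (list bool)
  S = sndF ∘F sndF ∘F sndF ∘F sndF ∘F sndF ∘F fstF
  k = lengthF (filterF sndF S)

certificate : List Bool → Cert
certificate v = fn (decodeF certTy) (at leaf (parse (skipDelimited v)) 0)

-- The comparison is with the whole input: since `delimit` is prefix-free, it identifies the
-- re-encoded instance with the first component without extracting that component.
verify : List Bool → Bool
verify v = eqBits (delimit (encodeCert (certificate v)) ++ skipDelimited v) v ∧ valid (certificate v)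

verifyF : Fun bits bool
verifyF = letF (decodeF certTy ∘F atF leaf (parseF ∘F skipDelimitedF) (constF 0))
    (andF (eqBitsF (delimitF (encodeCertF ∘F sndF) ++F (skipDelimitedF ∘F fstF)) fstF) (validF ∘F sndF))
  as verify by-ext λ v → refl

-- Lists as functions on vertices

at-tabulate : ∀ {X : Set} {d : X} {n} (f : Fin n → X) i → at d (tabulate f) (toℕ i) ≡ f i
at-tabulate f zero    = refl
at-tabulate f (suc i) = at-tabulate (f ∘ suc) i

tabulate-at : ∀ {X : Set} (d : X) xs → tabulate {n = length xs} (λ i → at d xs (toℕ i)) ≡ xs
tabulate-at d []       = refl
tabulate-at d (x ∷ xs) = cong (x ∷_) (tabulate-at d xs)

map-upTo-tabulate : ∀ {X : Set} (f : ℕ → X) n → map f (upTo n) ≡ tabulate {n = n} (f ∘ toℕ)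
map-upTo-tabulate f n = trans (map-upTo f n) (go f n)
  where
  go : ∀ {X : Set} (f : ℕ → X) n → applyUpTo f n ≡ tabulate {n = n} (f ∘ toℕ)
  go f zero    = refl
  go f (suc n) = cong (f 0 ∷_) (go (f ∘ suc) n)

all-tabulate : ∀ {X : Set} (p : X → Bool) {n} (f : Fin n → X) → T (all p (tabulate f)) ⇔ (∀ i → T (p (f i)))
all-tabulate p {zero}  f = mk⇔ (λ _ ()) (λ _ → tt)
all-tabulate p {suc n} f = mk⇔
  (λ t → let h , r = ⇒ (T-∧ {p (f zero)}) t in λ { zero → h ; (suc i) → ⇒ (all-tabulate p (f ∘ suc)) r i })
  (λ h → ⇐ (T-∧ {p (f zero)}) (h zero , ⇐ (all-tabulate p (f ∘ suc)) (h ∘ suc)))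

Pointwise-at : ∀ {X Y : Set} {R : X → Y → Set} {d : Y} {n} (f : Fin n → X) {ys} →
  PwL.Pointwise R (tabulate f) ys → ∀ i → R (f i) (at d ys (toℕ i))
Pointwise-at f (r ∷ rs) zero    = r
Pointwise-at f (r ∷ rs) (suc i) = Pointwise-at (f ∘ suc) rs i

length-filter-≐ : ∀ {X : Set} {P Q : Pred X 0ℓ} (P? : Decidable P) (Q? : Decidable Q) →
  (∀ x → P x ⇔ Q x) → ∀ xs → length (filter P? xs) ≡ length (filter Q? xs)
length-filter-≐ P? Q? h xs = cong length (filter-≐ P? Q? ((λ {x} → ⇒ (h x)) , (λ {x} → ⇐ (h x))) xs)

seeds-∣∣ : ∀ {n} (S : Subset n) → seeds (tabulate (Vec.lookup S)) ≡ Subset.∣ S ∣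
seeds-∣∣ Vec.[]            = refl
seeds-∣∣ (true  Vec.∷ S) = cong suc (seeds-∣∣ S)
seeds-∣∣ (false Vec.∷ S) = seeds-∣∣ S

-- `q ≈[ E ] m` says that q = m / E.

infix 4 _≈[_]_
data _≈[_]_ (q : ℚᵘ) (E m : ℕ) : Set where
  cross : ↥ q ℤ.* ⁺ E ≡ ⁺ m ℤ.* ↧ q → q ≈[ E ] m

≈-zero : ∀ {E} → 0ℚᵘ ≈[ E ] 0
≈-zero = cross refl

≈-+ : ∀ {E q r m k} → q ≈[ E ] m → r ≈[ E ] k → (q ℚ.+ r) ≈[ E ] (m + k)
≈-+ {E} {mkℚᵘ a b} {mkℚᵘ c d} {m} {k} (cross p₁) (cross p₂) = cross (begin
  (a ℤ.* D ℤ.+ c ℤ.* B) ℤ.* ⁺ E             ≡⟨ arith a c B D (⁺ E) ⟩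
  (a ℤ.* ⁺ E) ℤ.* D ℤ.+ (c ℤ.* ⁺ E) ℤ.* B   ≡⟨ cong₂ (λ x y → x ℤ.* D ℤ.+ y ℤ.* B) p₁ p₂ ⟩
  (⁺ m ℤ.* B) ℤ.* D ℤ.+ (⁺ k ℤ.* D) ℤ.* B   ≡⟨ arith′ (⁺ m) (⁺ k) B D ⟩
  (⁺ m ℤ.+ ⁺ k) ℤ.* (B ℤ.* D)               ≡⟨ cong₂ ℤ._*_ (sym (ℤ.pos-+ m k)) (sym (ℤ.pos-* (suc b) (suc d))) ⟩
  ⁺ (m + k) ℤ.* ⁺ (suc b * suc d)           ∎)
  where
  open ≡-Reasoning
  B = ⁺ suc b
  D = ⁺ suc d
  arith : ∀ a c B D E → (a ℤ.* D ℤ.+ c ℤ.* B) ℤ.* E ≡ (a ℤ.* E) ℤ.* D ℤ.+ (c ℤ.* E) ℤ.* B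
  arith = ℤSolver.solve-∀
  arith′ : ∀ m k B D → (m ℤ.* B) ℤ.* D ℤ.+ (k ℤ.* D) ℤ.* B ≡ (m ℤ.+ k) ℤ.* (B ℤ.* D)
  arith′ = ℤSolver.solve-∀

≈-* : ∀ {E F q r m k} → q ≈[ E ] m → r ≈[ F ] k → (q ℚ.* r) ≈[ E * F ] (m * k)
≈-* {E} {F} {mkℚᵘ a b} {mkℚᵘ c d} {m} {k} (cross p₁) (cross p₂) = cross (begin
  (a ℤ.* c) ℤ.* ⁺ (E * F)                   ≡⟨ cong ((a ℤ.* c) ℤ.*_) (ℤ.pos-* E F) ⟩
  (a ℤ.* c) ℤ.* (⁺ E ℤ.* ⁺ F)               ≡⟨ arith a c (⁺ E) (⁺ F) ⟩
  (a ℤ.* ⁺ E) ℤ.* (c ℤ.* ⁺ F)               ≡⟨ cong₂ ℤ._*_ p₁ p₂ ⟩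
  (⁺ m ℤ.* ⁺ suc b) ℤ.* (⁺ k ℤ.* ⁺ suc d)   ≡⟨ arith (⁺ m) (⁺ suc b) (⁺ k) (⁺ suc d) ⟩
  (⁺ m ℤ.* ⁺ k) ℤ.* (⁺ suc b ℤ.* ⁺ suc d)   ≡⟨ cong₂ ℤ._*_ (sym (ℤ.pos-* m k)) (sym (ℤ.pos-* (suc b) (suc d))) ⟩
  ⁺ (m * k) ℤ.* ⁺ (suc b * suc d)           ∎)
  where
  open ≡-Reasoning
  arith : ∀ a c E F → (a ℤ.* c) ℤ.* (E ℤ.* F) ≡ (a ℤ.* E) ℤ.* (c ℤ.* F)
  arith = ℤSolver.solve-∀

≈-one : ∀ {E q m} → 0 < E → q ≈[ E ] m → (q ≃ 1ℚᵘ) ⇔ (m ≡ E)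
≈-one {suc E} {mkℚᵘ a b} {m} _ (cross p) = mk⇔
  (λ { (*≡* eq) → ℤ.+-injective (ℤ.*-cancelʳ-≡ (⁺ m) (⁺ suc E) B
        (trans (sym p) (trans (cong (ℤ._* ⁺ suc E) (trans (sym (ℤ.*-identityʳ a)) (trans eq (ℤ.*-identityˡ B)))) (ℤ.*-comm B (⁺ suc E))))) })
  (λ { refl → *≡* (trans (ℤ.*-identityʳ a) (trans (ℤ.*-cancelʳ-≡ a B (⁺ suc E) (trans p (ℤ.*-comm (⁺ suc E) B))) (sym (ℤ.*-identityˡ B)))) })
  where B = ⁺ suc b

≈-≥ : ∀ {E q m} g → 0 < E → q ≈[ E ] m → (fromNat g ℚ.≤ q) ⇔ (g * E ≤ m)
≈-≥ {suc E} {mkℚᵘ a b} {m} g _ (cross p) = mk⇔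
  (λ { (*≤* le) → ℤ.drop‿+≤+ (ℤ.*-cancelʳ-≤-pos (⁺ (g * suc E)) (⁺ m) B
        (subst₂ ℤ._≤_ lhs rhs (ℤ.*-monoʳ-≤-nonNeg (⁺ suc E) le))) })
  (λ le → *≤* (ℤ.*-cancelʳ-≤-pos _ _ (⁺ suc E) (subst₂ ℤ._≤_ (sym lhs) (sym rhs) (ℤ.*-monoʳ-≤-nonNeg B (ℤ.+≤+ le)))))
  where
  B = ⁺ suc b
  arith : ∀ g B E → (g ℤ.* B) ℤ.* E ≡ (g ℤ.* E) ℤ.* B
  arith = ℤSolver.solve-∀
  lhs : (⁺ g ℤ.* B) ℤ.* ⁺ suc E ≡ ⁺ (g * suc E) ℤ.* B
  lhs = trans (arith (⁺ g) B (⁺ suc E)) (cong (ℤ._* B) (sym (ℤ.pos-* g (suc E))))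
  rhs : (a ℤ.* ⁺ 1) ℤ.* ⁺ suc E ≡ ⁺ m ℤ.* B
  rhs = trans (cong (ℤ._* ⁺ suc E) (ℤ.*-identityʳ a)) p

-- Elements outside the filter have numerator 0, which turns a sum over neighbours into one over all
-- vertices, the form that the verifier evaluates.
≈-sum : ∀ {X : Set} (E : ℕ) (e : X → Bool) (f : X → ℚᵘ) (g : X → ℕ) →
  (∀ x → T (e x) → f x ≈[ E ] g x) → (∀ x → e x ≡ false → g x ≡ 0) →
  ∀ xs → sumℚ (map f (filterᵇ e xs)) ≈[ E ] sum (map g xs)
≈-sum E e f g h₁ h₀ []       = ≈-zero
≈-sum E e f g h₁ h₀ (x ∷ xs) with e x in eq
... | true  = ≈-+ (h₁ x (subst T (sym eq) tt)) (≈-sum E e f g h₁ h₀ xs)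
... | false rewrite h₀ x eq = ≈-sum E e f g h₁ h₀ xs

Scales : ℕ → Fraction → List Bool → Set
Scales Q (a , b) c = val c * val b ≡ val a * Q

map-scales : ∀ q Q x → x * Q ≡ q → ∀ (k : List Bool) → val k ≡ x → ∀ {es cs} →
  PwL.Pointwise (Scales Q) es cs → PwL.Pointwise (Scales q) es (map (mulD k) cs)
map-scales q Q x eq k refl [] = []
map-scales q Q x eq k refl {(a , b) ∷ _} {c ∷ _} (r ∷ rs) =
  trans (cong (_* val b) (val-mulD k c)) (trans (*-assoc (val k) (val c) (val b)) (trans (cong (val k *_) r)
    (trans (arith (val k) (val a) Q) (cong (val a *_) eq)))) ∷ map-scales q Q x eq k refl rs
  where arith : ∀ x a Q → x * (a * Q) ≡ a * (x * Q)
        arith = solve-∀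

scaleRow-correct : ∀ es → PwL.Pointwise (Scales (val (proj₁ (scaleRow es)))) es (proj₂ (scaleRow es))
scaleRow-correct []             = []
scaleRow-correct ((a , b) ∷ es) =
  trans (cong (_* val b) (val-mulD a Q)) (trans (arith (val a) (val b) (val Q)) (cong (val a *_) (sym (val-mulD b Q)))) ∷
  map-scales _ (val Q) (val b) (sym (val-mulD b Q)) b refl (scaleRow-correct es)
  where
  Q = proj₁ (scaleRow es)
  arith : ∀ a b Q → a * Q * b ≡ a * (b * Q)
  arith = solve-∀

scaleRows-correct : ∀ ess → PwL.Pointwise (PwL.Pointwise (Scales (val (proj₁ (scaleRows ess))))) ess (proj₂ (scaleRows ess))
scaleRows-correct []         = []
scaleRows-correct (es ∷ ess) =
  map-scales _ (val q) (val Q) (trans (*-comm (val Q) (val q)) (sym (val-mulD q Q))) Q refl (scaleRow-correct es) ∷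
  go (scaleRows-correct ess)
  where
  q = proj₁ (scaleRow es)
  Q = proj₁ (scaleRows ess)
  go : ∀ {ess css} → PwL.Pointwise (PwL.Pointwise (Scales (val Q))) ess css →
    PwL.Pointwise (PwL.Pointwise (Scales (val (mulD q Q)))) ess (map (map (mulD q)) css)
  go []       = []
  go (r ∷ rs) = map-scales _ (val Q) (val q) (sym (val-mulD q Q)) q refl r ∷ go rs

Proper : Fraction → Set
Proper (a , b) = 0 < val b

scaleRow-positive : ∀ {es} → All Proper es → 0 < val (proj₁ (scaleRow es))
scaleRow-positive []                      = s≤s z≤n
scaleRow-positive {(a , b) ∷ es} (p ∷ ps) = subst (0 <_) (sym (val-mulD b (proj₁ (scaleRow es)))) (*-mono-< p (scaleRow-positive ps))

scaleRows-positive : ∀ {ess} → All (All Proper) ess → 0 < val (proj₁ (scaleRows ess))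
scaleRows-positive []                  = s≤s z≤n
scaleRows-positive {es ∷ ess} (p ∷ ps) =
  subst (0 <_) (sym (val-mulD (proj₁ (scaleRow es)) (proj₁ (scaleRows ess)))) (*-mono-< (scaleRow-positive p) (scaleRows-positive ps))

val-injective : ∀ {xs ys} → val xs ≡ val ys → xs ≡ ys
val-injective {xs} {ys} eq = trans (sym (toDigits-val xs)) (trans (cong toDigits eq) (toDigits-val ys))

Matches : Entry → Bool → ℚᵘ → Set
Matches (e , a , b) c p = e ≡ c × (T c → ↥ p ≡ ⁺ val a × ↧ₙ p ≡ val b)

table : ∀ {X : Set} {n} → (Fin n → Fin n → X) → List (List X)
table f = tabulate (λ u → tabulate (f u))

map-table : ∀ {X Y : Set} {n} (g : X → Y) (f : Fin n → Fin n → X) → map (map g) (table f) ≡ table (λ u v → g (f u v))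
map-table g f = trans (map-tabulate _ (map g)) (tabulate-cong (λ u → map-tabulate (f u) g))

-- Probabilities and loads of a graph from a matching table of entries

module _ {n : ℕ} (edge : Fin n → Fin n → Bool) (prob : Fin n → Fin n → ℚᵘ) (e : Fin n → Fin n → Entry) (match : ∀ u v → Matches (e u v) (edge u v) (prob u v)) where

  private
    frac : Fin n → Fin n → Fraction
    frac u v = toFraction (e u v)

    D : List Bool
    D = proj₁ (scaled (table e))

    css : Matrix
    css = proj₂ (scaled (table e))

  numerator : Fin n → Fin n → List Bool
  numerator u v = entryAt css (toℕ u) (toℕ v)

  private
    scales : ∀ u → PwL.Pointwise (Scales (val D)) (tabulate (frac u)) (at [] css (toℕ u))
    scales u = Pointwise-at (λ u → tabulate (frac u))
      (subst (λ z → PwL.Pointwise (PwL.Pointwise (Scales (val D))) z css) (map-table toFraction e) (scaleRows-correct (map (map toFraction) (table e)))) u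

    css-length : length css ≡ n
    css-length = trans (scaleRows-length (map (map toFraction) (table e))) (trans (length-map _ (table e)) (length-tabulate _))

    row-length : ∀ u → length (at [] css (toℕ u)) ≡ n
    row-length u = trans (sym (PwL.Pointwise-length (scales u))) (length-tabulate (frac u))

    tabulate-at′ : ∀ {X : Set} (d : X) xs → length xs ≡ n → xs ≡ tabulate {n = n} (λ i → at d xs (toℕ i))
    tabulate-at′ d xs refl = sym (tabulate-at d xs)

  matrix-table : css ≡ table numerator
  matrix-table = trans (tabulate-at′ [] css css-length) (tabulate-cong λ u → tabulate-at′ [] (at [] css (toℕ u)) (row-length u))

  numerator-scales : ∀ u v → Scales (val D) (frac u v) (numerator u v)
  numerator-scales u v = Pointwise-at (frac u) (scales u) v

  private
    proper : ∀ u v → Proper (frac u v)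
    proper u v with e u v | edge u v in eq | match u v
    ... | true  , a , b | true  | refl , m = subst (0 <_) (proj₂ (m tt)) (s≤s z≤n)
    ... | false , a , b | false | refl , m = s≤s z≤n

    All-tabulate : ∀ {X : Set} {P : X → Set} {m} (f : Fin m → X) → (∀ i → P (f i)) → All P (tabulate f)
    All-tabulate {m = zero}  f h = []
    All-tabulate {m = suc m} f h = h zero ∷ All-tabulate (f ∘ suc) (h ∘ suc)

  denominator-positive : 0 < val D
  denominator-positive = scaleRows-positive (subst (All (All Proper)) (sym (map-table toFraction e))
    (All-tabulate _ λ u → All-tabulate (frac u) (proper u)))

  prob≈ : ∀ u v → T (edge u v) → prob u v ≈[ val D ] val (numerator u v)
  prob≈ u v t with e u v | edge u v | match u v | numerator-scales u v
  prob≈ u v t | true , a , b | true | refl , m | eq with m tt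
  ... | num , den = cross (trans (cong (ℤ._* ⁺ val D) num) (trans (sym (ℤ.pos-* (val a) (val D))) (trans (cong ⁺_ (sym eq))
    (trans (ℤ.pos-* (val (numerator u v)) (val b)) (cong (λ z → ⁺ val (numerator u v) ℤ.* ⁺ z) (sym den))))))

  no-edge : ∀ u v → edge u v ≡ false → val (numerator u v) ≡ 0
  no-edge u v eq with e u v | edge u v | match u v | numerator-scales u v
  no-edge u v refl | false , a , b | false | refl , m | s = trans (sym (*-identityʳ _)) s

  row-sum : ∀ u → val (sumD (tabulate (numerator u))) ≡ sum (map (λ v → val (numerator u v)) (allFin n))
  row-sum u = trans (val-sumD (tabulate (numerator u))) (cong sum (trans (map-tabulate (numerator u) val) (sym (map-tabulate id (λ v → val (numerator u v))))))

  normalized⇔ : ∀ u → (sumℚ (map (prob u) (filterᵇ (edge u) (allFin n))) ≃ 1ℚᵘ) ⇔ T (eqBits (sumD (tabulate (numerator u))) D)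
  normalized⇔ u = mk⇔
    (λ eq → ⇐ (eqBits-correct (sumD (tabulate (numerator u))) D) (val-injective (trans (row-sum u) (⇒ total eq))))
    (λ t → ⇐ total (trans (sym (row-sum u)) (cong val (⇒ (eqBits-correct (sumD (tabulate (numerator u))) D) t))))
    where
    total = ≈-one denominator-positive (≈-sum (val D) (edge u) (prob u) (λ v → val (numerator u v)) (prob≈ u) (no-edge u) (allFin n))

  module _ (S : Subset n) (L γ : List Bool) where

    numerators : ℕ → Fin n → List Bool
    numerators zero    v = if Vec.lookup S v then L else []
    numerators (suc t) v = sumD (tabulate (λ u → mulD (numerator u v) (numerators t u)))

    private
      N₀ : List (List Bool)
      N₀ = map (λ s → if s then L else []) (tabulate (Vec.lookup S))

    rounds-loads : ∀ t → proj₂ (iter t (nextRound D css n) (γ , N₀)) ≡ tabulate (numerators t)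
    rounds-loads zero    = map-tabulate (Vec.lookup S) _
    rounds-loads (suc t) = trans (cong (nextLoads css n) (rounds-loads t)) (trans (map-upTo-tabulate _ n)
      (tabulate-cong λ v → cong sumD (trans (map-upTo-tabulate _ n)
        (tabulate-cong λ u → cong (mulD (numerator u v)) (at-tabulate (numerators t) u)))))

    rounds-threshold : ∀ t → val (proj₁ (iter t (nextRound D css n) (γ , N₀))) ≡ val γ * val D ^ t
    rounds-threshold zero    = sym (*-identityʳ _)
    rounds-threshold (suc t) = trans (val-mulD (proj₁ (iter t (nextRound D css n) (γ , N₀))) D) (trans (cong (_* val D) (rounds-threshold t)) (arith (val γ) (val D) (val D ^ t)))
      where arith : ∀ g d k → g * k * d ≡ g * (d * k)
            arith = solve-∀

    module _ (p≥0 : ∀ u v → T (edge u v) → 0ℚᵘ ℚ.≤ prob u v) (p≤1 : ∀ u v → T (edge u v) → prob u v ℚ.≤ 1ℚᵘ) (norm : ∀ u → sumℚ (map (λ v → prob u v) (filterᵇ (λ w → edge u w) (allFin n))) ≃ 1ℚᵘ) where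

      private
        G : MobilityGraph
        G = record { n = n ; edge = edge ; prob = prob ; prob≥0 = p≥0 ; prob≤1 = p≤1 ; normalized = norm }

      load≈ : ∀ t v → load G (val L) v t S ≈[ val D ^ t ] val (numerators t v)
      load≈ zero v with Vec.lookup S v
      ... | true  = cross refl
      ... | false = ≈-zero
      load≈ (suc t) v = subst (λ z → load G (val L) v (suc t) S ≈[ val D ^ suc t ] z) (sym total)
        (≈-sum (val D ^ suc t) (λ u → edge u v) (λ u → prob u v ℚ.* load G (val L) u t S)
          (λ u → val (numerator u v) * val (numerators t u))
          (λ u x → ≈-* (prob≈ u v x) (load≈ t u)) (λ u eq → cong (_* val (numerators t u)) (no-edge u v eq)) (allFin n))
        where
        f = λ u → mulD (numerator u v) (numerators t u)
        total : val (numerators (suc t) v) ≡ sum (map (λ u → val (numerator u v) * val (numerators t u)) (allFin n))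
        total = trans (val-sumD (tabulate f)) (cong sum (trans (map-tabulate f val) (trans (tabulate-cong λ u → val-mulD (numerator u v) (numerators t u))
          (sym (map-tabulate id (λ u → val (numerator u v) * val (numerators t u)))))))

      hits-σᵀ : ∀ t → hits (iter t (nextRound D css n) (γ , N₀)) ≡ σᵀ G (val L) (val γ) t S
      hits-σᵀ t = trans (cong (λ z → length (filterᵇ (leD g) z)) (trans (rounds-loads t) (sym (map-tabulate id (numerators t)))))
        (trans (filter-map (allFin n)) (length-filter-≐ (λ v → T? (leD g (numerators t v))) (λ v → fromNat (val γ) ℚ.≤? load G (val L) v t S) threshold (allFin n)))
        where
        g = proj₁ (iter t (nextRound D css n) (γ , N₀))
        filter-map : ∀ us → length (filterᵇ (leD g) (map (numerators t) us)) ≡ length (filter (λ v → T? (leD g (numerators t v))) us)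
        filter-map []       = refl
        filter-map (u ∷ us) with leD g (numerators t u)
        ... | true  = cong suc (filter-map us)
        ... | false = filter-map us
        threshold : ∀ v → T (leD g (numerators t v)) ⇔ (fromNat (val γ) ℚ.≤ load G (val L) v t S)
        threshold v = mk⇔
          (λ x → ⇐ q (subst (_≤ val (numerators t v)) (rounds-threshold t) (⇒ c x)))
          (λ x → ⇐ c (subst (_≤ val (numerators t v)) (sym (rounds-threshold t)) (⇒ q x)))
          where
          c = proj₁ (compareD-correct g (numerators t v))
          q = ≈-≥ (val γ) (m^n>0 (val D) {{>-nonZero denominator-positive}} t) (load≈ t v)

-- Codes of instances and of certificates

entryCode : Bool → ℚᵘ → List Bool
entryCode e p = if e then true ∷ encodeProb p else false ∷ []

entriesCode : ∀ {n} → (Fin n → Fin n → Bool) → (Fin n → Fin n → ℚᵘ) → List Bool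
entriesCode e p = concat (tabulate λ u → concat (tabulate λ v → entryCode (e u v) (p u v)))

encode-graph : ∀ G → encodeGraph G ≡ encodeUnary (MobilityGraph.n G) ++ entriesCode (MobilityGraph.edge G) (MobilityGraph.prob G)
encode-graph G = cong (λ z → encodeUnary n ++ concat z)
    (trans (map-tabulate id (λ u → concatMap (code u) (allFin n))) (tabulate-cong λ u → cong concat (map-tabulate id (code u))))
  where
  open MobilityGraph G
  code : Fin n → Fin n → List Bool
  code u v = entryCode (edge u v) (prob u v)

encodeEntry-match : ∀ t c p → Matches t c p → encodeEntry t ≡ entryCode c p
encodeEntry-match (true  , a , b) _ p (refl , m) with m tt
... | num , den = cong (true ∷_) (cong₂ _++_
  (cong delimit (sym (trans (cong toDigits (cong ℤ.∣_∣ num)) (toDigits-val a))))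
  (cong delimit (sym (trans (cong toDigits den) (toDigits-val b)))))
encodeEntry-match (false , a , b) _ p (refl , m) = refl

encodeRows-table : ∀ {n} (f : Fin n → Fin n → Entry) → encodeRows (table f) ≡ concat (tabulate λ u → concat (tabulate λ v → encodeEntry (f u v)))
encodeRows-table f = cong concat (trans (map-tabulate (λ u → tabulate (f u)) (λ row → concat (map encodeEntry row))) (tabulate-cong λ u → cong concat (map-tabulate (f u) encodeEntry)))

encode-entries : ∀ I → encode I ≡ encodeUnary (Instance.n I) ++ entriesCode (Instance.edge I) (Instance.prob I) ++ encodeBinary (Instance.k I)
  ++ encodeBinary (Instance.L I) ++ encodeBinary (Instance.γ I) ++ encodeUnary (Instance.τ I) ++ encodeBinary (Instance.Λ I)
encode-entries I = trans (cong (_++ rest) (encode-graph graph)) (++-assoc (encodeUnary n) (entriesCode edge prob) rest)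
  where
  open Instance I
  rest = encodeBinary k ++ encodeBinary L ++ encodeBinary γ ++ encodeUnary τ ++ encodeBinary Λ

module _ (I : Instance) where

  open Instance I

  encode-cert : (f : Fin n → Fin n → Entry) → (∀ u v → Matches (f u v) (edge u v) (prob u v)) →
    ∀ (S : Subset n) Ld γd → Subset.∣ S ∣ ≡ k → val Ld ≡ L → val γd ≡ γ →
    encodeCert (table f , Ld , γd , τ , Λ , tabulate (Vec.lookup S)) ≡ encode I
  encode-cert f match S Ld γd refl refl refl = trans
    (cong₂ _++_ (cong encodeUnary (length-tabulate (λ u → tabulate (f u)))) (cong₂ _++_ rows-eq (cong₂ _++_ (cong encodeBinary (seeds-∣∣ S))
      (cong₂ (λ x y → delimit x ++ delimit y ++ encodeUnary τ ++ encodeBinary Λ) (sym (toDigits-val Ld)) (sym (toDigits-val γd))))))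
    (sym (encode-entries I))
    where
    rows-eq : encodeRows (table f) ≡ entriesCode edge prob
    rows-eq = trans (encodeRows-table f) (cong concat (tabulate-cong λ u → cong concat (tabulate-cong λ v → encodeEntry-match (f u v) (edge u v) (prob u v) (match u v))))

nonempty-positive : ∀ w → T (nonempty w) ⇔ (0 < val w)
nonempty-positive []          = mk⇔ (λ ()) (λ ())
nonempty-positive (true ∷ w)  = mk⇔ (λ _ → s≤s z≤n) (λ _ → tt)
nonempty-positive (false ∷ w) = mk⇔ (λ _ → s≤s z≤n) (λ _ → tt)

infixr 2 _&_
_&_ : ∀ {a b} → T a → T b → T (a ∧ b)
_&_ {true} _ q = q

-- Soundness of the verifier

module Sound {n : ℕ} (f : Fin n → Fin n → Entry) (S : Subset n) (L γ : List Bool) (τ Λ : ℕ) (ok : T (validFor n (table f , L , γ , τ , Λ , tabulate (Vec.lookup S)))) where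

  private
    split : ∀ {a b} → T (a ∧ b) → T a × T b
    split = ⇒ T-∧
    D = proj₁ (scaled (table f))
    css = proj₂ (scaled (table f))
    ok₁ = proj₂ (split {all (λ row → length row ≡ᵇ n) (table f)} ok)
    ok₂ = proj₂ (split {length (tabulate (Vec.lookup S)) ≡ᵇ n} ok₁)
    entries-ok = split {all (all validEntry) (table f)} ok₂
    sums-ok = split {all (λ cs → eqBits (sumD cs) D) css} (proj₂ entries-ok)
    k-ok = split {1 ≤ᵇ seeds (tabulate (Vec.lookup S))} (proj₂ sums-ok)
    kn-ok = split {suc (seeds (tabulate (Vec.lookup S))) ≤ᵇ n} (proj₂ k-ok)
    L-ok = split {nonempty L} (proj₂ kn-ok)
    γ-ok = split {nonempty γ} (proj₂ L-ok)
    τ-ok = split {1 ≤ᵇ τ} (proj₂ γ-ok)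
    Λ-ok = split {1 ≤ᵇ Λ} (proj₂ τ-ok)
    Λn-ok = split {Λ ≤ᵇ n} (proj₂ Λ-ok)

    edge : Fin n → Fin n → Bool
    edge u v = proj₁ (f u v)
    -- `mkℚᵘ` takes the denominator minus one. At an edge `validEntry` makes the denominator
    -- positive, so `pred` is undone there; elsewhere the value is arbitrary.
    prob : Fin n → Fin n → ℚᵘ
    prob u v = mkℚᵘ (⁺ val (proj₁ (proj₂ (f u v)))) (pred (val (proj₂ (proj₂ (f u v)))))

    entry-ok : ∀ u v → T (validEntry (f u v))
    entry-ok u v = ⇒ (all-tabulate validEntry (f u)) (⇒ (all-tabulate (all validEntry) (λ u → tabulate (f u))) (proj₁ entries-ok) u) v

    facts : ∀ u v → T (edge u v) → 0 < val (proj₂ (proj₂ (f u v))) × val (proj₁ (proj₂ (f u v))) ≤ val (proj₂ (proj₂ (f u v)))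
    facts u v t with f u v | entry-ok u v
    ... | true , a , b | x = let p , q = split {nonempty b} x in ⇒ (nonempty-positive b) p , ⇒ (proj₁ (compareD-correct a b)) q

    suc-pred-positive : ∀ {m} → 0 < m → suc (pred m) ≡ m
    suc-pred-positive (s≤s _) = refl

    match : ∀ u v → Matches (f u v) (edge u v) (prob u v)
    match u v = refl , λ t → refl , suc-pred-positive (proj₁ (facts u v t))

    p≥0 : ∀ u v → T (edge u v) → 0ℚᵘ ℚ.≤ prob u v
    p≥0 u v _ = *≤* (subst (⁺ 0 ℤ.≤_) (sym (ℤ.*-identityʳ (⁺ val (proj₁ (proj₂ (f u v)))))) (ℤ.+≤+ z≤n))

    p≤1 : ∀ u v → T (edge u v) → prob u v ℚ.≤ 1ℚᵘ
    p≤1 u v t = *≤* (subst₂ ℤ._≤_ (sym (ℤ.*-identityʳ _)) (sym (ℤ.*-identityˡ _))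
      (ℤ.+≤+ (≤-trans (proj₂ (facts u v t)) (≤-reflexive (sym (suc-pred-positive (proj₁ (facts u v t))))))))

    norm : ∀ u → sumℚ (map (λ v → prob u v) (filterᵇ (λ w → edge u w) (allFin n))) ≃ 1ℚᵘ
    norm u = ⇐ (normalized⇔ edge prob f match u)
      (⇒ (all-tabulate (λ cs → eqBits (sumD cs) D) (λ u → tabulate (numerator edge prob f match u)))
        (subst (λ z → T (all (λ cs → eqBits (sumD cs) D) z)) (matrix-table edge prob f match) (proj₁ sums-ok)) u)

    inst : Instance
    inst = record
      { graph = record { n = n ; edge = edge ; prob = prob ; prob≥0 = p≥0 ; prob≤1 = p≤1 ; normalized = norm }
      ; k = Subset.∣ S ∣ ; L = val L ; γ = val γ ; τ = τ ; Λ = Λ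
      ; 0<k = subst (0 <_) (seeds-∣∣ S) (≤ᵇ⇒≤ 1 _ (proj₁ k-ok))
      ; k<n = subst (_< n) (seeds-∣∣ S) (≤ᵇ⇒≤ _ n (proj₁ kn-ok))
      ; L≥1 = ⇒ (nonempty-positive L) (proj₁ L-ok)
      ; 0<γ = ⇒ (nonempty-positive γ) (proj₁ γ-ok)
      ; τ≥1 = ≤ᵇ⇒≤ 1 τ (proj₁ τ-ok)
      ; 0<Λ = ≤ᵇ⇒≤ 1 Λ (proj₁ Λ-ok)
      ; Λ≤n = ≤ᵇ⇒≤ Λ n (proj₁ Λn-ok) }

  sound : T-BS (encodeCert (table f , L , γ , τ , Λ , tabulate (Vec.lookup S)))
  sound = inst , encode-cert inst f match S L γ refl refl refl , S , refl ,
    subst (Λ ≤_) (hits-σᵀ edge prob f match S L γ p≥0 p≤1 norm τ) (≤ᵇ⇒≤ Λ _ (proj₂ Λn-ok))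

-- A certificate consists of mere lists. The length checks make them tables of functions on `Fin n`,
-- the form that `Sound` expects.
valid-sound : ∀ X → T (valid X) → T-BS (encodeCert X)
valid-sound (rows , L , γ , τ , Λ , S) ok =
  subst₂ (λ r s → T-BS (encodeCert (r , L , γ , τ , Λ , s))) (sym rows≡) (sym S≡)
    (Sound.sound f V L γ τ Λ (subst₂ (λ r s → T (validFor n (r , L , γ , τ , Λ , s))) rows≡ S≡ ok))
  where
  n = length rows
  f : Fin n → Fin n → Entry
  f u v = at (false , [] , []) (at [] rows (toℕ u)) (toℕ v)
  V : Subset n
  V = Vec.tabulate (λ i → at false S (toℕ i))
  lengths-ok = ⇒ (T-∧ {all (λ row → length row ≡ᵇ n) rows}) ok
  row-length : ∀ u → length (at [] rows (toℕ u)) ≡ n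
  row-length u = ≡ᵇ⇒≡ _ n (⇒ (all-tabulate (λ row → length row ≡ᵇ n) (λ i → at [] rows (toℕ i)))
    (subst (λ r → T (all (λ row → length row ≡ᵇ n) r)) (sym (tabulate-at [] rows)) (proj₁ lengths-ok)) u)
  to-table : ∀ {X : Set} (d : X) xs → length xs ≡ n → xs ≡ tabulate {n = n} (λ i → at d xs (toℕ i))
  to-table d xs eq = subst (λ m → xs ≡ tabulate {n = m} (λ i → at d xs (toℕ i))) eq (sym (tabulate-at d xs))
  rows≡ : rows ≡ table f
  rows≡ = trans (to-table [] rows refl) (tabulate-cong λ u → to-table _ (at [] rows (toℕ u)) (row-length u))
  S≡ : S ≡ tabulate (Vec.lookup V)
  S≡ = trans (to-table false S (≡ᵇ⇒≡ _ n (proj₁ (⇒ (T-∧ {length S ≡ᵇ n}) (proj₂ lengths-ok)))))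
    (tabulate-cong λ i → sym (Vec.lookup∘tabulate (λ i → at false S (toℕ i)) i))

verify-sound : ∀ w c → T (verify (pair w c)) → T-BS w
verify-sound w c t = subst T-BS (proj₁ (delimit-prefix (encodeCert X) w (trans (cong (delimit (encodeCert X) ++_) (sym (skipDelimited-pair w c))) (⇒ (eqBits-correct (delimit (encodeCert X) ++ skipDelimited (pair w c)) (pair w c)) (proj₁ parts)))))
    (valid-sound X (proj₂ parts))
  where
  X = certificate (pair w c)
  parts = ⇒ (T-∧ {eqBits (delimit (encodeCert X) ++ skipDelimited (pair w c)) (pair w c)}) t

-- Completeness of the verifier

module Complete (I : Instance) (S : Subset (Instance.n I)) (card : Subset.∣ S ∣ ≡ Instance.k I) (enough : σᵀ (Instance.graph I) (Instance.L I) (Instance.γ I) (Instance.τ I) S ≥ Instance.Λ I) where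

  open Instance I

  f : Fin n → Fin n → Entry
  f u v = if edge u v then (true , toDigits ℤ.∣ ↥ prob u v ∣ , toDigits (↧ₙ prob u v)) else (false , [] , [])

  cert : Cert
  cert = table f , toDigits L , toDigits γ , τ , Λ , tabulate (Vec.lookup S)

  private
    numerator≥0 : ∀ u v → T (edge u v) → ⁺ ℤ.∣ ↥ prob u v ∣ ≡ ↥ prob u v
    numerator≥0 u v t with prob≥0 u v t
    ... | *≤* le = ℤ.0≤i⇒+∣i∣≡i (subst (⁺ 0 ℤ.≤_) (ℤ.*-identityʳ _) le)

    match : ∀ u v → Matches (f u v) (edge u v) (prob u v)
    match u v with edge u v in eq
    ... | true  = refl , λ _ → trans (sym (numerator≥0 u v (subst T (sym eq) tt))) (cong ⁺_ (sym (val-toDigits ℤ.∣ ↥ prob u v ∣))) , sym (val-toDigits (↧ₙ prob u v))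
    ... | false = refl , λ ()

  encode-correct : encodeCert cert ≡ encode I
  encode-correct = encode-cert I f match S (toDigits L) (toDigits γ) card (val-toDigits L) (val-toDigits γ)

  private
    numerator≤ : ∀ u v → T (edge u v) → ℤ.∣ ↥ prob u v ∣ ≤ ↧ₙ prob u v
    numerator≤ u v t with prob≤1 u v t
    ... | *≤* le = ℤ.drop‿+≤+ (subst₂ ℤ._≤_ (trans (ℤ.*-identityʳ _) (sym (numerator≥0 u v t))) (ℤ.*-identityˡ _) le)

    entry-ok : ∀ u v → T (validEntry (f u v))
    entry-ok u v with edge u v in eq
    ... | true  = ⇐ (nonempty-positive (toDigits (↧ₙ prob u v))) (subst (0 <_) (sym (val-toDigits (↧ₙ prob u v))) (s≤s z≤n)) &
      ⇐ (proj₁ (compareD-correct (toDigits ℤ.∣ ↥ prob u v ∣) (toDigits (↧ₙ prob u v))))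
        (subst₂ _≤_ (sym (val-toDigits ℤ.∣ ↥ prob u v ∣)) (sym (val-toDigits (↧ₙ prob u v))) (numerator≤ u v (subst T (sym eq) tt)))
    ... | false = tt

    D = proj₁ (scaled (table f))
    css = proj₂ (scaled (table f))
    positive : ∀ m → 0 < m → T (nonempty (toDigits m))
    positive m p = ⇐ (nonempty-positive (toDigits m)) (subst (0 <_) (sym (val-toDigits m)) p)
    seeds≡ : seeds (tabulate (Vec.lookup S)) ≡ k
    seeds≡ = trans (seeds-∣∣ S) card
    σ≡ : σᵀ graph (val (toDigits L)) (val (toDigits γ)) τ S ≡ σᵀ graph L γ τ S
    σ≡ = cong₂ (λ l g → σᵀ graph l g τ S) (val-toDigits L) (val-toDigits γ)

  cert-valid : T (valid cert)
  cert-valid = subst (λ m → T (validFor m cert)) (sym (length-tabulate (λ u → tabulate (f u))))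
    ( ⇐ (all-tabulate (λ row → length row ≡ᵇ n) (λ u → tabulate (f u))) (λ u → ≡⇒≡ᵇ _ n (length-tabulate (f u)))
    & ≡⇒≡ᵇ (length (tabulate (Vec.lookup S))) n (length-tabulate (Vec.lookup S))
    & ⇐ (all-tabulate (all validEntry) (λ u → tabulate (f u))) (λ u → ⇐ (all-tabulate validEntry (f u)) (entry-ok u))
    & subst (λ z → T (all (λ cs → eqBits (sumD cs) D) z)) (sym (matrix-table edge prob f match))
        (⇐ (all-tabulate (λ cs → eqBits (sumD cs) D) (λ u → tabulate (numerator edge prob f match u)))
          (λ u → ⇒ (normalized⇔ edge prob f match u) (normalized u)))
    & ≤⇒≤ᵇ (subst (1 ≤_) (sym seeds≡) 0<k)
    & ≤⇒≤ᵇ (subst (_< n) (sym seeds≡) k<n)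
    & positive L L≥1 & positive γ 0<γ & ≤⇒≤ᵇ τ≥1 & ≤⇒≤ᵇ 0<Λ & ≤⇒≤ᵇ Λ≤n
    & ≤⇒≤ᵇ (subst (Λ ≤_) (sym (trans (hits-σᵀ edge prob f match S (toDigits L) (toDigits γ) prob≥0 prob≤1 normalized τ) σ≡)) enough))

-- Length of the certificates

length-delimit : ∀ w → length (delimit w) ≡ suc (2 * length w)
length-delimit []      = refl
length-delimit (b ∷ w) = trans (cong (2 +_) (length-delimit w)) (cong suc (sym (*-suc 2 (length w))))

∣bits∣≤delimit : ∀ w → ∣_∣ {bits} w ≤ 8 * length (delimit w)
∣bits∣≤delimit w = ≤-trans (∣bits∣≤ w) (≤-trans (m≤m+n _ (12 * length w + 7)) (≤-reflexive
    (trans (arith (length w)) (cong (8 *_) (sym (length-delimit w))))))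
  where arith : ∀ n → 4 * n + 1 + (12 * n + 7) ≡ 8 * suc (2 * n)
        arith = solve-∀

-- `k` is the part of an element that its own code does not pay for. It is 0 for entries, as even
-- the single bit of a non-edge pays 8, and 2 for rows.
∣tabulate∣≤ : ∀ {A} k (c : ⟦ A ⟧ → List Bool) {n} (f : Fin n → ⟦ A ⟧) → (∀ i → suc (∣_∣ {A} (f i)) ≤ k + 8 * length (c (f i))) →
  ∣_∣ {list A} (tabulate f) ≤ 1 + n * k + 8 * length (concat (map c (tabulate f)))
∣tabulate∣≤ k c {zero}  f h = ≤-refl
∣tabulate∣≤ {A} k c {suc n} f h = begin
  suc (∣_∣ {A} (f zero)) + ∣_∣ {list A} (tabulate (f ∘ suc))
    ≤⟨ +-mono-≤ (h zero) (∣tabulate∣≤ {A} k c (f ∘ suc) (h ∘ suc)) ⟩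
  k + 8 * length (c (f zero)) + (1 + n * k + 8 * length codes)
    ≡⟨ arith k (length (c (f zero))) (n * k) (length codes) ⟩
  1 + (k + n * k) + 8 * (length (c (f zero)) + length codes)
    ≡⟨ cong (λ z → 1 + (k + n * k) + 8 * z) (length-++ (c (f zero))) ⟨
  1 + suc n * k + 8 * length (c (f zero) ++ codes) ∎
  where
  open ≤-Reasoning
  codes = concat (map c (tabulate (f ∘ suc)))
  arith : ∀ k a m b → k + 8 * a + (1 + m + 8 * b) ≡ 1 + (k + m) + 8 * (a + b)
  arith = solve-∀

module _ (I : Instance) (S : Subset (Instance.n I)) (card : Subset.∣ S ∣ ≡ Instance.k I) (enough : σᵀ (Instance.graph I) (Instance.L I) (Instance.γ I) (Instance.τ I) S ≥ Instance.Λ I) where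

  open Instance I

  open Complete I S card enough

  private
    entry≤ : ∀ u v → suc (∣_∣ {entryTy} (f u v)) ≤ 0 + 8 * length (encodeEntry (f u v))
    entry≤ u v with edge u v
    ... | false = s≤s (s≤s (s≤s (s≤s (s≤s (s≤s z≤n)))))
    ... | true  = begin
      6 + (∣_∣ {bits} a + ∣_∣ {bits} b)                          ≤⟨ +-mono-≤ (m≤m+n 6 2) (+-mono-≤ (∣bits∣≤delimit a) (∣bits∣≤delimit b)) ⟩
      8 + (8 * length (delimit a) + 8 * length (delimit b))      ≡⟨ arith (length (delimit a)) (length (delimit b)) ⟩
      8 * suc (length (delimit a) + length (delimit b))          ≡⟨ cong (λ z → 8 * suc z) (length-++ (delimit a)) ⟨
      8 * suc (length (delimit a ++ delimit b))                  ∎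
      where
      open ≤-Reasoning
      a = toDigits ℤ.∣ ↥ prob u v ∣
      b = toDigits (↧ₙ prob u v)
      arith : ∀ x y → 8 + (8 * x + 8 * y) ≡ 8 * suc (x + y)
      arith = solve-∀

    row≤ : ∀ u → suc (∣_∣ {list entryTy} (tabulate (f u))) ≤ 2 + 8 * length (concat (map encodeEntry (tabulate (f u))))
    row≤ u = s≤s (≤-trans (∣tabulate∣≤ {entryTy} 0 encodeEntry (f u) (entry≤ u)) (≤-reflexive (cong (λ z → suc z + 8 * length (concat (map encodeEntry (tabulate (f u))))) (*-zeroʳ n))))

    rows≤ : ∣_∣ {list (list entryTy)} (table f) ≤ 1 + n * 2 + 8 * length (encodeRows (table f))
    rows≤ = ∣tabulate∣≤ {list entryTy} 2 (λ row → concat (map encodeEntry row)) (λ u → tabulate (f u)) row≤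

    S≤ : ∣_∣ {bits} (tabulate (Vec.lookup S)) ≤ 4 * n + 1
    S≤ = ≤-trans (∣bits∣≤ _) (≤-reflexive (cong (λ z → 4 * z + 1) (length-tabulate (Vec.lookup S))))

    nat≤ : ∀ m → ∣_∣ {nat} m ≤ 8 * length (encodeUnary m)
    nat≤ zero    = s≤s z≤n
    nat≤ (suc m) = ≤-trans (+-mono-≤ (m≤m+n 2 6) (nat≤ m)) (≤-reflexive (sym (*-suc 8 (length (encodeUnary m)))))

    length-unary : ∀ m → length (encodeUnary m) ≡ suc m
    length-unary zero    = refl
    length-unary (suc m) = cong suc (length-unary m)

  -- The factor 8 is exact for n: rows take an overhead of 2 n, the unary Λ takes at most 2 n and
  -- the seed list at most 4 n, all charged to the unary n at the front of the code. Everything else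
  -- is charged to its own code.
  cert≤ : ∣_∣ {certTy} cert ≤ 8 + length (encode I) * 8
  cert≤ = begin
    ∣_∣ {certTy} cert
      ≤⟨ s≤s (+-mono-≤ rows≤ (s≤s (+-mono-≤ (∣bits∣≤delimit Ld) (s≤s (+-mono-≤ (∣bits∣≤delimit γd) (s≤s (+-mono-≤ (nat≤ τ)
           (s≤s (+-mono-≤ (≤-trans (≤-reflexive (∣nat∣ Λ)) (s≤s (+-mono-≤ Λ≤n Λ≤n))) S≤))))))))) ⟩
    suc (1 + n * 2 + 8 * R + suc (8 * length (delimit Ld) + suc (8 * length (delimit γd) + suc (8 * length (encodeUnary τ) + suc (suc (n + n) + (4 * n + 1))))))
      ≡⟨ arith n R (length (delimit Ld)) (length (delimit γd)) (length (encodeUnary τ)) ⟩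
    8 + 8 * (n + (R + (length (delimit Ld) + (length (delimit γd) + length (encodeUnary τ)))))
      ≤⟨ +-monoʳ-≤ 8 (*-monoʳ-≤ 8 (+-mono-≤ (≤-trans (n≤1+n n) (≤-reflexive (trans (sym (length-unary n)) (cong (length ∘ encodeUnary) (sym (length-tabulate (λ u → tabulate (f u)))))))) (+-monoʳ-≤ R (≤-trans
           (+-monoʳ-≤ (length (delimit Ld)) (+-monoʳ-≤ (length (delimit γd)) (m≤m+n _ (length (encodeBinary Λ))))) (m≤n+m _ (length (encodeBinary (seeds (tabulate (Vec.lookup S)))))))))) ⟩
    8 + 8 * (length (encodeUnary (length (table f))) + (R + (length (encodeBinary (seeds (tabulate (Vec.lookup S)))) + (length (delimit Ld) + (length (delimit γd) + (length (encodeUnary τ) + length (encodeBinary Λ)))))))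
      ≡⟨ cong (λ z → 8 + 8 * z) (sym lengths) ⟩
    8 + 8 * length (encodeCert cert)
      ≡⟨ cong (λ z → 8 + 8 * length z) encode-correct ⟩
    8 + 8 * length (encode I)
      ≡⟨ cong (8 +_) (*-comm 8 (length (encode I))) ⟩
    8 + length (encode I) * 8 ∎
    where
    open ≤-Reasoning
    Ld = toDigits L
    γd = toDigits γ
    R = length (encodeRows (table f))
    arith : ∀ n r a b t → suc (1 + n * 2 + 8 * r + suc (8 * a + suc (8 * b + suc (8 * t + suc (suc (n + n) + (4 * n + 1))))))
      ≡ 8 + 8 * (n + (r + (a + (b + t))))
    arith = solve-∀
    lengths : length (encodeCert cert) ≡ length (encodeUnary (length (table f))) + (R + (length (encodeBinary (seeds (tabulate (Vec.lookup S)))) + (length (delimit Ld) + (length (delimit γd) + (length (encodeUnary τ) + length (encodeBinary Λ))))))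
    lengths = trans (length-++ (encodeUnary (length (table f)))) (cong (length (encodeUnary (length (table f))) +_)
      (trans (length-++ (encodeRows (table f))) (cong (R +_)
      (trans (length-++ (encodeBinary (seeds (tabulate (Vec.lookup S))))) (cong (length (encodeBinary (seeds (tabulate (Vec.lookup S)))) +_)
      (trans (length-++ (delimit Ld)) (cong (length (delimit Ld) +_)
      (trans (length-++ (delimit γd)) (cong (length (delimit γd) +_) (length-++ (encodeUnary τ)))))))))))

  verify-complete : T (verify (pair (encode I) (serialize (enc certTy cert) [])))
  verify-complete = subst (λ X → T (eqBits (delimit (encodeCert X) ++ skipDelimited (pair w c)) (pair w c) ∧ valid X)) (sym cert≡)
    (⇐ (eqBits-correct (delimit (encodeCert cert) ++ skipDelimited (pair w c)) (pair w c))
      (cong₂ (λ x y → delimit x ++ y) encode-correct (skipDelimited-pair w c)) & cert-valid)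
    where
    w = encode I
    c = serialize (enc certTy cert) []
    cert≡ : certificate (pair w c) ≡ cert
    cert≡ = trans (cong (λ z → fn (decodeF certTy) (at leaf (parse z) 0)) (skipDelimited-pair w c))
      (trans (cong (λ z → fn (decodeF certTy) (at leaf z 0)) (parse-serialize (enc certTy cert) [])) (decode-enc certTy cert))

T-BS∈NP : NP T-BS
T-BS∈NP = T ∘ verify , 8 ∷ 8 ∷ [] , Fun-decidable verifyF , λ w → mk⇔
  (λ { (I , refl , S , card , enough) → serialize (enc certTy (Complete.cert I S card enough)) [] ,
       ≤-trans (≤-reflexive (trans (length-serialize (enc certTy (Complete.cert I S card enough)) []) (+-identityʳ _)))
         (≤-trans (cert≤ I S card enough) (≤-reflexive (eval≡ (length (encode I))))) ,
       verify-complete I S card enough })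
  (λ { (c , _ , t) → verify-sound w c t })
  where
  eval≡ : ∀ n → 8 + n * 8 ≡ 8 + n * (8 + n * 0)
  eval≡ = solve-∀

-- Covering by out-neighbours

module _ {n : ℕ} (edge : Fin n → Fin n → Bool) where

  covered : Subset n → Fin n → Bool
  covered S v = any (λ u → edge u v ∧ Vec.lookup S u) (allFin n)

  coverage : Subset n → ℕ
  coverage S = length (filterᵇ (covered S) (allFin n))

module _ (I : Instance) where

  open Instance I

  -- Phrased through what the code of an instance determines, so that it passes to every instance
  -- with the same code.
  Spreading : Set
  Spreading = γ ≡ 1 × τ ≡ 1 × (∀ u v → T (edge u v) → ℤ.∣ ↥ prob u v ∣ ≡ 1 × ↧ₙ prob u v ≤ L)

  module _ (S : Subset n) (v : Fin n) (simple : Spreading) where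

    private
      term : Fin n → ℚᵘ
      term u = prob u v ℚ.* load graph L u 0 S

      total : List (Fin n) → ℚᵘ
      total us = sumℚ (map term (filterᵇ (λ u → edge u v) us))

      unit-numerator : ∀ u → T (edge u v) → ↥ prob u v ≡ ⁺ 1
      unit-numerator u t with prob≥0 u v t
      ... | *≤* le = trans (sym (ℤ.0≤i⇒+∣i∣≡i (subst (⁺ 0 ℤ.≤_) (ℤ.*-identityʳ _) le))) (cong ⁺_ (proj₁ (proj₂ (proj₂ simple) u v t)))

      scaled≥1 : ∀ p → ↥ p ≡ ⁺ 1 → ↧ₙ p ≤ L → 1ℚᵘ ℚ.≤ p ℚ.* fromNat L
      scaled≥1 (mkℚᵘ _ d) refl le = *≤* (subst₂ ℤ._≤_ (sym (ℤ.*-identityˡ _)) (sym (trans (ℤ.*-identityʳ _) (ℤ.*-identityˡ (⁺ L))))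
        (ℤ.+≤+ (≤-trans (≤-reflexive (*-identityʳ (suc d))) le)))

      zero-term : ∀ p → (p ℚ.* 0ℚᵘ) ≃ 0ℚᵘ
      zero-term = ℚ.*-zeroʳ

      1≥0 : 0ℚᵘ ℚ.≤ 1ℚᵘ
      1≥0 = *≤* (ℤ.+≤+ z≤n)

      bounds : ∀ u → T (edge u v) → 0ℚᵘ ℚ.≤ term u × (Vec.lookup S u ≡ true → 1ℚᵘ ℚ.≤ term u) × (Vec.lookup S u ≡ false → term u ℚ.≤ 0ℚᵘ)
      bounds u t with Vec.lookup S u
      ... | true  = ℚ.≤-trans 1≥0 big , (λ _ → big) , λ ()
        where big = scaled≥1 (prob u v) (unit-numerator u t) (proj₂ (proj₂ (proj₂ simple) u v t))
      ... | false = ℚ.≤-reflexive (ℚ.≃-sym (zero-term (prob u v))) , (λ ()) , λ _ → ℚ.≤-reflexive (zero-term (prob u v))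

      total≥0 : ∀ us → 0ℚᵘ ℚ.≤ total us
      total≥0 []       = ℚ.≤-refl
      total≥0 (u ∷ us) with edge u v in eq
      ... | true  = ℚ.+-mono-≤ (proj₁ (bounds u (subst T (sym eq) tt))) (total≥0 us)
      ... | false = total≥0 us

      some : ∀ us → T (any (λ u → edge u v ∧ Vec.lookup S u) us) → 1ℚᵘ ℚ.≤ total us
      some (u ∷ us) t with edge u v in eq
      ... | false = some us t
      ... | true  = pick (Vec.lookup S u) refl t
        where
        pick : ∀ b → Vec.lookup S u ≡ b → T (b ∨ any (λ u → edge u v ∧ Vec.lookup S u) us) → 1ℚᵘ ℚ.≤ term u ℚ.+ total us
        pick true  eq′ _ = ℚ.+-mono-≤ (proj₁ (proj₂ (bounds u (subst T (sym eq) tt))) eq′) (total≥0 us)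
        pick false _   t = ℚ.+-mono-≤ (proj₁ (bounds u (subst T (sym eq) tt))) (some us t)

      none : ∀ us → any (λ u → edge u v ∧ Vec.lookup S u) us ≡ false → total us ℚ.≤ 0ℚᵘ
      none []       _ = ℚ.≤-refl
      none (u ∷ us) t with edge u v in eq
      ... | false = none us t
      ... | true  = pick (Vec.lookup S u) refl t
        where
        pick : ∀ b → Vec.lookup S u ≡ b → b ∨ any (λ u → edge u v ∧ Vec.lookup S u) us ≡ false → term u ℚ.+ total us ℚ.≤ 0ℚᵘ
        pick false eq′ t = ℚ.+-mono-≤ (proj₂ (proj₂ (bounds u (subst T (sym eq) tt))) eq′) (none us t)

    -- There is nothing between 0 and the threshold 1: a seeded in-neighbour alone contributes L / m
    -- with m at most L, and without one every term vanishes.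
    covered⇔ : (fromNat γ ℚ.≤ load graph L v τ S) ⇔ T (covered edge S v)
    covered⇔ = subst₂ (λ g t → (fromNat g ℚ.≤ load graph L v t S) ⇔ T (covered edge S v))
        (sym (proj₁ simple)) (sym (proj₁ (proj₂ simple))) (mk⇔ to (some (allFin n)))
      where
      1≰0 : ¬ 1ℚᵘ ℚ.≤ 0ℚᵘ
      1≰0 (*≤* (ℤ.+≤+ ()))
      to : 1ℚᵘ ℚ.≤ total (allFin n) → T (covered edge S v)
      to le with covered edge S v in eq
      ... | true  = tt
      ... | false = ⊥-elim (1≰0 (ℚ.≤-trans le (none (allFin n) eq)))

  σᵀ-coverage : Spreading → ∀ S → σᵀ graph L γ τ S ≡ coverage edge S
  σᵀ-coverage simple S = length-filter-≐ (λ v → fromNat γ ℚ.≤? load graph L v τ S) (λ v → T? (covered edge S v)) (λ v → covered⇔ S v simple) (allFin n)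

-- Unique readability of instances

SameEntry : Bool → ℚᵘ → Bool → ℚᵘ → Set
SameEntry e p e′ p′ = e ≡ e′ × (T e → ℤ.∣ ↥ p ∣ ≡ ℤ.∣ ↥ p′ ∣ × ↧ₙ p ≡ ↧ₙ p′)

entryCode-prefix : ∀ e p e′ p′ {r s} → entryCode e p ++ r ≡ entryCode e′ p′ ++ s → SameEntry e p e′ p′ × r ≡ s
entryCode-prefix false p false p′ eq = (refl , λ ()) , ∷-injectiveʳ eq
entryCode-prefix true p true p′ {r} {s} eq with encodeBinary-prefix ℤ.∣ ↥ p ∣ ℤ.∣ ↥ p′ ∣
    (trans (sym (++-assoc (encodeBinary ℤ.∣ ↥ p ∣) (encodeBinary (↧ₙ p)) r)) (trans (∷-injectiveʳ eq) (++-assoc (encodeBinary ℤ.∣ ↥ p′ ∣) (encodeBinary (↧ₙ p′)) s)))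
... | num , eq′ with encodeBinary-prefix (↧ₙ p) (↧ₙ p′) eq′
... | den , eq″ = (refl , λ _ → num , den) , eq″

concat-prefix : ∀ {n} (c d : Fin n → List Bool) {P : Fin n → Set} → (∀ i {r s} → c i ++ r ≡ d i ++ s → P i × r ≡ s) →
  ∀ {r s} → concat (tabulate c) ++ r ≡ concat (tabulate d) ++ s → (∀ i → P i) × r ≡ s
concat-prefix {zero}  c d h eq = (λ ()) , eq
concat-prefix {suc n} c d h {r} {s} eq with h zero (trans (sym (++-assoc (c zero) _ r)) (trans eq (++-assoc (d zero) _ s)))
... | p , eq′ with concat-prefix (c ∘ suc) (d ∘ suc) (h ∘ suc) eq′
... | ps , eq″ = (λ { zero → p ; (suc i) → ps i }) , eq″

entriesCode-prefix : ∀ {n} (e e′ : Fin n → Fin n → Bool) p p′ {r s} → entriesCode e p ++ r ≡ entriesCode e′ p′ ++ s →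
  (∀ u v → SameEntry (e u v) (p u v) (e′ u v) (p′ u v)) × r ≡ s
entriesCode-prefix e e′ p p′ = concat-prefix _ _ (λ u → concat-prefix (λ v → entryCode (e u v) (p u v)) (λ v → entryCode (e′ u v) (p′ u v))
  (λ v → entryCode-prefix (e u v) (p u v) (e′ u v) (p′ u v)))

spreadCode : ∀ {n} → (Fin n → Fin n → Bool) → (Fin n → Fin n → ℚᵘ) → (k Λ : ℕ) → List Bool
spreadCode {n} e p k Λ = encodeUnary n ++ entriesCode e p ++ encodeBinary k ++ encodeBinary n ++ encodeBinary 1 ++ encodeUnary 1 ++ encodeBinary Λ

coverage-cong : ∀ {n} (e e′ : Fin n → Fin n → Bool) → (∀ u v → e u v ≡ e′ u v) → ∀ S → coverage e S ≡ coverage e′ S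
coverage-cong {n} e e′ h S = length-filter-≐ (λ v → T? (covered e S v)) (λ v → T? (covered e′ S v)) (λ v → mk⇔ (subst T (eq v)) (subst T (sym (eq v)))) (allFin n)
  where
  eq : ∀ v → covered e S v ≡ covered e′ S v
  eq v = cong or (map-cong (λ u → cong (_∧ Vec.lookup S u) (h u v)) (allFin n))

Coverable : ∀ {n} → (Fin n → Fin n → Bool) → (k Λ : ℕ) → Set
Coverable {n} e k Λ = Σ (Subset n) λ S → Subset.∣ S ∣ ≡ k × coverage e S ≥ Λ

-- The instance behind a member of `T-BS` need not be the constructed one. Reading the code field by
-- field identifies its size, edges and parameters, and its probabilities as far as `Spreading`
-- looks at them.
spread-yes : ∀ {n} (e : Fin n → Fin n → Bool) p k Λ → (∀ u v → T (e u v) → ℤ.∣ ↥ p u v ∣ ≡ 1 × ↧ₙ p u v ≤ n) →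
  T-BS (spreadCode e p k Λ) → Coverable e k Λ
spread-yes {n} e p k Λ h (I@record { graph = record { n = n′ ; edge = e′ ; prob = p′ } } , eq , S , card , enough)
  with encodeUnary-prefix n n′ (trans eq (encode-entries I))
... | refl , eq₁ with entriesCode-prefix e e′ p p′ eq₁
... | same , eq₂ with encodeBinary-prefix k (Instance.k I) eq₂
... | refl , eq₃ with encodeBinary-prefix n (Instance.L I) eq₃
... | L≡ , eq₄ with encodeBinary-prefix 1 (Instance.γ I) eq₄
... | γ≡ , eq₅ with encodeUnary-prefix 1 (Instance.τ I) eq₅
... | τ≡ , eq₆ with encodeBinary-prefix Λ (Instance.Λ I) {[]} {[]} (cong (_++ []) eq₆)
... | refl , _ = S , card , subst (_≥ Λ) (trans (σᵀ-coverage I simple S) (coverage-cong e′ e (λ u v → sym (proj₁ (same u v))) S)) enough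
  where
  simple : Spreading I
  simple = sym γ≡ , sym τ≡ , λ u v t →
    let t′ = subst T (sym (proj₁ (same u v))) t
        num , den = proj₂ (same u v) t′
        one′ , le = h u v t′
    in trans (sym num) one′ , ≤-trans (≤-reflexive (sym den)) (≤-trans le (≤-reflexive L≡))

-- Counting elements of lists

count : ∀ {X : Set} → (X → Bool) → List X → ℕ
count p xs = length (filterᵇ p xs)

count-∷ : ∀ {X : Set} (p : X → Bool) x xs → count p (x ∷ xs) ≡ (if p x then 1 else 0) + count p xs
count-∷ p x xs with p x
... | true  = refl
... | false = refl

count-++ : ∀ {X : Set} (p : X → Bool) xs ys → count p (xs ++ ys) ≡ count p xs + count p ys
count-++ p xs ys = trans (cong length (filter-++ (T? ∘ p) xs ys)) (length-++ (filterᵇ p xs))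

count-map : ∀ {X Y : Set} (p : Y → Bool) (f : X → Y) xs → count p (map f xs) ≡ count (p ∘ f) xs
count-map p f []       = refl
count-map p f (x ∷ xs) = trans (count-∷ p (f x) (map f xs)) (trans (cong ((if p (f x) then 1 else 0) +_) (count-map p f xs)) (sym (count-∷ (p ∘ f) x xs)))

count-none : ∀ {X : Set} (xs : List X) → count (λ _ → false) xs ≡ 0
count-none []       = refl
count-none (x ∷ xs) = count-none xs

count-all : ∀ {X : Set} (xs : List X) → count (λ _ → true) xs ≡ length xs
count-all []       = refl
count-all (x ∷ xs) = cong suc (count-all xs)

count-mono : ∀ {X : Set} (p q : X → Bool) → (∀ x → T (p x) → T (q x)) → ∀ xs → count p xs ≤ count q xs
count-mono p q h []       = z≤n
count-mono p q h (x ∷ xs) with p x | q x | h x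
... | true  | true  | _ = s≤s (count-mono p q h xs)
... | true  | false | f = ⊥-elim (f tt)
... | false | true  | _ = m≤n⇒m≤1+n (count-mono p q h xs)
... | false | false | _ = count-mono p q h xs

-- Applied with `p` for being covered and `q` for being a target: if the threshold is the number of
-- targets, reaching it leaves no target uncovered.
count-full : ∀ {X : Set} (p q : X → Bool) → (∀ x → T (p x) → T (q x)) → ∀ xs → count q xs ≤ count p xs → ∀ {x} → x ∈ xs → T (q x) → T (p x)
count-full p q h (x ∷ xs) le m t with p x in eq | q x in eq′ | h x
count-full p q h (x ∷ xs) le (here refl) t | true  | _     | _ = subst T (sym eq) tt
count-full p q h (x ∷ xs) le (here refl) t | false | true  | _ = ⊥-elim (<⇒≱ (s≤s (count-mono p q h xs)) le)
count-full p q h (x ∷ xs) le (here refl) t | false | false | _ = ⊥-elim (subst T eq′ t)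
count-full p q h (x ∷ xs) le (there m) t | true  | true  | _ = count-full p q h xs (s≤s⁻¹ le) m t
count-full p q h (x ∷ xs) le (there m) t | true  | false | f = ⊥-elim (f tt)
count-full p q h (x ∷ xs) le (there m) t | false | true  | _ = count-full p q h xs (≤-trans (n≤1+n _) le) m t
count-full p q h (x ∷ xs) le (there m) t | false | false | _ = count-full p q h xs le m t

count-upTo : ∀ {d k} → k < d → count (_≡ᵇ k) (upTo d) ≡ 1
count-upTo {suc d} {zero}  _ = trans (cong suc (trans (cong (count (_≡ᵇ 0)) (sym (map-upTo suc d))) (trans (count-map (_≡ᵇ 0) suc (upTo d)) (count-none (upTo d))))) refl
count-upTo {suc d} {suc k} (s≤s lt) = trans (cong (count (_≡ᵇ suc k)) (sym (map-upTo suc d))) (trans (count-map (_≡ᵇ suc k) suc (upTo d)) (count-upTo lt))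

map-lookup-allFin : ∀ {X Y : Set} (f : X → Y) xs → map (f ∘ lookup xs) (allFin (length xs)) ≡ map f xs
map-lookup-allFin f xs = trans (map-tabulate id (f ∘ lookup xs)) (trans (sym (map-tabulate (lookup xs) f)) (cong (map f) (tabulate-lookup xs)))

count-lookup : ∀ {X : Set} (p : X → Bool) xs → count (p ∘ lookup xs) (allFin (length xs)) ≡ count p xs
count-lookup p xs = trans (sym (count-map p (lookup xs) (allFin (length xs)))) (cong (count p) (trans (map-lookup-allFin id xs) (map-id xs)))

-- From clauses to graphs

-- A node is a product and not a sum, since `Ty` has products only. The two flags tell literals, the
-- sink and clauses apart, with dummies in the remaining fields.
Lit Clause Node : Set
Lit = ℕ × ℕ × ℕ
Clause = List Lit
Node = Bool × Bool × Lit × Clause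

variable-of : Lit → ℕ × ℕ
variable-of (t , x , _) = t , x

value-of : Lit → ℕ
value-of (_ , _ , a) = a

literal : ℕ × ℕ → ℕ → Lit
literal (t , x) a = t , x , a

literalNode : Lit → Node
literalNode l = true , false , l , []

clauseNode : Clause → Node
clauseNode c = false , false , (0 , 0 , 0) , c

sinkNode : Node
sinkNode = false , true , (0 , 0 , 0) , []

isLiteral isSink : Node → Bool
isLiteral = proj₁
isSink = proj₁ ∘ proj₂

literalAt : Node → Lit
literalAt = proj₁ ∘ proj₂ ∘ proj₂

clauseAt : Node → Clause
clauseAt = proj₂ ∘ proj₂ ∘ proj₂

eqLit : Lit → Lit → Bool
eqLit (t , x , a) (t′ , x′ , a′) = (t ≡ᵇ t′) ∧ (x ≡ᵇ x′) ∧ (a ≡ᵇ a′)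

memLit : Lit → Clause → Bool
memLit l = any (eqLit l)

-- The sink receives an arc from every node, itself included; hence all out-degrees are positive and
-- equal probabilities can be normalized. No arc enters a literal.
arc : Node → Node → Bool
arc u v = not (isLiteral v) ∧ (isSink v ∨ (isLiteral u ∧ memLit (literalAt u) (clauseAt v)))

eqLit-correct : ∀ l m → T (eqLit l m) ⇔ l ≡ m
eqLit-correct (t , x , a) (t′ , x′ , a′) = mk⇔
  (λ p → let p₁ , q = ⇒ (T-∧ {t ≡ᵇ t′}) p
             p₂ , p₃ = ⇒ (T-∧ {x ≡ᵇ x′}) q
         in cong₂ _,_ (≡ᵇ⇒≡ t t′ p₁) (cong₂ _,_ (≡ᵇ⇒≡ x x′ p₂) (≡ᵇ⇒≡ a a′ p₃)))
  (λ { refl → ≡⇒≡ᵇ t t refl & ≡⇒≡ᵇ x x refl & ≡⇒≡ᵇ a a refl })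

memLit-correct : ∀ l c → T (memLit l c) ⇔ l ∈ c
memLit-correct l c = mk⇔ (λ t → Any.map (λ {m} → ⇒ (eqLit-correct l m)) (any⁻ (eqLit l) c t)) (λ p → any⁺ (eqLit l) (Any.map (λ {m} → ⇐ (eqLit-correct l m)) p))

nodes : List Lit → List Clause → List Node
nodes lits cs = map literalNode lits ++ map clauseNode cs ++ sinkNode ∷ []

outdegree : List Node → Node → ℕ
outdegree ns u = count (arc u) ns

arcCode : List Node → Node → Node → List Bool
arcCode ns u v = if arc u v then true ∷ (encodeBinary 1 ++ encodeBinary (outdegree ns u)) else false ∷ []

graphCode : List Node → (k Λ : ℕ) → List Bool
graphCode ns k Λ = encodeUnary (length ns) ++ concat (map (λ u → concat (map (arcCode ns u) ns)) ns) ++ encodeBinary k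
  ++ encodeBinary (length ns) ++ encodeBinary 1 ++ encodeUnary 1 ++ encodeBinary Λ

module _ (ns : List Node) (positive : ∀ u → 0 < outdegree ns u) where

  arcᴳ : Fin (length ns) → Fin (length ns) → Bool
  arcᴳ u v = arc (lookup ns u) (lookup ns v)

  private
    n = length ns
    outdeg : Fin n → ℕ
    outdeg u = outdegree ns (lookup ns u)
    prob : Fin n → Fin n → ℚᵘ
    prob u v = mkℚᵘ (⁺ 1) (pred (outdeg u))
    denominator≡ : ∀ u → suc (pred (outdeg u)) ≡ outdeg u
    denominator≡ u with outdeg u | positive (lookup ns u)
    ... | suc _ | _ = refl
    tabulate-map : ∀ {Y : Set} (f : Node → Y) → map f ns ≡ tabulate (f ∘ lookup ns)
    tabulate-map f = trans (cong (map f) (sym (tabulate-lookup ns))) (map-tabulate (lookup ns) f)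

  graphCode-spread : ∀ k Λ → graphCode ns k Λ ≡ spreadCode arcᴳ prob k Λ
  graphCode-spread k Λ = cong (λ z → encodeUnary n ++ concat z ++ encodeBinary k ++ encodeBinary n ++ encodeBinary 1 ++ encodeUnary 1 ++ encodeBinary Λ)
    (trans (tabulate-map _) (tabulate-cong λ u → cong concat (trans (tabulate-map _) (tabulate-cong λ v →
      cong (λ d → if arcᴳ u v then true ∷ (encodeBinary 1 ++ encodeBinary d) else false ∷ []) (sym (denominator≡ u))))))

  private
    outdeg≤n : ∀ u → suc (pred (outdeg u)) ≤ n
    outdeg≤n u = ≤-trans (≤-reflexive (denominator≡ u)) (length-filter (T? ∘ arc (lookup ns u)) ns)

    norm : ∀ u → sumℚ (map (λ v → prob u v) (filterᵇ (λ w → arcᴳ u w) (allFin n))) ≃ 1ℚᵘ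
    norm u = ⇐ (≈-one (positive (lookup ns u)) (≈-sum (outdeg u) (arcᴳ u) (prob u) (λ v → if arcᴳ u v then 1 else 0)
        unit (λ v eq → cong (λ b → if b then 1 else 0) eq) (allFin n)))
      (trans (count-sum (allFin n)) (count-lookup (arc (lookup ns u)) ns))
      where
      unit : ∀ v → T (arcᴳ u v) → prob u v ≈[ outdeg u ] (if arcᴳ u v then 1 else 0)
      unit v t with arcᴳ u v
      ... | true = cross (cong (λ d → ⁺ 1 ℤ.* ⁺ d) (sym (denominator≡ u)))
      count-sum : ∀ vs → sum (map (λ v → if arcᴳ u v then 1 else 0) vs) ≡ count (arcᴳ u) vs
      count-sum []       = refl
      count-sum (v ∷ vs) = trans (cong ((if arcᴳ u v then 1 else 0) +_) (count-sum vs)) (sym (count-∷ (arcᴳ u) v vs))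

  graphCode-yes : ∀ k Λ → 0 < k → k < n → 0 < Λ → Λ ≤ n → T-BS (graphCode ns k Λ) ⇔ Coverable arcᴳ k Λ
  graphCode-yes k Λ 0<k k<n 0<Λ Λ≤n = mk⇔
    (λ t → spread-yes arcᴳ prob k Λ (λ u v _ → refl , outdeg≤n u) (subst T-BS (graphCode-spread k Λ) t))
    (λ { (S , card , enough) → I , trans (graphCode-spread k Λ) (sym (encode-entries I)) , S , card ,
         subst (_≥ Λ) (sym (σᵀ-coverage I (refl , refl , λ u v _ → refl , outdeg≤n u) S)) enough })
    where
    I : Instance
    I = record
      { graph = record
        { n = n ; edge = arcᴳ ; prob = prob
        ; prob≥0 = λ u v _ → *≤* (ℤ.+≤+ z≤n)
        ; prob≤1 = λ u v _ → *≤* (subst (⁺ 1 ℤ.≤_) (sym (ℤ.*-identityˡ _)) (ℤ.+≤+ (s≤s z≤n)))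
        ; normalized = norm }
      ; k = k ; L = n ; γ = 1 ; τ = 1 ; Λ = Λ
      ; 0<k = 0<k ; k<n = k<n ; L≥1 = ≤-trans 0<k (<⇒≤ k<n) ; 0<γ = ≤-refl ; τ≥1 = ≤-refl ; 0<Λ = 0<Λ ; Λ≤n = Λ≤n }

-- Choosing one value for each variable so as to satisfy all clauses

unique-length : ∀ {n} {S : Subset n} {us} → Unique us → All (Subset._∈ S) us → length us ≤ Subset.∣ S ∣
unique-length []       []       = z≤n
unique-length {S = S} {u ∷ us} (u∉ ∷ uq) (p ∷ ps) = ≤-trans (s≤s (unique-length uq (rest u∉ ps))) (Subset.x∈p⇒∣p-x∣<∣p∣ p)
  where
  rest : ∀ {us} → All (u ≢_) us → All (Subset._∈ S) us → All (Subset._∈ (S Subset.- u)) us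
  rest []       []       = []
  rest (q ∷ qs) (r ∷ rs) = Subset.x∈p∧x≢y⇒x∈p-y r (q ∘ sym) ∷ rest qs rs

pigeonhole : ∀ {n} {S : Subset n} {us} → Unique us → All (Subset._∈ S) us → length us ≡ Subset.∣ S ∣ → ∀ {u} → u Subset.∈ S → u ∈ us
pigeonhole {us = us} uq ins len {u} u∈S with Any.any? (u Fin.≟_) us
... | yes p = p
... | no ¬p = ⊥-elim (<⇒≱ (≤-reflexive (cong suc (sym len))) (unique-length (All.¬Any⇒All¬ us ¬p ∷ uq) (u∈S ∷ ins)))

module Assignment (vars : List (ℕ × ℕ)) (unique : Unique vars) (d : ℕ) (others : List Clause) where

  choices : ℕ × ℕ → Clause
  choices v = map (literal v) (upTo d)

  literals : List Lit
  literals = concat (map choices vars)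

  clauses : List Clause
  clauses = map choices vars ++ others

  graph : List Node
  graph = nodes literals clauses

  -- The clauses `choices` need no mention here: `α v < d` says as much.
  Satisfiable : Set
  Satisfiable = ∃ λ (α : ℕ × ℕ → ℕ) → (∀ {v} → v ∈ vars → α v < d) ×
    (∀ {c} → c ∈ others → ∃ λ v → v ∈ vars × literal v (α v) ∈ c)

  private
    N : ℕ
    N = length graph

    key : Fin N → Node
    key = lookup graph

    target : Node → Bool
    target = not ∘ isLiteral

    edge : Fin N → Fin N → Bool
    edge u v = arc (key u) (key v)

    node-index : ∀ {x} → x ∈ graph → ∃ λ u → key u ≡ x
    node-index p = index p , sym (lookup-index p)

    clause∈ : ∀ {c} → c ∈ clauses → clauseNode c ∈ graph
    clause∈ p = ∈-++⁺ʳ (map literalNode literals) (∈-++⁺ˡ (∈-map⁺ clauseNode p))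

    sink∈ : sinkNode ∈ graph
    sink∈ = ∈-++⁺ʳ (map literalNode literals) (∈-++⁺ʳ (map clauseNode clauses) (here refl))

    targets : count target graph ≡ suc (length clauses)
    targets = trans (count-++ target (map literalNode literals) _) (trans (cong₂ _+_
      (trans (count-map target literalNode literals) (count-none literals))
      (trans (count-++ target (map clauseNode clauses) _) (cong (_+ 1) (trans (count-map target clauseNode clauses) (count-all clauses)))))
      (+-comm (length clauses) 1))

    Chosen : Subset N → Fin N → Set
    Chosen S u = u Subset.∈ S × T (isLiteral (key u))

    covered-witness : ∀ S v → T (covered edge S v) → ∃ λ u → T (edge u v) × u Subset.∈ S
    covered-witness S v t with find (any⁻ (λ u → edge u v ∧ Vec.lookup S u) (allFin N) t)
    ... | u , _ , p = let q , r = ⇒ (T-∧ {edge u v}) p in u , q , Vec.lookup⇒[]= u S (T⇒≡ r)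
      where T⇒≡ : ∀ {b} → T b → b ≡ true
            T⇒≡ {true} _ = refl

    witness-covered : ∀ S v u → T (edge u v) → T (Vec.lookup S u) → T (covered edge S v)
    witness-covered S v u p q = any⁺ (λ u → edge u v ∧ Vec.lookup S u) (lose (∈-allFin u) (p & q))

  outdegree-positive : ∀ u → 0 < outdegree graph u
  outdegree-positive u = go graph sink∈
    where
    go : ∀ ns → sinkNode ∈ ns → 0 < count (arc u) ns
    go (_ ∷ ns) (here refl) = s≤s z≤n
    go (x ∷ ns) (there p) = ≤-trans (go ns p) (≤-trans (m≤n+m _ _) (≤-reflexive (sym (count-∷ (arc u) x ns))))

  module _ (S : Subset N) (card : Subset.∣ S ∣ ≡ length vars) (enough : coverage edge S ≥ suc (length clauses)) where

    private
      -- Only clauses and the sink can be covered, and the threshold equals their number.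
      all-covered : ∀ v → T (target (key v)) → T (covered edge S v)
      all-covered v = count-full (covered edge S) (target ∘ key)
        (λ v t → let u , e , _ = covered-witness S v t in proj₁ (⇒ (T-∧ {not (isLiteral (key v))}) e))
        (allFin N) (≤-trans (≤-reflexive (trans (count-lookup target graph) targets)) enough) (∈-allFin v)

      clause-covered : ∀ {c} → c ∈ clauses → ∃ λ u → Chosen S u × literalAt (key u) ∈ c
      clause-covered {c} p with node-index (clause∈ p)
      ... | v , eq with covered-witness S v (all-covered v (subst (T ∘ target) (sym eq) tt))
      ... | u , e , u∈S = let i , m = ⇒ (T-∧ {isLiteral (key u)}) (subst (T ∘ arc (key u)) eq e)
                          in u , (u∈S , i) , ⇒ (memLit-correct (literalAt (key u)) c) m

      lit : Fin N → Lit
      lit = literalAt ∘ key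

      chosen : All (λ v → ∃ λ u → u Subset.∈ S × variable-of (lit u) ≡ v × value-of (lit u) < d) vars
      chosen = All.tabulate λ {v} p →
        let u , (u∈S , _) , m = clause-covered (∈-++⁺ˡ (∈-map⁺ choices p))
            a , a∈ , eq = ∈-map⁻ (literal v) m
        in u , u∈S , cong variable-of eq , subst (_< d) (sym (cong value-of eq)) (∈-upTo⁻ a∈)

      nodesOf : ∀ {vs} → All (λ v → ∃ λ u → u Subset.∈ S × variable-of (lit u) ≡ v × value-of (lit u) < d) vs → List (Fin N)
      nodesOf []            = []
      nodesOf ((u , _) ∷ p) = u ∷ nodesOf p

      us : List (Fin N)
      us = nodesOf chosen

      nodesOf-vars : ∀ {vs} (p : All _ vs) → map (variable-of ∘ lit) (nodesOf p) ≡ vs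
      nodesOf-vars []                        = refl
      nodesOf-vars ((u , _ , refl , _) ∷ p) = cong (_ ∷_) (nodesOf-vars p)

      nodesOf-∈ : ∀ {vs} (p : All _ vs) → All (Subset._∈ S) (nodesOf p)
      nodesOf-∈ []                    = []
      nodesOf-∈ ((u , u∈S , _) ∷ p) = u∈S ∷ nodesOf-∈ p

      nodesOf-< : ∀ {vs} (p : All _ vs) → All (λ u → value-of (lit u) < d) (nodesOf p)
      nodesOf-< []                        = []
      nodesOf-< ((u , _ , _ , lt) ∷ p) = lt ∷ nodesOf-< p

      vars≡ : map (variable-of ∘ lit) us ≡ vars
      vars≡ = nodesOf-vars chosen

      unique-us : Unique (map (variable-of ∘ lit) us)
      unique-us = subst Unique (sym vars≡) unique

      _≟ᵛ_ : (v w : ℕ × ℕ) → Dec (v ≡ w)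
      _≟ᵛ_ = Product.≡-dec _≟_ _≟_

      value : List (Fin N) → ℕ × ℕ → ℕ
      value []       v = 0
      value (u ∷ us) v with variable-of (lit u) ≟ᵛ v
      ... | yes _ = value-of (lit u)
      ... | no  _ = value us v

      value-correct : ∀ us → Unique (map (variable-of ∘ lit) us) → ∀ {u} → u ∈ us → value us (variable-of (lit u)) ≡ value-of (lit u)
      value-correct (w ∷ us) (w∉ ∷ uq) {u} p with variable-of (lit w) ≟ᵛ variable-of (lit u)
      value-correct (w ∷ us) (w∉ ∷ uq) (here refl) | yes _  = refl
      value-correct (w ∷ us) (w∉ ∷ uq) (there p)   | yes eq = ⊥-elim (All.lookup w∉ (∈-map⁺ (variable-of ∘ lit) p) eq)
      value-correct (w ∷ us) (w∉ ∷ uq) (here refl) | no ¬eq = ⊥-elim (¬eq refl)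
      value-correct (w ∷ us) (w∉ ∷ uq) (there p)   | no ¬eq = value-correct us uq p

      -- The seeds found for the clauses `choices` have distinct variables, hence are distinct, and
      -- there are as many of them as seeds in all. So no clause can be covered by a second value of
      -- some variable.
      all-us : ∀ {u} → u Subset.∈ S → u ∈ us
      all-us = pigeonhole (Unique.map⁻ unique-us) (nodesOf-∈ chosen) (trans (trans (sym (length-map (variable-of ∘ lit) us)) (cong length vars≡)) (sym card))

    coverable-satisfiable : Satisfiable
    coverable-satisfiable = value us ,
      (λ {v} p → let u , u∈ , eq = ∈-map⁻ (variable-of ∘ lit) (subst (v ∈_) (sym vars≡) p)
                 in subst (_< d) (sym (trans (cong (value us) eq) (value-correct us unique-us u∈))) (All.lookup (nodesOf-< chosen) u∈)) ,
      (λ {c} p → let u , (u∈S , _) , m = clause-covered (∈-++⁺ʳ (map choices vars) p)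
                     u∈ = all-us u∈S
                 in variable-of (lit u) , subst (variable-of (lit u) ∈_) vars≡ (∈-map⁺ (variable-of ∘ lit) u∈) ,
                    subst (λ a → literal (variable-of (lit u)) a ∈ c) (sym (value-correct us unique-us u∈)) m)

  module _ (α : ℕ × ℕ → ℕ) (α<d : ∀ {v} → v ∈ vars → α v < d) (sat : ∀ {c} → c ∈ others → ∃ λ v → v ∈ vars × literal v (α v) ∈ c) {v₀ : ℕ × ℕ} (v₀∈ : v₀ ∈ vars) where

    private
      selected : Node → Bool
      selected x = isLiteral x ∧ (value-of (literalAt x) ≡ᵇ α (variable-of (literalAt x)))

      S : Subset N
      S = Vec.tabulate (selected ∘ key)

      S-lookup : ∀ u → Vec.lookup S u ≡ selected (key u)
      S-lookup = Vec.lookup∘tabulate (selected ∘ key)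

      count-choices : ∀ {v} → v ∈ vars → count (selected ∘ literalNode) (choices v) ≡ 1
      count-choices {v} p = trans (count-map (selected ∘ literalNode) (literal v) (upTo d)) (count-upTo (α<d p))

      count-literals : ∀ vs → (∀ {v} → v ∈ vs → v ∈ vars) → count (selected ∘ literalNode) (concat (map choices vs)) ≡ length vs
      count-literals []       h = refl
      count-literals (v ∷ vs) h = trans (count-++ (selected ∘ literalNode) (choices v) _) (cong₂ _+_ (count-choices (h (here refl))) (count-literals vs (h ∘ there)))

      card : Subset.∣ S ∣ ≡ length vars
      card = trans (sym (seeds-∣∣ S)) (trans (cong seeds (tabulate-cong S-lookup)) (trans (cong seeds (sym (map-tabulate id (selected ∘ key))))
        (trans (count-map id (selected ∘ key) (allFin N)) (trans (count-lookup selected graph)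
        (trans (count-++ selected (map literalNode literals) _) (trans (cong₂ _+_
          (trans (count-map selected literalNode literals) (count-literals vars id))
          (trans (count-++ selected (map clauseNode clauses) _) (cong (_+ 0) (trans (count-map selected clauseNode clauses) (count-none clauses)))))
          (+-identityʳ _)))))))

      literal-node : ∀ {v} → v ∈ vars → ∃ λ u → key u ≡ literalNode (literal v (α v)) × T (Vec.lookup S u)
      literal-node {v} p with node-index (∈-++⁺ˡ (∈-map⁺ literalNode (∈-concat⁺′ (∈-map⁺ (literal v) (∈-upTo⁺ (α<d p))) (∈-map⁺ choices p))))
      ... | u , eq = u , eq , subst T (sym (trans (S-lookup u) (cong selected eq))) (≡⇒≡ᵇ (α v) (α v) refl)

      clause-sat : ∀ {c} → c ∈ clauses → ∃ λ v → v ∈ vars × literal v (α v) ∈ c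
      clause-sat p with ∈-++⁻ (map choices vars) p
      ... | inj₂ q = sat q
      ... | inj₁ q with ∈-map⁻ choices q
      ...   | v , v∈ , refl = v , v∈ , ∈-map⁺ (literal v) (∈-upTo⁺ (α<d v∈))

      target-covered : ∀ w → T (target (key w)) → T (covered edge S w)
      target-covered w t with ∈-++⁻ (map literalNode literals) (∈-lookup {xs = graph} w)
      ... | inj₁ p with ∈-map⁻ literalNode p
      ...   | l , _ , eq = ⊥-elim (subst (T ∘ target) eq t)
      target-covered w t | inj₂ q with ∈-++⁻ (map clauseNode clauses) q
      ... | inj₁ p with ∈-map⁻ clauseNode p
      ...   | c , c∈ , eq with clause-sat c∈
      ...     | v , v∈ , m with literal-node v∈
      ...       | u , eq′ , s = witness-covered S w u (subst₂ (λ x y → T (arc x y)) (sym eq′) (sym eq) (⇐ (memLit-correct (literal v (α v)) c) m)) s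
      -- Any seed covers the sink; the variable `v₀` guarantees that there is one.
      target-covered w t | inj₂ q | inj₂ (here eq) with literal-node v₀∈
      ... | u , _ , s = witness-covered S w u (subst (T ∘ arc (key u)) (sym eq) tt) s

    satisfiable-coverable : Coverable edge (length vars) (suc (length clauses))
    satisfiable-coverable = S , card , ≤-trans (≤-reflexive (sym (trans (count-lookup target graph) targets)))
      (count-mono (target ∘ key) (covered edge S) target-covered (allFin N))

  reduction-correct : ∀ {v₀} → v₀ ∈ vars → T-BS (graphCode graph (length vars) (suc (length clauses))) ⇔ Satisfiable
  reduction-correct {v₀} v₀∈ = mk⇔
    (λ t → let S , card , enough = ⇒ yes⇔ t in coverable-satisfiable S card enough)
    (λ { (α , α<d , sat) → ⇐ yes⇔ (satisfiable-coverable α α<d sat v₀∈) })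
    where
    vars>0 : 0 < length vars
    vars>0 = nonempty-list v₀∈
      where nonempty-list : ∀ {v : ℕ × ℕ} {vs} → v ∈ vs → 0 < length vs
            nonempty-list (here _)  = s≤s z≤n
            nonempty-list (there _) = s≤s z≤n
    N≡ : N ≡ length literals + suc (length clauses)
    N≡ = trans (length-++ (map literalNode literals)) (cong₂ _+_ (length-map literalNode literals)
      (trans (length-++ (map clauseNode clauses)) (trans (cong (_+ 1) (length-map clauseNode clauses)) (+-comm (length clauses) 1))))
    -- Each variable has a clause of its own. With the sink this gives k < n, as instances require.
    vars≤ : length vars ≤ length clauses
    vars≤ = ≤-trans (≤-reflexive (sym (length-map choices vars))) (≤-trans (m≤m+n _ _) (≤-reflexive (sym (length-++ (map choices vars)))))
    Λ≤N : suc (length clauses) ≤ N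
    Λ≤N = ≤-trans (m≤n+m _ (length literals)) (≤-reflexive (sym N≡))
    yes⇔ = graphCode-yes graph outdegree-positive (length vars) (suc (length clauses)) vars>0 (≤-trans (s≤s vars≤) Λ≤N) (s≤s z≤n) Λ≤N

-- Positions in lists

at-++ˡ : ∀ {X : Set} {d : X} xs {ys i} → i < length xs → at d (xs ++ ys) i ≡ at d xs i
at-++ˡ (x ∷ xs) {i = zero}  lt       = refl
at-++ˡ (x ∷ xs) {i = suc i} (s≤s lt) = at-++ˡ xs lt

at-++ʳ : ∀ {X : Set} {d : X} xs {ys i} → at d (xs ++ ys) (length xs + i) ≡ at d ys i
at-++ʳ []       = refl
at-++ʳ (x ∷ xs) = at-++ʳ xs

at-map : ∀ {X Y : Set} (f : X → Y) {d : X} xs i → at (f d) (map f xs) i ≡ f (at d xs i)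
at-map f []       i       = refl
at-map f (x ∷ xs) zero    = refl
at-map f (x ∷ xs) (suc i) = at-map f xs i

at-default : ∀ {X : Set} {d : X} xs {i} → length xs ≤ i → at d xs i ≡ d
at-default []       le       = refl
at-default (x ∷ xs) (s≤s le) = at-default xs le

at-replicate : ∀ {X : Set} {d y : X} n {i} → i < n → at d (replicate n y) i ≡ y
at-replicate (suc n) {zero}  lt       = refl
at-replicate (suc n) {suc i} (s≤s lt) = at-replicate n lt

at-replicate-default : ∀ {X : Set} (d : X) n i → at d (replicate n d) i ≡ d
at-replicate-default d zero    i       = refl
at-replicate-default d (suc n) zero    = refl
at-replicate-default d (suc n) (suc i) = at-replicate-default d n i

at-index : ∀ {X : Set} {d y : X} {xs} (p : y ∈ xs) → at d xs (toℕ (index p)) ≡ y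
at-index (here refl) = refl
at-index (there p)   = at-index p

-- Head-relative tableaux: cell T holds what the heads read.

module Tableau (M : TM) where

  open TM M

  -- With all heads aligned, a column holds one symbol of each tape. The flag marks the head column
  -- and the state is repeated in every cell. When a head moves, the whole tape shifts, so every
  -- cell depends on the transition read in the head cell.
  Cell : Set
  Cell = Bool × Fin states × Vec (Symbol extra) (suc workTapes)

  startCell : Bool → Symbol extra → Cell
  startCell h s = h , start , s Vec.∷ Vec.replicate workTapes blank

  abstract

    allSymbols : List (Symbol extra)
    allSymbols = blank ∷ bit false ∷ bit true ∷ map aux (allFin extra)

    allVecs : ∀ m → List (Vec (Symbol extra) m)
    allVecs zero    = Vec.[] ∷ []
    allVecs (suc m) = cartesianProductWith Vec._∷_ allSymbols (allVecs m)

    allCells : List Cell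
    allCells = cartesianProduct (true ∷ false ∷ []) (cartesianProduct (allFin states) (allVecs (suc workTapes)))

    ∈-allSymbols : ∀ s → s ∈ allSymbols
    ∈-allSymbols blank       = here refl
    ∈-allSymbols (bit false) = there (here refl)
    ∈-allSymbols (bit true)  = there (there (here refl))
    ∈-allSymbols (aux a)     = there (there (there (∈-map⁺ aux (∈-allFin a))))

    ∈-allVecs : ∀ {m} (v : Vec (Symbol extra) m) → v ∈ allVecs m
    ∈-allVecs Vec.[]      = here refl
    ∈-allVecs (s Vec.∷ v) = ∈-cartesianProductWith⁺ Vec._∷_ (∈-allSymbols s) (∈-allVecs v)

    ∈-allCells : ∀ c → c ∈ allCells
    ∈-allCells (h , q , v) = ∈-cartesianProduct⁺ (∈-bools h) (∈-cartesianProduct⁺ (∈-allFin q) (∈-allVecs v))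
      where
      ∈-bools : ∀ h → h ∈ (true ∷ false ∷ [])
      ∈-bools true  = here refl
      ∈-bools false = there (here refl)

    -- The enumeration stays opaque: the tableau knows it through `cellOf-code` and `code<values`
    -- only.
    values : ℕ
    values = length allCells

    code : Cell → ℕ
    code c = toℕ (index (∈-allCells c))

    cellOf : ℕ → Cell
    cellOf = at (startCell false blank) allCells

    cellOf-code : ∀ c → cellOf (code c) ≡ c
    cellOf-code c = at-index (∈-allCells c)

    code<values : ∀ c → code c < values
    code<values c = Fin.toℕ<n (index (∈-allCells c))

  private
    Γ : Set
    Γ = Symbol extra

  -- The symbol that a move brings to a position from its left, from itself or
  -- from its right; the flags tell which of the three the head has written on.
  arriving : Γ × Move → Bool × Γ → Bool × Γ → Bool × Γ → Γ
  arriving (y , left)  (h , s) _ _ = if h then y else s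
  arriving (y , stay)  _ (h , s) _ = if h then y else s
  arriving (y , right) _ _ (h , s) = if h then y else s

  -- A halted configuration repeats itself, so the verdict can be read in the last row however early
  -- the run ends.
  apply : Maybe (Fin states × Vec (Γ × Move) (suc workTapes)) → (l m r : Cell) → Cell
  apply nothing            l m r = m
  apply (just (q , acts)) (hl , _ , l) (hm , _ , m) (hr , _ , r) = hm , q ,
    Vec.tabulate λ j → arriving (Vec.lookup acts j) (hl , Vec.lookup l j) (hm , Vec.lookup m j) (hr , Vec.lookup r j)

  evolve : (c l m r : Cell) → Cell
  evolve (_ , q , s) = apply (δ q s)

  cellAt : ℕ → Tape extra → ℕ → Γ
  cellAt zero    (tape ls x rs) zero    = x
  cellAt zero    (tape ls x rs) (suc n) = at blank rs n
  cellAt (suc T) (tape ls x rs) zero    = at blank ls T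
  cellAt (suc T) tp             (suc n) = cellAt T tp n

  cellAt-head : ∀ T tp → cellAt T tp T ≡ Tape.current tp
  cellAt-head zero    tp = refl
  cellAt-head (suc T) tp = cellAt-head T tp

  cellAt-write : ∀ T ls x y rs n → cellAt T (tape ls y rs) n ≡ (if n ≡ᵇ T then y else cellAt T (tape ls x rs) n)
  cellAt-write zero    ls x y rs zero    = refl
  cellAt-write zero    ls x y rs (suc n) = refl
  cellAt-write (suc T) ls x y rs zero    = refl
  cellAt-write (suc T) ls x y rs (suc n) = cellAt-write T ls x y rs n

  cellAt-right : ∀ T tp n → cellAt T (moveHead right tp) n ≡ cellAt T tp (suc n)
  cellAt-right zero          (tape ls x [])       zero    = refl
  cellAt-right zero          (tape ls x (r ∷ rs)) zero    = refl
  cellAt-right zero          (tape ls x [])       (suc n) = refl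
  cellAt-right zero          (tape ls x (r ∷ rs)) (suc n) = refl
  cellAt-right (suc zero)    (tape ls x [])       zero    = refl
  cellAt-right (suc zero)    (tape ls x (r ∷ rs)) zero    = refl
  cellAt-right (suc (suc T)) (tape ls x [])       zero    = refl
  cellAt-right (suc (suc T)) (tape ls x (r ∷ rs)) zero    = refl
  cellAt-right (suc T)       tp                   (suc n) = cellAt-right T tp n

  cellAt-left : ∀ T tp n → cellAt T (moveHead left tp) (suc n) ≡ cellAt T tp n
  cellAt-left zero          (tape [] x rs)       zero    = refl
  cellAt-left zero          (tape (l ∷ ls) x rs) zero    = refl
  cellAt-left zero          (tape [] x rs)       (suc n) = refl
  cellAt-left zero          (tape (l ∷ ls) x rs) (suc n) = refl
  cellAt-left (suc zero)    (tape [] x rs)       zero    = refl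
  cellAt-left (suc zero)    (tape (l ∷ ls) x rs) zero    = refl
  cellAt-left (suc (suc T)) (tape [] x rs)       zero    = refl
  cellAt-left (suc (suc T)) (tape (l ∷ ls) x rs) zero    = refl
  cellAt-left (suc T)       tp                   (suc n) = cellAt-left T tp n

  -- Seen from the head, the tape moves against it: after a move to the left, a column holds what
  -- was in the column to its left. The index `suc n` provides that left neighbour.
  cellAt-act : ∀ T tp a n → cellAt T (act tp a) (suc n) ≡
    arriving a ((n ≡ᵇ T) , cellAt T tp n) ((suc n ≡ᵇ T) , cellAt T tp (suc n)) ((suc (suc n) ≡ᵇ T) , cellAt T tp (suc (suc n)))
  cellAt-act T (tape ls x rs) (y , left)  n = trans (cellAt-left T (tape ls y rs) n) (cellAt-write T ls x y rs n)
  cellAt-act T (tape ls x rs) (y , stay)  n = cellAt-write T ls x y rs (suc n)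
  cellAt-act T (tape ls x rs) (y , right) n = trans (cellAt-right T (tape ls y rs) (suc n)) (cellAt-write T ls x y rs (suc (suc n)))

  cellAt-input : ∀ T ys n → cellAt T (fromCells [] ys) n ≡ at blank (replicate T blank ++ ys) n
  cellAt-input zero    []       zero    = refl
  cellAt-input zero    (y ∷ ys) zero    = refl
  cellAt-input zero    []       (suc n) = refl
  cellAt-input zero    (y ∷ ys) (suc n) = refl
  cellAt-input (suc T) []       zero    = refl
  cellAt-input (suc T) (y ∷ ys) zero    = refl
  cellAt-input (suc T) ys       (suc n) = cellAt-input T ys n

  view : ℕ → Config M → ℕ → Cell
  view T (config q ts) n = (n ≡ᵇ T) , q , Vec.map (λ tp → cellAt T tp n) ts

  advance : Config M → Config M
  advance c = fromMaybe c (step M c)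

  view-advance : ∀ T c n → view T (advance c) (suc n) ≡ evolve (view T c T) (view T c n) (view T c (suc n)) (view T c (suc (suc n)))
  -- The head column of the view becomes the list of symbols read by `step`, so both sides branch on
  -- the same value of `δ`.
  view-advance T (config q ts) n rewrite Vec.map-cong (cellAt-head T) ts with δ q (Vec.map Tape.current ts)
  ... | nothing          = refl
  ... | just (q′ , acts) = cong (λ z → (suc n ≡ᵇ T) , q′ , z)
    (trans (sym (Vec.tabulate∘lookup _)) (Vec.tabulate-cong λ j →
      trans (Vec.lookup-map j (λ tp → cellAt T tp (suc n)) (Vec.zipWith act ts acts)) (trans (cong (λ tp → cellAt T tp (suc n)) (Vec.lookup-zipWith act j ts acts))
      (trans (cellAt-act T (Vec.lookup ts j) (Vec.lookup acts j) n)
        (sym (trans (cong₂ (λ a b → arriving (Vec.lookup acts j) ((n ≡ᵇ T) , a) ((suc n ≡ᵇ T) , b) ((suc (suc n) ≡ᵇ T) , Vec.lookup (Vec.map (λ tp → cellAt T tp (suc (suc n))) ts) j))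
            (Vec.lookup-map j (λ tp → cellAt T tp n) ts) (Vec.lookup-map j (λ tp → cellAt T tp (suc n)) ts))
          (cong (λ c → arriving (Vec.lookup acts j) ((n ≡ᵇ T) , cellAt T (Vec.lookup ts j) n) ((suc n ≡ᵇ T) , cellAt T (Vec.lookup ts j) (suc n)) ((suc (suc n) ≡ᵇ T) , c)) (Vec.lookup-map j (λ tp → cellAt T tp (suc (suc n))) ts))))))))

  run-advance : ∀ t c {r} → run M t c ≡ just r → iter t advance c ≡ r
  run-advance t c eq with step M c in stp
  run-advance zero    c refl | nothing = refl
  run-advance (suc t) c refl | nothing = halted (suc t)
    where
    halted : ∀ n → iter n advance c ≡ c
    halted zero    = refl
    halted (suc n) = trans (cong advance (halted n)) (cong (fromMaybe c) stp)
  run-advance (suc t) c eq | just c′ = trans (iter-shift advance t c) (trans (cong (λ z → iter t advance (fromMaybe c z)) stp) (run-advance t c′ eq))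

  -- T bounds the running time, v is the known part of the input, and P bounds
  -- the length of the rest.

  codes : Γ → ℕ × ℕ
  codes s = code (startCell true s) , code (startCell false s)

  -- The reduction computes with numbers and not with cells. Codes of start cells are therefore
  -- constants in pairs, with and without the head flag, from which it selects by comparing columns.
  startCode : Bool → ℕ × ℕ → ℕ
  startCode h p = if h then proj₁ p else proj₂ p

  startCode-codes : ∀ h s → startCode h (codes s) ≡ code (startCell h s)
  startCode-codes true  s = refl
  startCode-codes false s = refl

  free : List Γ
  free = bit false ∷ bit true ∷ blank ∷ []

  -- Negation by positive literals: a cell differs from `a` if it has one of the other values. A
  -- template is thus the implication from four given cells to their successor, written as a clause.
  avoiding : ℕ → List ℕ
  avoiding a = filterᵇ (λ b → not (b ≡ᵇ a)) (upTo values)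

  Template : Set
  Template = List ℕ × List ℕ × List ℕ × List ℕ × List ℕ

  template : ℕ × ℕ × ℕ × ℕ → Template
  template (a , b , c , d) = avoiding a , avoiding b , avoiding c , avoiding d ,
    code (evolve (cellOf a) (cellOf b) (cellOf c) (cellOf d)) ∷ []

  templates : List Template
  templates = map template (cartesianProduct vs (cartesianProduct vs (cartesianProduct vs vs)))
    where vs = upTo values

  acceptingValues : List ℕ
  acceptingValues = filterᵇ (λ a → accepting (proj₁ (proj₂ (cellOf a)))) (upTo values)

  module _ (T : ℕ) (v : List Bool) (P : ℕ) where

    -- The margins of T columns left of the head and right of the input let the head column stay
    -- determined for T steps; the remaining column is the blank that ends the longest input.
    width : ℕ
    width = T + (length v + P) + suc T

    allowed : List (List Γ)
    allowed = replicate T (blank ∷ []) ++ map (λ b → bit b ∷ []) v ++ replicate P free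

    allowedAt : ℕ → List Γ
    allowedAt = at (blank ∷ []) allowed

    allowedCodes : List (List (ℕ × ℕ))
    allowedCodes = replicate T (codes blank ∷ []) ++ map (λ b → codes (bit b) ∷ []) v ++ replicate P (map codes free)

    initialClause : ℕ → Clause
    initialClause x = map (λ p → literal (0 , x) (startCode (x ≡ᵇ T) p)) (at (codes blank ∷ []) allowedCodes x)

    -- After a blank only blanks follow, so the guessed symbols form a bit string with padding.
    -- Codes without head flag are right because the known input is nonempty and these columns lie
    -- beyond the head.
    blankClause : ℕ → Clause
    blankClause i = literal (0 , x) (proj₂ (codes (bit false))) ∷ literal (0 , x) (proj₂ (codes (bit true)))
        ∷ literal (0 , suc x) (proj₂ (codes blank)) ∷ []
      where x = T + (length v + i)

    stepClause : ℕ → ℕ → Template → Clause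
    stepClause t x (a , b , c , d , e) = map (literal (t , T)) a ++ map (literal (t , x)) b ++ map (literal (t , suc x)) c
      ++ map (literal (t , suc (suc x))) d ++ map (literal (suc t , suc x)) e

    acceptClause : Clause
    acceptClause = map (literal (T , T)) acceptingValues

    constraints : List Clause
    constraints = map initialClause (upTo width) ++ map blankClause (upTo P)
      ++ concat (map (λ t → concat (map (λ x → map (stepClause t x) templates) (upTo (width ∸ 2)))) (upTo T))
      ++ acceptClause ∷ []

    grid : List (ℕ × ℕ)
    grid = cartesianProduct (upTo (suc T)) (upTo width)

    configuration : List Bool → ℕ → Config M
    configuration c t = iter t advance (initial M (v ++ c))

    Accepts : List Bool → Set
    Accepts c = length c ≤ P × Bool.T (accepting (Config.state (configuration c T)))

    module A = Assignment grid (Unique.cartesianProduct⁺ (Unique.upTo⁺ (suc T)) (Unique.upTo⁺ width)) values constraints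

    private
      ∈-grid : ∀ {t x} → t ≤ T → x < width → (t , x) ∈ grid
      ∈-grid t≤T x<w = ∈-cartesianProduct⁺ (∈-upTo⁺ (s≤s t≤T)) (∈-upTo⁺ x<w)

      allowedCodes≡ : allowedCodes ≡ map (map codes) allowed
      allowedCodes≡ = sym (trans (map-++ (map codes) (replicate T _) _) (cong₂ _++_ (map-replicate (map codes) T _)
        (trans (map-++ (map codes) (map (λ b → bit b ∷ []) v) _) (cong₂ _++_ (sym (map-∘ v)) (map-replicate (map codes) P free)))))

      initialClause≡ : ∀ x → initialClause x ≡ map (λ s → literal (0 , x) (code (startCell (x ≡ᵇ T) s))) (allowedAt x)
      initialClause≡ x = trans (cong (map _) (trans (cong (λ z → at (codes blank ∷ []) z x) allowedCodes≡) (at-map (map codes) allowed x)))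
        (trans (sym (map-∘ (allowedAt x))) (map-cong (λ s → cong (literal (0 , x)) (startCode-codes (x ≡ᵇ T) s)) (allowedAt x)))

      allowedAt-left : ∀ {x} → x < T → allowedAt x ≡ blank ∷ []
      allowedAt-left {x} lt = trans (at-++ˡ (replicate T (blank ∷ [])) (subst (x <_) (sym (length-replicate T)) lt)) (at-replicate T lt)

      allowedAt-right : ∀ j → allowedAt (T + j) ≡ at (blank ∷ []) (map (λ b → bit b ∷ []) v ++ replicate P free) j
      allowedAt-right j = trans (cong (λ k → allowedAt (k + j)) (sym (length-replicate T))) (at-++ʳ (replicate T (blank ∷ [])))

      allowedAt-known : ∀ {j} → j < length v → allowedAt (T + j) ≡ at blank (map bit v) j ∷ []
      allowedAt-known {j} lt = trans (allowedAt-right j) (trans (at-++ˡ (map (λ b → bit b ∷ []) v) (subst (j <_) (sym (length-map _ v)) lt))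
        (trans (cong (λ z → at (blank ∷ []) z j) (map-∘ v)) (at-map (_∷ []) (map bit v) j)))

      allowedAt-free : ∀ i → allowedAt (T + (length v + i)) ≡ at (blank ∷ []) (replicate P free) i
      allowedAt-free i = trans (allowedAt-right (length v + i)) (trans (cong (λ k → at (blank ∷ []) (map (λ b → bit b ∷ []) v ++ replicate P free) (k + i)) (sym (length-map (λ b → bit b ∷ []) v)))
        (at-++ʳ (map (λ b → bit b ∷ []) v)))

      inputAt : List Bool → ℕ → Γ
      inputAt c = at blank (replicate T blank ++ map bit (v ++ c))

      inputAt-left : ∀ c {x} → x < T → inputAt c x ≡ blank
      inputAt-left c {x} lt = trans (at-++ˡ (replicate T blank) (subst (x <_) (sym (length-replicate T)) lt)) (at-replicate T lt)

      inputAt-right : ∀ c j → inputAt c (T + j) ≡ at blank (map bit v ++ map bit c) j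
      inputAt-right c j = trans (cong (λ k → inputAt c (k + j)) (sym (length-replicate T))) (trans (at-++ʳ (replicate T blank)) (cong (λ z → at blank z j) (map-++ bit v c)))

      inputAt-known : ∀ c {j} → j < length v → inputAt c (T + j) ≡ at blank (map bit v) j
      inputAt-known c {j} lt = trans (inputAt-right c j) (at-++ˡ (map bit v) (subst (j <_) (sym (length-map bit v)) lt))

      inputAt-free : ∀ c i → inputAt c (T + (length v + i)) ≡ at blank (map bit c) i
      inputAt-free c i = trans (inputAt-right c (length v + i)) (trans (cong (λ k → at blank (map bit v ++ map bit c) (k + i)) (sym (length-map bit v))) (at-++ʳ (map bit v)))

      view-initial : ∀ c x → view T (initial M (v ++ c)) x ≡ startCell (x ≡ᵇ T) (inputAt c x)
      view-initial c x = cong (λ z → (x ≡ᵇ T) , start , z) (cong₂ Vec._∷_ (cellAt-input T (map bit (v ++ c)) x)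
        (trans (Vec.map-replicate (λ tp → cellAt T tp x) (fromCells [] []) workTapes) (cong (Vec.replicate workTapes)
          (trans (cellAt-input T [] x) (trans (cong (λ z → at blank z x) (++-identityʳ (replicate T blank))) (at-replicate-default blank T x))))))

      data Position (x : ℕ) : Set where
        on-left  : x < T → Position x
        on-known : ∀ j → j < length v → x ≡ T + j → Position x
        on-rest  : ∀ i → x ≡ T + (length v + i) → Position x

      position : ∀ x → Position x
      position x with x <? T
      ... | yes lt = on-left lt
      ... | no ¬lt with (x ∸ T) <? length v
      ...   | yes lt = on-known (x ∸ T) lt (sym (m+[n∸m]≡n (≮⇒≥ ¬lt)))
      ...   | no ¬lt′ = on-rest (x ∸ T ∸ length v) (sym (trans (cong (λ z → T + z) (m+[n∸m]≡n (≮⇒≥ ¬lt′))) (m+[n∸m]≡n (≮⇒≥ ¬lt))))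

      rest<width : ∀ {i} → i ≤ P → T + (length v + i) < width
      rest<width {i} le = ≤-trans (≤-reflexive (+-comm 1 _)) (+-mono-≤ (+-monoʳ-≤ T (+-monoʳ-≤ (length v) le)) (s≤s z≤n))

      initial∈ : ∀ {x} → x < width → initialClause x ∈ constraints
      initial∈ lt = ∈-++⁺ˡ (∈-map⁺ initialClause (∈-upTo⁺ lt))

      blank∈ : ∀ {i} → i < P → blankClause i ∈ constraints
      blank∈ lt = ∈-++⁺ʳ (map initialClause (upTo width)) (∈-++⁺ˡ (∈-map⁺ blankClause (∈-upTo⁺ lt)))

      steps : List Clause
      steps = concat (map (λ t → concat (map (λ x → map (stepClause t x) templates) (upTo (width ∸ 2)))) (upTo T))

      step∈ : ∀ {t x a b c d} → t < T → suc (suc x) < width → a < values → b < values → c < values → d < values →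
        stepClause t x (template (a , b , c , d)) ∈ constraints
      step∈ {t} {x} t<T x<w a< b< c< d< = ∈-++⁺ʳ (map initialClause (upTo width)) (∈-++⁺ʳ (map blankClause (upTo P)) (∈-++⁺ˡ
        (∈-concat⁺′ (∈-concat⁺′ (∈-map⁺ (stepClause t x) (∈-map⁺ template (∈-cartesianProduct⁺ (∈-upTo⁺ a<) (∈-cartesianProduct⁺ (∈-upTo⁺ b<) (∈-cartesianProduct⁺ (∈-upTo⁺ c<) (∈-upTo⁺ d<))))))
            (∈-map⁺ (λ x → map (stepClause t x) templates) (∈-upTo⁺ (m+n≤o⇒m≤o∸n (suc x) (≤-trans (≤-reflexive (+-comm (suc x) 2)) x<w)))))
          (∈-map⁺ (λ t → concat (map (λ x → map (stepClause t x) templates) (upTo (width ∸ 2)))) (∈-upTo⁺ t<T)))))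

      accept∈ : acceptClause ∈ constraints
      accept∈ = ∈-++⁺ʳ (map initialClause (upTo width)) (∈-++⁺ʳ (map blankClause (upTo P)) (∈-++⁺ʳ steps (here refl)))

      literal-injective : ∀ {u w a b} → literal u a ≡ literal w b → u ≡ w × a ≡ b
      literal-injective refl = refl , refl

      literal∈ : ∀ {u w a as} → literal u a ∈ map (literal w) as → u ≡ w × a ∈ as
      literal∈ {as = as} p with ∈-map⁻ (literal _) p
      ... | b , b∈ , eq with literal-injective eq
      ... | refl , refl = refl , b∈

      ∈-avoiding : ∀ {a b} → b < values → b ≢ a → b ∈ avoiding a
      ∈-avoiding {a} {b} b< b≢a = ∈-filter⁺ (T? ∘ (λ b → not (b ≡ᵇ a))) (∈-upTo⁺ b<) (differ (b ≡ᵇ a) (λ t → b≢a (≡ᵇ⇒≡ b a t)))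
        where
        differ : ∀ e → ¬ Bool.T e → Bool.T (not e)
        differ false _ = tt
        differ true  f = f tt

      ∉-avoiding : ∀ {a} → ¬ (a ∈ avoiding a)
      ∉-avoiding {a} p = same (a ≡ᵇ a) (≡⇒≡ᵇ a a refl) (proj₂ (∈-filter⁻ (T? ∘ (λ b → not (b ≡ᵇ a))) {xs = upTo values} p))
        where
        same : ∀ e → Bool.T e → ¬ Bool.T (not e)
        same true _ ()

    -- The string consists of the bits before the first blank. A blank in front of a bit is excluded
    -- by the second hypothesis, which comes from the blank clauses.
    guess : ∀ P (s : ℕ → Γ) → (∀ {i} → i < P → s i ∈ free) → (∀ {i} → i < P → s i ≡ blank → s (suc i) ≡ blank) → s P ≡ blank →
      ∃ λ c → length c ≤ P × (∀ {i} → i ≤ P → s i ≡ at blank (map bit c) i)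
    guess zero    s h₁ h₂ end = [] , z≤n , λ { z≤n → end }
    guess (suc P) s h₁ h₂ end with guess P (s ∘ suc) (h₁ ∘ s≤s) (h₂ ∘ s≤s) end | h₁ (s≤s z≤n)
    ... | c , le , eq | here s₀         = false ∷ c , s≤s le , λ { {zero} _ → s₀ ; {suc i} (s≤s le) → eq le }
    ... | c , le , eq | there (here s₀) = true ∷ c , s≤s le , λ { {zero} _ → s₀ ; {suc i} (s≤s le) → eq le }
    ... | [] , le , eq | there (there (here s₀)) = [] , z≤n , λ { {zero} _ → s₀ ; {suc i} (s≤s le) → eq le }
    ... | b ∷ c , le , eq | there (there (here s₀)) with trans (sym (eq z≤n)) (h₂ (s≤s z≤n) s₀)
    ...   | ()

    module _ (α : ℕ × ℕ → ℕ) (α< : ∀ {v} → v ∈ grid → α v < values) (sat : ∀ {c} → c ∈ constraints → ∃ λ v → v ∈ grid × literal v (α v) ∈ c) where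

      private
        symbol : ℕ → Γ
        symbol x = Vec.head (proj₂ (proj₂ (cellOf (α (0 , x)))))

        cell≡ : ∀ x h s → α (0 , x) ≡ code (startCell h s) → cellOf (α (0 , x)) ≡ startCell h (symbol x) × symbol x ≡ s
        cell≡ x h s eq = let eq′ = trans (cong cellOf eq) (cellOf-code (startCell h s))
                             eq″ = cong (Vec.head ∘ proj₂ ∘ proj₂) eq′
                         in trans eq′ (cong (startCell h) (sym eq″)) , eq″

        initial-cell : ∀ {x} → x < width → symbol x ∈ allowedAt x × cellOf (α (0 , x)) ≡ startCell (x ≡ᵇ T) (symbol x)
        initial-cell {x} lt with sat (initial∈ lt)
        ... | u , _ , p with ∈-map⁻ (λ s → literal (0 , x) (code (startCell (x ≡ᵇ T) s))) (subst (literal u (α u) ∈_) (initialClause≡ x) p)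
        ... | s , s∈ , eq with literal-injective {u} {0 , x} eq
        ... | refl , eq′ = let c , e = cell≡ x (x ≡ᵇ T) s eq′ in subst (_∈ allowedAt x) (sym e) s∈ , c

        blank-next : ∀ {i} → i < P → symbol (T + (length v + i)) ≡ blank → symbol (T + (length v + suc i)) ≡ blank
        blank-next {i} lt eq with sat (blank∈ lt)
        ... | u , _ , here p with literal-injective {u} {0 , T + (length v + i)} p
        ...   | refl , a with trans (sym eq) (proj₂ (cell≡ _ false (bit false) a))
        ...     | ()
        blank-next {i} lt eq | u , _ , there (here p) with literal-injective {u} {0 , T + (length v + i)} p
        ...   | refl , a with trans (sym eq) (proj₂ (cell≡ _ false (bit true) a))
        ...     | ()
        blank-next {i} lt eq | u , _ , there (there (here p)) with literal-injective {u} {0 , suc (T + (length v + i))} p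
        ...   | refl , a = trans (cong symbol (trans (cong (λ z → T + z) (+-suc (length v) i)) (+-suc T (length v + i)))) (proj₂ (cell≡ _ false blank a))

        singleton : ∀ {s s′ : Γ} {ss} → ss ≡ s′ ∷ [] → s ∈ ss → s ≡ s′
        singleton refl (here eq) = eq

        guessed : ∃ λ c → length c ≤ P × (∀ {i} → i ≤ P → symbol (T + (length v + i)) ≡ at blank (map bit c) i)
        guessed = guess P (λ i → symbol (T + (length v + i)))
          (λ {i} lt → subst (symbol (T + (length v + i)) ∈_) (trans (allowedAt-free i) (at-replicate P lt)) (proj₁ (initial-cell (rest<width (<⇒≤ lt)))))
          blank-next
          (singleton (trans (allowedAt-free P) (at-default (replicate P free) (≤-reflexive (length-replicate P)))) (proj₁ (initial-cell (rest<width ≤-refl))))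

        c : List Bool
        c = proj₁ guessed

        symbol≡ : ∀ {x} → Position x → x < width → symbol x ≡ inputAt c x
        symbol≡ (on-left x<T) lt = trans (singleton (allowedAt-left x<T) (proj₁ (initial-cell lt))) (sym (inputAt-left c x<T))
        symbol≡ (on-known j j< refl) lt = trans (singleton (allowedAt-known j<) (proj₁ (initial-cell lt))) (sym (inputAt-known c j<))
        symbol≡ (on-rest i refl) lt = rest (i ≤? P)
          where
          rest : Dec (i ≤ P) → symbol (T + (length v + i)) ≡ inputAt c (T + (length v + i))
          rest (yes i≤P) = trans (proj₂ (proj₂ guessed) i≤P) (sym (inputAt-free c i))
          rest (no i≰P)  = trans (singleton (trans (allowedAt-free i) (at-default (replicate P free) (≤-trans (≤-reflexive (length-replicate P)) (<⇒≤ (≰⇒> i≰P))))) (proj₁ (initial-cell lt)))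
            (sym (trans (inputAt-free c i) (at-default (map bit c) (≤-trans (≤-reflexive (length-map bit c)) (≤-trans (proj₁ (proj₂ guessed)) (<⇒≤ (≰⇒> i≰P)))))))

        head<width : ∀ {t} → t ≤ T → T + t < width
        head<width {t} le = ≤-trans (≤-reflexive (sym (+-suc T t))) (≤-trans (+-monoʳ-≤ T (s≤s le)) (+-monoˡ-≤ (suc T) (m≤m+n T (length v + P))))

        -- Among the templates is the one for the four values that the assignment really takes. Its
        -- avoiding literals all fail, so what satisfies the clause is its conclusion.
        step≡ : ∀ {t x} → t < T → suc (suc x) < width →
          α (suc t , suc x) ≡ code (evolve (cellOf (α (t , T))) (cellOf (α (t , x))) (cellOf (α (t , suc x))) (cellOf (α (t , suc (suc x)))))
        step≡ {t} {x} t<T x<w with sat (step∈ t<T x<w (in-grid head-in) (in-grid (<⇒≤ (<⇒≤ x<w))) (in-grid (<⇒≤ x<w)) (in-grid x<w))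
          where
          head-in : T < width
          head-in = ≤-trans (≤-reflexive (cong suc (sym (+-identityʳ T)))) (head<width z≤n)
          in-grid : ∀ {x} → x < width → α (t , x) < values
          in-grid lt = α< (∈-grid (<⇒≤ t<T) lt)
        ... | u , _ , p with ∈-++⁻ (map (literal (t , T)) (avoiding (α (t , T)))) p
        ... | inj₁ q with literal∈ {u} q
        ...   | refl , q′ = ⊥-elim (∉-avoiding q′)
        step≡ {t} {x} t<T x<w | u , _ , p | inj₂ q with ∈-++⁻ (map (literal (t , x)) (avoiding (α (t , x)))) q
        ... | inj₁ r with literal∈ {u} r
        ...   | refl , r′ = ⊥-elim (∉-avoiding r′)
        step≡ {t} {x} t<T x<w | u , _ , p | inj₂ q | inj₂ r with ∈-++⁻ (map (literal (t , suc x)) (avoiding (α (t , suc x)))) r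
        ... | inj₁ s with literal∈ {u} s
        ...   | refl , s′ = ⊥-elim (∉-avoiding s′)
        step≡ {t} {x} t<T x<w | u , _ , p | inj₂ q | inj₂ r | inj₂ s with ∈-++⁻ (map (literal (t , suc (suc x))) (avoiding (α (t , suc (suc x))))) s
        ... | inj₁ y with literal∈ {u} y
        ...   | refl , y′ = ⊥-elim (∉-avoiding y′)
        step≡ {t} {x} t<T x<w | u , _ , p | inj₂ q | inj₂ r | inj₂ s | inj₂ y with literal∈ {u} y
        ... | refl , here eq = eq

        -- The clauses do not constrain the two ends of a row, so row t is
        -- determined only at distance at least t from them.
        row : ∀ t → t ≤ T → ∀ {x} → t ≤ x → x + t < width → cellOf (α (t , x)) ≡ view T (configuration c t) x
        row zero    _   {x} _ lt = trans (proj₂ (initial-cell x<w)) (trans (cong (startCell (x ≡ᵇ T)) (symbol≡ (position x) x<w)) (sym (view-initial c x)))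
          where
          x<w : x < width
          x<w = subst (_< width) (+-identityʳ x) lt
        row (suc t) t<T {suc x} (s≤s t≤x) lt = trans (cong cellOf (step≡ t<T (≤-trans (s≤s (m≤m+n _ t)) lt′))) (trans (cellOf-code _)
            (trans (cong₂ (λ a b → evolve a b (cellOf (α (t , suc x))) (cellOf (α (t , suc (suc x))))) (row t t≤T t≤T (head<width t≤T)) (row t t≤T t≤x (<⇒≤ (<⇒≤ lt′))))
            (trans (cong₂ (evolve (view T C T) (view T C x)) (row t t≤T (m≤n⇒m≤1+n t≤x) (<⇒≤ lt′)) (row t t≤T (m≤n⇒m≤1+n (m≤n⇒m≤1+n t≤x)) lt′))
              (sym (view-advance T C x)))))
          where
          C = configuration c t
          t≤T = <⇒≤ t<T
          lt′ : suc (suc x) + t < width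
          lt′ = subst (λ z → suc z < width) (+-suc x t) lt

      satisfied-accepts : ∃ Accepts
      satisfied-accepts = c , proj₁ (proj₂ guessed) , subst (λ z → Bool.T (accepting (proj₁ (proj₂ z)))) (row T ≤-refl ≤-refl (head<width ≤-refl)) accepted
        where
        accepted : Bool.T (accepting (proj₁ (proj₂ (cellOf (α (T , T))))))
        accepted with sat accept∈
        ... | u , _ , p with literal∈ {u} p
        ... | refl , q = proj₂ (∈-filter⁻ (T? ∘ (λ a → accepting (proj₁ (proj₂ (cellOf a))))) {xs = upTo values} q)

    module _ (nonempty-input : 0 < length v) (c : List Bool) (c≤P : length c ≤ P) (accepted : Bool.T (accepting (Config.state (configuration c T)))) where

      private
        α : ℕ × ℕ → ℕ
        α (t , x) = code (view T (configuration c t) x)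

        α₀ : ∀ x → α (0 , x) ≡ code (startCell (x ≡ᵇ T) (inputAt c x))
        α₀ x = cong code (view-initial c x)

        some-free : ∀ c i → at blank (map bit c) i ∈ free
        some-free []          i       = there (there (here refl))
        some-free (false ∷ c) zero    = here refl
        some-free (true ∷ c)  zero    = there (here refl)
        some-free (b ∷ c)     (suc i) = some-free c i

        input-allowed : ∀ {x} → Position x → inputAt c x ∈ allowedAt x
        input-allowed {x} (on-left x<T) = subst (inputAt c x ∈_) (sym (allowedAt-left x<T)) (here (inputAt-left c x<T))
        input-allowed {x} (on-known j j< refl) = subst (inputAt c x ∈_) (sym (allowedAt-known j<)) (here (inputAt-known c j<))
        input-allowed {x} (on-rest i refl) = rest (i <? P)
          where
          rest : Dec (i < P) → inputAt c x ∈ allowedAt x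
          rest (no i≮P)  = subst (inputAt c x ∈_) (sym (trans (allowedAt-free i) (at-default (replicate P free) (≤-trans (≤-reflexive (length-replicate P)) (≮⇒≥ i≮P)))))
            (here (trans (inputAt-free c i) (at-default (map bit c) (≤-trans (≤-reflexive (length-map bit c)) (≤-trans c≤P (≮⇒≥ i≮P))))))
          rest (yes i<P) = subst₂ _∈_ (sym (inputAt-free c i)) (sym (trans (allowedAt-free i) (at-replicate P i<P))) (some-free c i)

        off-head : ∀ i → (T + (length v + i) ≡ᵇ T) ≡ false
        off-head i = go T (length v + i) (≤-trans nonempty-input (m≤m+n _ i))
          where
          go : ∀ T k → 0 < k → (T + k ≡ᵇ T) ≡ false
          go zero    (suc k) _ = refl
          go (suc T) k       p = go T k p

        rest-code : ∀ i {s} → at blank (map bit c) i ≡ s → α (0 , T + (length v + i)) ≡ code (startCell false s)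
        rest-code i eq = trans (α₀ _) (cong₂ (λ h s → code (startCell h s)) (off-head i) (trans (inputAt-free c i) eq))

        blanks : ∀ c i → (∃ λ b → at blank (map (bit {extra}) c) i ≡ bit b) ⊎ at blank (map (bit {extra}) c) (suc i) ≡ blank
        blanks []      i       = inj₂ refl
        blanks (b ∷ c) zero    = inj₁ (b , refl)
        blanks (b ∷ c) (suc i) = blanks c i

        Good : Clause → Set
        Good cl = ∃ λ u → u ∈ grid × literal u (α u) ∈ cl

        good-initial : ∀ {x} → x < width → Good (initialClause x)
        good-initial {x} lt = (0 , x) , ∈-grid z≤n lt , subst (literal (0 , x) (α (0 , x)) ∈_) (sym (initialClause≡ x))
          (subst (λ z → literal (0 , x) z ∈ map (λ s → literal (0 , x) (code (startCell (x ≡ᵇ T) s))) (allowedAt x)) (sym (α₀ x))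
            (∈-map⁺ (λ s → literal (0 , x) (code (startCell (x ≡ᵇ T) s))) (input-allowed (position x))))

        good-blank : ∀ {i} → i < P → Good (blankClause i)
        good-blank {i} lt with blanks c i
        ... | inj₁ (false , eq) = (0 , x) , ∈-grid z≤n (rest<width (<⇒≤ lt)) , here (cong (literal (0 , x)) (rest-code i eq))
          where x = T + (length v + i)
        ... | inj₁ (true , eq) = (0 , x) , ∈-grid z≤n (rest<width (<⇒≤ lt)) , there (here (cong (literal (0 , x)) (rest-code i eq)))
          where x = T + (length v + i)
        ... | inj₂ eq = (0 , suc x) , ∈-grid z≤n (subst (_< width) shift (rest<width lt)) ,
            there (there (here (cong (literal (0 , suc x)) (trans (cong (λ z → α (0 , z)) (sym shift)) (rest-code (suc i) eq)))))
          where
          x = T + (length v + i)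
          shift : T + (length v + suc i) ≡ suc x
          shift = trans (cong (λ z → T + z) (+-suc (length v) i)) (+-suc T (length v + i))

        -- A template with a wrong premise is satisfied at the cell that differs from it; if all
        -- four premises are right, the conclusion is `view-advance`.
        good-step : ∀ {t x} → t < T → suc (suc x) < width → ∀ a b e d → Good (stepClause t x (template (a , b , e , d)))
        good-step {t} {x} t<T x<w a b e d with α (t , T) ≟ a | α (t , x) ≟ b | α (t , suc x) ≟ e | α (t , suc (suc x)) ≟ d
        ... | no ≢a | _ | _ | _ = (t , T) , ∈-grid (<⇒≤ t<T) (≤-trans (s≤s (m≤m+n T (length v + P))) (≤-trans (≤-reflexive (+-comm 1 _)) (+-monoʳ-≤ (T + (length v + P)) (s≤s z≤n)))) ,
          ∈-++⁺ˡ (∈-map⁺ (literal (t , T)) (∈-avoiding (code<values _) ≢a))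
        ... | yes _ | no ≢b | _ | _ = (t , x) , ∈-grid (<⇒≤ t<T) (<⇒≤ (<⇒≤ x<w)) ,
          ∈-++⁺ʳ (map (literal (t , T)) (avoiding a)) (∈-++⁺ˡ (∈-map⁺ (literal (t , x)) (∈-avoiding (code<values _) ≢b)))
        ... | yes _ | yes _ | no ≢e | _ = (t , suc x) , ∈-grid (<⇒≤ t<T) (<⇒≤ x<w) ,
          ∈-++⁺ʳ (map (literal (t , T)) (avoiding a)) (∈-++⁺ʳ (map (literal (t , x)) (avoiding b)) (∈-++⁺ˡ (∈-map⁺ (literal (t , suc x)) (∈-avoiding (code<values _) ≢e))))
        ... | yes _ | yes _ | yes _ | no ≢d = (t , suc (suc x)) , ∈-grid (<⇒≤ t<T) x<w ,
          ∈-++⁺ʳ (map (literal (t , T)) (avoiding a)) (∈-++⁺ʳ (map (literal (t , x)) (avoiding b)) (∈-++⁺ʳ (map (literal (t , suc x)) (avoiding e))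
            (∈-++⁺ˡ (∈-map⁺ (literal (t , suc (suc x))) (∈-avoiding (code<values _) ≢d)))))
        ... | yes refl | yes refl | yes refl | yes refl = (suc t , suc x) , ∈-grid t<T (<⇒≤ x<w) ,
          ∈-++⁺ʳ (map (literal (t , T)) (avoiding a)) (∈-++⁺ʳ (map (literal (t , x)) (avoiding b)) (∈-++⁺ʳ (map (literal (t , suc x)) (avoiding e))
            (∈-++⁺ʳ (map (literal (t , suc (suc x))) (avoiding d)) (here (cong (literal (suc t , suc x)) follows)))))
          where
          C = configuration c t
          follows : α (suc t , suc x) ≡ code (evolve (cellOf (α (t , T))) (cellOf (α (t , x))) (cellOf (α (t , suc x))) (cellOf (α (t , suc (suc x)))))
          follows = cong code (trans (view-advance T C x)
            (trans (cong₂ (λ a b → evolve a b (view T C (suc x)) (view T C (suc (suc x)))) (sym (cellOf-code (view T C T))) (sym (cellOf-code (view T C x))))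
              (cong₂ (evolve (cellOf (α (t , T))) (cellOf (α (t , x)))) (sym (cellOf-code (view T C (suc x)))) (sym (cellOf-code (view T C (suc (suc x))))))))

        good-accept : Good acceptClause
        good-accept = (T , T) , ∈-grid ≤-refl (≤-trans (s≤s (m≤m+n T (length v + P))) (≤-trans (≤-reflexive (+-comm 1 _)) (+-monoʳ-≤ (T + (length v + P)) (s≤s z≤n)))) ,
          ∈-map⁺ (literal (T , T)) (∈-filter⁺ (T? ∘ (λ a → accepting (proj₁ (proj₂ (cellOf a))))) (∈-upTo⁺ (code<values _))
            (subst (λ z → Bool.T (accepting (proj₁ (proj₂ z)))) (sym (cellOf-code (view T (configuration c T) T))) accepted))

        good : ∀ {cl} → cl ∈ constraints → Good cl
        good p with ∈-++⁻ (map initialClause (upTo width)) p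
        ... | inj₁ q with ∈-map⁻ initialClause q
        ...   | x , x∈ , refl = good-initial (∈-upTo⁻ x∈)
        good p | inj₂ q with ∈-++⁻ (map blankClause (upTo P)) q
        ... | inj₁ r with ∈-map⁻ blankClause r
        ...   | i , i∈ , refl = good-blank (∈-upTo⁻ i∈)
        good p | inj₂ q | inj₂ r with ∈-++⁻ steps r
        ... | inj₂ (here refl) = good-accept
        ... | inj₁ s with ∈-concat⁻′ (map (λ t → concat (map (λ x → map (stepClause t x) templates) (upTo (width ∸ 2)))) (upTo T)) s
        ...   | _ , s₁ , s₂ with ∈-map⁻ (λ t → concat (map (λ x → map (stepClause t x) templates) (upTo (width ∸ 2)))) s₂
        ...     | t , t∈ , refl with ∈-concat⁻′ (map (λ x → map (stepClause t x) templates) (upTo (width ∸ 2))) s₁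
        ...       | _ , s₃ , s₄ with ∈-map⁻ (λ x → map (stepClause t x) templates) s₄
        ...         | x , x∈ , refl with ∈-map⁻ (stepClause t x) s₃
        ...           | _ , k∈ , refl with ∈-map⁻ template k∈
        ...             | (a , b , e , d) , _ , refl = good-step (∈-upTo⁻ t∈) (inside (∈-upTo⁻ x∈)) a b e d
          where
          inside : ∀ {x} → x < width ∸ 2 → suc (suc x) < width
          inside {x} lt = ≤-trans (≤-reflexive (+-comm 2 (suc x))) (≤-trans (+-monoˡ-≤ 2 lt) (≤-reflexive (m∸n+n≡m 2≤width)))
            where
            2≤width : 2 ≤ width
            2≤width = ≮⇒≥ λ w<2 → n≮0 (≤-trans lt (≤-reflexive (m≤n⇒m∸n≡0 (<⇒≤ w<2))))

      accepts-satisfied : A.Satisfiable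
      accepts-satisfied = α , (λ _ → code<values _) , good

    tableau-correct : 0 < length v → A.Satisfiable ⇔ ∃ Accepts
    tableau-correct ne = mk⇔ (λ { (α , α< , sat) → satisfied-accepts α α< sat }) (λ { (c , le , acc) → accepts-satisfied ne c le acc })

-- The reduction as a polynomial-time function

cartesianProductF : ∀ {Γ A B} → Fun Γ (list A) → Fun Γ (list B) → Fun Γ (list (A ⊗ B))
cartesianProductF xs ys = concatF (mapF (mapF (sndF ∘F fstF ,F sndF) (ys ∘F fstF)) xs)
  as (λ γ → cartesianProduct (fn xs γ) (fn ys γ)) by-ext λ γ → lemma (fn xs γ) (fn ys γ)
  where
  lemma : ∀ {X Y : Set} (xs : List X) (ys : List Y) → concat (map (λ x → map (λ y → x , y) ys) xs) ≡ cartesianProduct xs ys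
  lemma []       ys = refl
  lemma (x ∷ xs) ys = cong (map (x ,_) ys ++_) (lemma xs ys)

replicateF : ∀ {Γ A} → Fun Γ nat → ⟦ A ⟧ → Fun Γ (list A)
replicateF {Γ} {A} n x = mapF {A = 𝟙} (constF x) (unitsF n)
  as (λ γ → replicate (fn n γ) x) by-ext λ γ → map-replicate (λ _ → x) (fn n γ) tt

tableF : ∀ {Γ A} (f : Bool → ⟦ A ⟧) → Fun Γ bool → Fun Γ A
tableF f b = ifF b (constF (f true)) (constF (f false)) as (λ γ → f (fn b γ)) by-ext λ γ → lemma (fn b γ)
  where
  lemma : ∀ b → (if b then f true else f false) ≡ f b
  lemma true  = refl
  lemma false = refl

evalF : ∀ {Γ} → Polynomial → Fun Γ nat → Fun Γ nat
evalF []      n = constF 0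
evalF (a ∷ p) n = constF a +F n *F evalF p n

fn-evalF : ∀ {Γ} p (n : Fun Γ nat) γ → fn (evalF p n) γ ≡ eval p (fn n γ)
fn-evalF []      n γ = refl
fn-evalF (a ∷ p) n γ = cong (λ r → a + fn n γ * r) (fn-evalF p n γ)

eval-mono : ∀ p {m n} → m ≤ n → eval p m ≤ eval p n
eval-mono []      le = z≤n
eval-mono (a ∷ p) le = +-monoʳ-≤ a (*-mono-≤ le (eval-mono p le))

litTy nodeTy : Ty
litTy  = nat ⊗ nat ⊗ nat
nodeTy = bool ⊗ bool ⊗ litTy ⊗ list litTy

literalF : ∀ {Γ} → Fun Γ (nat ⊗ nat) → Fun Γ nat → Fun Γ litTy
literalF v a = fstF ∘F v ,F sndF ∘F v ,F a

eqLitF : ∀ {Γ} → Fun Γ litTy → Fun Γ litTy → Fun Γ bool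
eqLitF l m = andF (eqF (fstF ∘F l) (fstF ∘F m)) (andF (eqF (fstF ∘F sndF ∘F l) (fstF ∘F sndF ∘F m)) (eqF (sndF ∘F sndF ∘F l) (sndF ∘F sndF ∘F m)))

arcF : ∀ {Γ} → Fun Γ nodeTy → Fun Γ nodeTy → Fun Γ bool
arcF u v = andF (notF (fstF ∘F v)) (orF (fstF ∘F sndF ∘F v) (andF (fstF ∘F u)
  (anyF (eqLitF (fstF ∘F sndF ∘F sndF ∘F u ∘F fstF) sndF) (sndF ∘F sndF ∘F sndF ∘F v))))

nodesF : ∀ {Γ} → Fun Γ (list litTy) → Fun Γ (list (list litTy)) → Fun Γ (list nodeTy)
nodesF ls cs = mapF (constF true ,F constF false ,F sndF ,F constF []) ls
  ++F mapF (constF false ,F constF false ,F constF (0 , 0 , 0) ,F sndF) cs ++F constF (sinkNode ∷ [])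

graphCodeF : Fun (list nodeTy ⊗ nat ⊗ nat) bits
graphCodeF = encodeUnaryF (lengthF ns)
  ++F concatF (mapF (letF (lengthF (filterF (arcF (sndF ∘F fstF) sndF) (ns ∘F fstF)))
        (concatF (mapF (ifF (arcF (sndF ∘F fstF ∘F fstF) sndF) (consF (constF true) (constF (encodeBinary 1) ++F encodeBinaryF (sndF ∘F fstF))) (constF (false ∷ []))) (ns ∘F fstF ∘F fstF)))) ns)
  ++F encodeBinaryF (fstF ∘F sndF) ++F encodeBinaryF (lengthF ns) ++F constF (encodeBinary 1) ++F constF (encodeUnary 1) ++F encodeBinaryF (sndF ∘F sndF)
  where
  ns : Fun (list nodeTy ⊗ nat ⊗ nat) (list nodeTy)
  ns = fstF

module Reduction (M : TM) where

  open Tableau M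

  inputTy : Ty
  inputTy = bits ⊗ nat ⊗ nat

  private
    vF : Fun inputTy bits
    vF = fstF

    TF PF widthF : Fun inputTy nat
    TF = fstF ∘F sndF
    PF = sndF ∘F sndF
    widthF = TF +F (lengthF vF +F PF) +F sucF TF

    gridF : Fun inputTy (list (nat ⊗ nat))
    gridF = cartesianProductF (upToF (sucF TF)) (upToF widthF)

    choicesF : Fun (inputTy ⊗ nat ⊗ nat) (list litTy)
    choicesF = mapF (literalF (sndF ∘F fstF) sndF) (constF (upTo values))

    allowedCodesF : Fun inputTy (list (list (nat ⊗ nat)))
    allowedCodesF = replicateF TF (codes blank ∷ []) ++F mapF (tableF {A = list (nat ⊗ nat)} (λ b → codes (bit b) ∷ []) sndF) vF ++F replicateF PF (map codes free)

    initialClauseF : Fun (inputTy ⊗ nat) (list litTy)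
    initialClauseF = mapF (literalF (constF 0 ,F sndF ∘F fstF) (ifF (eqF (sndF ∘F fstF) (TF ∘F fstF ∘F fstF)) (fstF ∘F sndF) (sndF ∘F sndF)))
      (atF (codes blank ∷ []) (allowedCodesF ∘F fstF) sndF)

    blankClauseF : Fun (inputTy ⊗ nat) (list litTy)
    blankClauseF = consF (literalF (constF 0 ,F x) (constF (proj₂ (codes (bit false))))) (consF (literalF (constF 0 ,F x) (constF (proj₂ (codes (bit true)))))
        (consF (literalF (constF 0 ,F sucF x) (constF (proj₂ (codes blank)))) (constF [])))
      where
      x : Fun (inputTy ⊗ nat) nat
      x = TF ∘F fstF +F (lengthF (vF ∘F fstF) +F sndF)

    templateTy : Ty
    templateTy = list nat ⊗ list nat ⊗ list nat ⊗ list nat ⊗ list nat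

    stepClauseF : Fun (((inputTy ⊗ nat) ⊗ nat) ⊗ templateTy) (list litTy)
    stepClauseF = at-cell (t ,F TF ∘F fstF ∘F fstF ∘F fstF) (fstF ∘F sndF) ++F at-cell (t ,F x) (fstF ∘F sndF ∘F sndF)
        ++F at-cell (t ,F sucF x) (fstF ∘F sndF ∘F sndF ∘F sndF) ++F at-cell (t ,F sucF (sucF x)) (fstF ∘F sndF ∘F sndF ∘F sndF ∘F sndF)
        ++F at-cell (sucF t ,F sucF x) (sndF ∘F sndF ∘F sndF ∘F sndF ∘F sndF)
      where
      t x : Fun (((inputTy ⊗ nat) ⊗ nat) ⊗ templateTy) nat
      t = sndF ∘F fstF ∘F fstF
      x = sndF ∘F fstF
      at-cell : ∀ {Γ} → Fun Γ (nat ⊗ nat) → Fun Γ (list nat) → Fun Γ (list litTy)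
      at-cell v as = mapF (literalF (v ∘F fstF) sndF) as

    constraintsF : Fun inputTy (list (list litTy))
    constraintsF = mapF initialClauseF (upToF widthF) ++F mapF blankClauseF (upToF PF)
      -- The templates depend on the machine only, so for the reduction they are a constant of
      -- constant size.
      ++F concatF (mapF (concatF (mapF (mapF stepClauseF (constF {B = list templateTy} templates)) (upToF ((widthF ∸F constF 2) ∘F fstF)))) (upToF TF))
      ++F consF (mapF (literalF (TF ∘F fstF ,F TF ∘F fstF) sndF) (constF acceptingValues)) (constF [])

    clausesF : Fun inputTy (list (list litTy))
    clausesF = mapF choicesF gridF ++F constraintsF

  abstract

    coreF : Fun inputTy bits
    coreF = graphCodeF ∘F (nodesF (concatF (mapF choicesF gridF)) clausesF ,F lengthF gridF ,F sucF (lengthF clausesF))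

    -- By computation, since each combinator carries its intended function; the surrounding
    -- `abstract` keeps this large term folded in what follows.
    coreF-correct : ∀ v T P → fn coreF (v , T , P) ≡ graphCode (A.graph T v P) (length (grid T v P)) (suc (length (A.clauses T v P)))
    coreF-correct v T P = refl

module Hardness (B R : Language) (p : Polynomial) (M : TM) (q : Polynomial) (decider : ∀ w → ∃ λ c → run M (eval q (length w)) (initial M w) ≡ just c × (R w ⇔ T (accepts M c))) (witness : ∀ w → B w ⇔ (∃ λ c → length c ≤ eval p (length w) × R (pair w c))) where

  open Tableau M
  open Reduction M

  private
    P time : List Bool → ℕ
    P w    = eval p (length w)
    time w = eval q (length (delimit w) + P w)

  reduce : List Bool → List Bool
  reduce w = fn coreF (delimit w , time w , P w)

  private
    lenF : Fun bits nat
    lenF = lengthF {bits} {bool} idF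

    PF : Fun bits nat
    PF = evalF p lenF as P by-ext fn-evalF p lenF

    delimitedF : Fun bits bits
    delimitedF = delimitF {bits} idF

    totalF : Fun bits nat
    totalF = lengthF {bits} {bool} delimitedF +F PF

    timeF : Fun bits nat
    timeF = evalF q totalF as time by-ext fn-evalF q totalF

  reduceF : Fun bits bits
  reduceF = coreF ∘F (delimitedF ,F timeF ,F PF)

  private
    -- The time is computed for the longest admissible certificate. Polynomials with natural
    -- coefficients are monotone, so it suffices for shorter ones, and runs that end early stay
    -- where they are.
    accepts⇔ : ∀ w {c} → length c ≤ P w → R (pair w c) ⇔ T (TM.accepting M (Config.state (configuration (time w) (delimit w) (P w) c (time w))))
    accepts⇔ w {c} le = subst (λ z → R (pair w c) ⇔ T (TM.accepting M (Config.state z))) (sym final) (proj₂ (proj₂ (decider (pair w c))))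
      where
      final : configuration (time w) (delimit w) (P w) c (time w) ≡ proj₁ (decider (pair w c))
      final = run-advance (time w) (initial M (pair w c)) (run-mono M
        (eval-mono q (≤-trans (≤-reflexive (length-++ (delimit w))) (+-monoʳ-≤ (length (delimit w)) le))) (initial M (pair w c)) (proj₁ (proj₂ (decider (pair w c)))))

    member⇔ : ∀ w → B w ⇔ ∃ (Accepts (time w) (delimit w) (P w))
    member⇔ w = mk⇔
      (λ b → let c , le , r = ⇒ (witness w) b in c , le , ⇒ (accepts⇔ w le) r)
      (λ { (c , le , a) → ⇐ (witness w) (c , le , ⇐ (accepts⇔ w le) a) })

    delimit-nonempty : ∀ w → 0 < length (delimit w)
    delimit-nonempty []      = s≤s z≤n
    delimit-nonempty (b ∷ w) = s≤s z≤n

    code⇔ : ∀ w → T-BS (reduce w) ⇔ A.Satisfiable (time w) (delimit w) (P w)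
    code⇔ w = subst (λ z → T-BS z ⇔ A.Satisfiable t v k) (sym (coreF-correct v t k))
      -- The cell (0 , 0) shows that there is a variable, hence a seed.
      (A.reduction-correct t v k {0 , 0} (∈-cartesianProduct⁺ (∈-upTo⁺ {suc t} (s≤s z≤n)) (∈-upTo⁺ {width t v k} (≤-trans (s≤s z≤n) (m≤n+m (suc t) (t + (length v + k)))))))
      where
      t = time w
      v = delimit w
      k = P w

  reduction : B ≤ₚ T-BS
  reduction = reduce , Fun-computable reduceF , λ w → mk⇔
    (λ b → ⇐ (code⇔ w) (⇐ (tableau⇔ w) (⇒ (member⇔ w) b)))
    (λ t → ⇐ (member⇔ w) (⇒ (tableau⇔ w) (⇒ (code⇔ w) t)))
    where
    tableau⇔ : ∀ w → A.Satisfiable (time w) (delimit w) (P w) ⇔ ∃ (Accepts (time w) (delimit w) (P w))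
    tableau⇔ w = tableau-correct (time w) (delimit w) (P w) (delimit-nonempty w)

T-BS-NPHard : NPHard T-BS
T-BS-NPHard B (R , p , (M , q , decider) , witness) = Hardness.reduction B R p M q decider witness

mainTheorem1 : NPComplete T-BS
mainTheorem1 = T-BS∈NP , T-BS-NPHard
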